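{- Let $p$ be an odd prime, $n\ge 0$, and for $\psi\in\{\chi_0,\chi_p\}$ let $c_\psi(s)_{ij}$ ($0\le i,j\le n$) be the $(i,j)$-entry of the inverse of the upper triangular matrix $B_\psi(s)=(b_\psi(s)_{ij})_{0\le i,j\le n}$. Then, as rational functions of $p^{ -s}$: (1) For $\psi=\chi_0$ and $0\le i\le j\le n$, $$c_{\chi_0}(s)_{ij}=\frac{p^{\frac{(j-i)(j-i+2)}4-(j-i)s}(1-p^{i-s})\prod_{k=i+1}^j(p^k-1)}{(1-p^{j-s})\prod_{k=1}^{(j-i)/2}(1-p^{i+j-1+2k-2s})(p^{2k}-1)}\quad\text{if } i\equiv j\bmod2,$$ $$c_{\chi_0}(s)_{ij}=\frac{p^{\frac{(j-i)^2-1}4-(j-i)s}\prod_{k=i+1}^j(p^k-1)}{(1-p^{j-s})\prod_{k=1}^{(j-i-1)/2}(1-p^{i+j+2k-2s})(p^{2k}-1)}\quad\text{if } i\not\equiv j\bmod2.$$ (2) For $\psi=\chi_p$ and $0\le i\le j\le n$ with $i\equiv j\bmod2$, $$c_{\chi_p}(s)_{ij}=\frac{\chi_p(-1)^{\frac{j-i}2}\,p^{\frac{j-i}2(\frac{j-i}2-2s)}\prod_{k=i+1}^j(p^k-1)}{\prod_{k=1}^{(j-i)/2}(1-p^{i+j-1+2k-2s})(p^{2k}-1)}.$$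
   Context: $p$ is a fixed odd prime; $\chi_0$ is the trivial and $\chi_p=(\frac{\cdot}{p})$ the quadratic Dirichlet character modulo $p$. Empty products equal $1$. For $0\le i\le j$ let $$m_{\chi_0}(s)_{ij}=\frac{p^{si-\frac{j(j+1)}2+\frac{(j-i)(j-i+2)}4}\prod_{r=i+1}^j(p^r-1)}{\prod_{r=1}^{(j-i)/2}(p^{2r}-1)}\ (j-i\text{ even}),$$ $$m_{\chi_0}(s)_{ij}=\frac{p^{si-\frac{j(j+1)}2+\frac{(j-i)^2-1}4}\prod_{r=i+1}^j(p^r-1)}{\prod_{r=1}^{(j-i-1)/2}(p^{2r}-1)}\ (j-i\text{ odd}),$$ $$m_{\chi_p}(s)_{ij}=\frac{\chi_p(-1)^{\frac{j-i}2}p^{si-\frac{j(j+1)}2+\frac{(j-i)^2}4}\prod_{k=i+1}^j(p^k-1)}{\prod_{k=1}^{(j-i)/2}(p^{2k}-1)}\ (j-i\text{ even}),\qquad m_{\chi_p}(s)_{ij}=0\ (j-i\text{ odd}).$$ (For $i>j$, $m_\psi(s)_{ij}=0$.) Define $b_\psi(s)_{ij}$ inductively by $b_\psi(s)_{ij}=0$ for $i>j$, $b_\psi(s)_{ii}=1$, and for $i<j$ $$b_\psi(s)_{ij}=\frac{p^{ -js+j(j+1)/2}}{p^{(j-i)((j+i+1)/2-s)}-1}\sum_{k=i}^{j-1}m_\psi(s)_{kj}\,b_\psi(s)_{ik}.$$ -}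

module Defs where

open import Algebra.Bundles.Raw using (RawRing)
import Algebra.Definitions.RawSemiring as RawSemiringOps
open import Data.Bool using (if_then_else_)
open import Data.Fin using (Fin; toℕ)
import Data.Fin as Fin
open import Data.Fin.Properties using (any?; toℕ<n)
open import Data.Integer as ℤ using (ℤ; +_; -[1+_]; 0ℤ; 1ℤ; -1ℤ)
open import Data.Integer.Divisibility.Signed using (_∣?_)
import Data.Integer.Properties as ℤ
open import Data.List using (List; []; _∷_; map)
open import Data.List.Relation.Unary.Any as Any using (Any; here; there)
open import Data.Nat as ℕ using (ℕ; zero; suc; z≤n; s≤s)
import Data.Nat.Properties as ℕ
open import Data.Product using (∃; _×_; _,_)
open import Data.Sum using ([_,_]′)
open import Relation.Binary.Definitions using (tri<; tri≈; tri>)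
open import Relation.Binary.PropositionalEquality
open import Relation.Nullary using (¬?; yes; no; does; contradiction)

-- ℤ[X]: coefficient lists, lowest degree first, trailing zeros allowed

Poly : Set
Poly = List ℤ

coeff : Poly → ℕ → ℤ
coeff []      _       = 0ℤ
coeff (a ∷ f) zero    = a
coeff (a ∷ f) (suc k) = coeff f k

infix  4 _≈ₚ_
infixl 6 _+ₚ_
infixl 7 _*ₚ_ _·ₚ_

_≈ₚ_ : Poly → Poly → Set
f ≈ₚ g = ∀ k → coeff f k ≡ coeff g k

_+ₚ_ : Poly → Poly → Poly
[]      +ₚ g       = g
(a ∷ f) +ₚ []      = a ∷ f
(a ∷ f) +ₚ (b ∷ g) = (a ℤ.+ b) ∷ (f +ₚ g)

_·ₚ_ : ℤ → Poly → Poly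
a ·ₚ f = map (a ℤ.*_) f

_*ₚ_ : Poly → Poly → Poly
[]      *ₚ g = []
(a ∷ f) *ₚ g = a ·ₚ g +ₚ (0ℤ ∷ f *ₚ g)

Nonzero : Poly → Set
Nonzero = Any (_≢ 0ℤ)

-- ℤ[X] is a domain, by comparing lowest terms.

data Order : ℕ → Poly → Set where
  here  : ∀ {a f} → a ≢ 0ℤ → Order zero (a ∷ f)
  there : ∀ {k a f} → a ≡ 0ℤ → Order k f → Order (suc k) (a ∷ f)

data Vanish : ℕ → Poly → Set where
  nil  : ∀ {k} → Vanish k []
  zero : ∀ {f} → Vanish zero f
  suc  : ∀ {k a f} → a ≡ 0ℤ → Vanish k f → Vanish (suc k) (a ∷ f)

order⇒nonzero : ∀ {k f} → Order k f → Nonzero f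
order⇒nonzero (here a≢0)  = here a≢0
order⇒nonzero (there _ o) = there (order⇒nonzero o)

nonzero⇒order : ∀ {f} → Nonzero f → ∃ λ k → Order k f
nonzero⇒order (here a≢0) = zero , here a≢0
nonzero⇒order {a ∷ f} (there nz) with a ℤ.≟ 0ℤ | nonzero⇒order nz
... | yes a≡0 | k , o = suc k , there a≡0 o
... | no  a≢0 | _     = zero , here a≢0

order⇒vanish : ∀ {k f} → Order k f → Vanish k f
order⇒vanish (here _)      = zero
order⇒vanish (there a≡0 o) = suc a≡0 (order⇒vanish o)

0·-vanish : ∀ k {a} f → a ≡ 0ℤ → Vanish k (a ·ₚ f)
0·-vanish zero    f       _    = zero
0·-vanish (suc k) []      _    = nil
0·-vanish (suc k) (b ∷ f) refl = suc refl (0·-vanish k f refl)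

·-vanish : ∀ {k} a {f} → Vanish k f → Vanish k (a ·ₚ f)
·-vanish a nil          = nil
·-vanish a zero         = zero
·-vanish a (suc refl v) = suc (ℤ.*-zeroʳ a) (·-vanish a v)

+-vanish : ∀ {k f g} → Vanish k f → Vanish k g → Vanish k (f +ₚ g)
+-vanish nil          w            = w
+-vanish zero         w            = zero
+-vanish (suc e v)    nil          = suc e v
+-vanish (suc refl v) (suc refl w) = suc refl (+-vanish v w)

*-vanish : ∀ {k} f {g} → Vanish k g → Vanish k (f *ₚ g)
*-vanish         []      v = nil
*-vanish {zero}  (a ∷ f) v = zero
*-vanish {suc k} (a ∷ f) v =
  +-vanish (·-vanish a v) (suc refl (*-vanish f (weaken v)))
  where
  weaken : ∀ {k f} → Vanish (suc k) f → Vanish k f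
  weaken         nil       = nil
  weaken {zero}  (suc _ _) = zero
  weaken {suc k} (suc e v) = suc e (weaken v)

·-order : ∀ {k a f} → a ≢ 0ℤ → Order k f → Order k (a ·ₚ f)
·-order {a = a} a≢0 (here b≢0) =
  here λ ab≡0 → [ a≢0 , b≢0 ]′ (ℤ.i*j≡0⇒i≡0∨j≡0 a ab≡0)
·-order {a = a} a≢0 (there refl o) = there (ℤ.*-zeroʳ a) (·-order a≢0 o)

+-orderˡ : ∀ {k f g} → Order k f → Vanish (suc k) g → Order k (f +ₚ g)
+-orderˡ o              nil          = +-[] o
  where
  +-[] : ∀ {k f} → Order k f → Order k (f +ₚ [])
  +-[] (here e)    = here e
  +-[] (there e o) = there e o
+-orderˡ (here {a} a≢0) (suc refl _) =
  here λ e → a≢0 (trans (sym (ℤ.+-identityʳ a)) e)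
+-orderˡ (there refl o) (suc refl v) = there refl (+-orderˡ o v)

+-orderʳ : ∀ {k f g} → Vanish (suc k) f → Order k g → Order k (f +ₚ g)
+-orderʳ nil          o              = o
+-orderʳ (suc refl _) (here {b} b≢0) =
  here λ e → b≢0 (trans (sym (ℤ.+-identityˡ b)) e)
+-orderʳ (suc refl v) (there refl o) = there refl (+-orderʳ v o)

*-order : ∀ {j k f g} → Order j f → Order k g → Order (j ℕ.+ k) (f *ₚ g)
*-order {f = _ ∷ f} (here a≢0) o =
  +-orderˡ (·-order a≢0 o) (suc refl (*-vanish f (order⇒vanish o)))
*-order {g = g} (there {j} a≡0 o) o′ =
  +-orderʳ (0·-vanish _ g a≡0) (there refl (*-order o o′))

*-nonzero : ∀ {f g} → Nonzero f → Nonzero g → Nonzero (f *ₚ g)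
*-nonzero nf ng with nonzero⇒order nf | nonzero⇒order ng
... | _ , o | _ , o′ = order⇒nonzero (*-order o o′)

-- ℚ(X), as the field of fractions of ℤ[X]

record RatFun : Set where
  no-eta-equality; pattern
  constructor _÷_⟨_⟩
  field
    num         : Poly
    den         : Poly
    den-nonzero : Nonzero den
open RatFun public

infix  4 _≈_
infix  8 -_ _⁻¹
infixl 7 _*_ _/_
infixl 6 _+_ _-_

_≈_ : RatFun → RatFun → Set
f ≈ g = num f *ₚ den g ≈ₚ num g *ₚ den f

fromℤ : ℤ → RatFun
fromℤ a = (a ∷ []) ÷ (1ℤ ∷ []) ⟨ here (λ ()) ⟩

0# 1# X : RatFun
0# = fromℤ 0ℤ
1# = fromℤ 1ℤ
X  = (0ℤ ∷ 1ℤ ∷ []) ÷ (1ℤ ∷ []) ⟨ here (λ ()) ⟩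

_+_ _*_ : RatFun → RatFun → RatFun
(f ÷ f′ ⟨ nf ⟩) + (g ÷ g′ ⟨ ng ⟩) =
  (f *ₚ g′ +ₚ g *ₚ f′) ÷ (f′ *ₚ g′) ⟨ *-nonzero nf ng ⟩
(f ÷ f′ ⟨ nf ⟩) * (g ÷ g′ ⟨ ng ⟩) =
  (f *ₚ g) ÷ (f′ *ₚ g′) ⟨ *-nonzero nf ng ⟩

-_ : RatFun → RatFun
- (f ÷ f′ ⟨ nf ⟩) = (-1ℤ ·ₚ f) ÷ f′ ⟨ nf ⟩

_-_ : RatFun → RatFun → RatFun
f - g = f + (- g)

-- Total inverse with the convention 0 ⁻¹ = 0; it is only ever applied below
-- to elements that are nonzero in ℚ(X) when p is prime.
_⁻¹ : RatFun → RatFun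
(f ÷ f′ ⟨ _ ⟩) ⁻¹ with Any.any? (λ a → ¬? (a ℤ.≟ 0ℤ)) f
... | yes nf = f′ ÷ f ⟨ nf ⟩
... | no  _  = 0#

_/_ : RatFun → RatFun → RatFun
f / g = f * g ⁻¹

rawRing : RawRing _ _
rawRing = record
  { Carrier = RatFun ; _≈_ = _≈_ ; _+_ = _+_ ; _*_ = _*_
  ; -_ = -_ ; 0# = 0# ; 1# = 1# }

open RawSemiringOps (RawRing.rawSemiring rawRing) public
  using (_^_; sum; product)

infixr 8 _^ᶻ_
_^ᶻ_ : RatFun → ℤ → RatFun
f ^ᶻ (+ k)    = f ^ k
f ^ᶻ -[1+ k ] = (f ⁻¹) ^ suc k

-- ∑[ a ⋯ b ] h = h a + … + h b and ∏[ a ⋯ b ] h = h a * … * h b,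
-- empty when b < a.
∑[_⋯_] ∏[_⋯_] : ℕ → ℕ → (ℕ → RatFun) → RatFun
∑[ a ⋯ b ] h = sum     {suc b ℕ.∸ a} λ t → h (a ℕ.+ toℕ t)
∏[ a ⋯ b ] h = product {suc b ℕ.∸ a} λ t → h (a ℕ.+ toℕ t)

Matrix : ℕ → Set
Matrix n = Fin n → Fin n → RatFun

infixl 7 _⊗_
_⊗_ : ∀ {n} → Matrix n → Matrix n → Matrix n
(A ⊗ C) i j = sum λ k → A i k * C k j

I : ∀ {n} → Matrix n
I i j = if does (i Fin.≟ j) then 1# else 0#

infix 4 _≈ᴹ_
_≈ᴹ_ : ∀ {n} → Matrix n → Matrix n → Set
A ≈ᴹ C = ∀ i j → A i j ≈ C i j

infix 4 _IsInverseOf_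
_IsInverseOf_ : ∀ {n} → Matrix n → Matrix n → Set
C IsInverseOf A = A ⊗ C ≈ᴹ I × C ⊗ A ≈ᴹ I

-- Labels for the trivial and the quadratic character modulo p.
data Character : Set where
  χ₀ χₚ : Character

module AtPrime (p : ℕ) where

  -- p^(a + b s), where X stands for p^(-s).
  p^[_⊕_s] : ℤ → ℤ → RatFun
  p^[ a ⊕ b s] = fromℤ (+ p) ^ᶻ a * X ^ᶻ (ℤ.- b)

  p^_ : ℕ → RatFun
  p^ a = p^[ + a ⊕ 0ℤ s]

  legendre : ℤ → ℤ
  legendre a with + p ∣? a
                | any? {n = p} (λ x → + p ∣? (+ toℕ x ℤ.* + toℕ x ℤ.- a))
  ... | yes _ | _     = 0ℤ
  ... | no  _ | yes _ = 1ℤ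
  ... | no  _ | no  _ = -1ℤ

  -- In the exponents below every ℕ-division is exact and no ∸ truncates.
  m : Character → ℕ → ℕ → RatFun
  m ψ i j with i ℕ.≤? j | (j ℕ.∸ i) ℕ.% 2
  m ψ  i j | no  _ | _ = 0#
  m χ₀ i j | yes _ | zero =
    let d = j ℕ.∸ i in
    (p^[ + (d ℕ.* (d ℕ.+ 2) ℕ./ 4) ℤ.- + (j ℕ.* (j ℕ.+ 1) ℕ./ 2) ⊕ + i s]
      * ∏[ suc i ⋯ j ] (λ r → p^ r - 1#))
    / ∏[ 1 ⋯ d ℕ./ 2 ] (λ r → p^ (2 ℕ.* r) - 1#)
  m χ₀ i j | yes _ | suc _ =
    let d = j ℕ.∸ i in
    (p^[ + ((d ℕ.* d ℕ.∸ 1) ℕ./ 4) ℤ.- + (j ℕ.* (j ℕ.+ 1) ℕ./ 2) ⊕ + i s]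
      * ∏[ suc i ⋯ j ] (λ r → p^ r - 1#))
    / ∏[ 1 ⋯ (d ℕ.∸ 1) ℕ./ 2 ] (λ r → p^ (2 ℕ.* r) - 1#)
  m χₚ i j | yes _ | zero =
    let d = j ℕ.∸ i in
    (fromℤ (legendre -1ℤ) ^ (d ℕ./ 2)
      * p^[ + (d ℕ.* d ℕ./ 4) ℤ.- + (j ℕ.* (j ℕ.+ 1) ℕ./ 2) ⊕ + i s]
      * ∏[ suc i ⋯ j ] (λ k → p^ k - 1#))
    / ∏[ 1 ⋯ d ℕ./ 2 ] (λ k → p^ (2 ℕ.* k) - 1#)
  m χₚ i j | yes _ | suc _ = 0#

  -- b ψ i j in terms of the earlier entries h k = b ψ i k, k < j.
  b-entry : Character → (i j : ℕ) → (ℕ → RatFun) → RatFun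
  b-entry ψ i j h with ℕ.<-cmp i j
  ... | tri> _ _ _ = 0#
  ... | tri≈ _ _ _ = 1#
  ... | tri< _ _ _ =
    p^[ + (j ℕ.* (j ℕ.+ 1) ℕ./ 2) ⊕ ℤ.- + j s]
    / (p^[ + ((j ℕ.∸ i) ℕ.* (j ℕ.+ i ℕ.+ 1) ℕ./ 2) ⊕ ℤ.- + (j ℕ.∸ i) s] - 1#)
    * ∑[ i ⋯ j ℕ.∸ 1 ] (λ k → m ψ k j * h k)

  -- b-history ψ i j k = b ψ i k for k < j
  b-history : Character → ℕ → ℕ → ℕ → RatFun
  b-history ψ i zero    k = 0#
  b-history ψ i (suc j) k with k ℕ.<? j
  ... | yes _ = b-history ψ i j k
  ... | no  _ = b-entry ψ i j (b-history ψ i j)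

  b : Character → ℕ → ℕ → RatFun
  b ψ i j = b-entry ψ i j (b-history ψ i j)

  B : Character → (n : ℕ) → Matrix (suc n)
  B ψ n i j = b ψ (toℕ i) (toℕ j)

  -- The detour through b-history is only for the termination checker: b
  -- satisfies the inductive definition literally.

  b-lower : ∀ ψ {i j} → j ℕ.< i → b ψ i j ≡ 0#
  b-lower ψ {i} {j} j<i with ℕ.<-cmp i j
  ... | tri> _ _ _     = refl
  ... | tri≈ _ _ ¬j<i  = contradiction j<i ¬j<i
  ... | tri< _ _ ¬j<i  = contradiction j<i ¬j<i

  b-diagonal : ∀ ψ i → b ψ i i ≡ 1#
  b-diagonal ψ i with ℕ.<-cmp i i
  ... | tri> _ i≢i _ = contradiction refl i≢i
  ... | tri≈ _ _ _   = refl
  ... | tri< _ i≢i _ = contradiction refl i≢i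

  b-history-correct : ∀ ψ i {j k} → k ℕ.< j → b-history ψ i j k ≡ b ψ i k
  b-history-correct ψ i {suc j} {k} k<1+j with k ℕ.<? j
  ... | yes k<j = b-history-correct ψ i k<j
  ... | no  k≮j with ℕ.≤-antisym (ℕ.≤-pred k<1+j) (ℕ.≮⇒≥ k≮j)
  ...   | refl = refl

  b-upper : ∀ ψ {i j} → i ℕ.< j → b ψ i j ≡
    p^[ + (j ℕ.* (j ℕ.+ 1) ℕ./ 2) ⊕ ℤ.- + j s]
    / (p^[ + ((j ℕ.∸ i) ℕ.* (j ℕ.+ i ℕ.+ 1) ℕ./ 2) ⊕ ℤ.- + (j ℕ.∸ i) s] - 1#)
    * ∑[ i ⋯ j ℕ.∸ 1 ] (λ k → m ψ k j * b ψ i k)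
  b-upper ψ {i} {suc j} i<1+j with ℕ.<-cmp i (suc j)
  ... | tri> i≮1+j _ _ = contradiction i<1+j i≮1+j
  ... | tri≈ i≮1+j _ _ = contradiction i<1+j i≮1+j
  ... | tri< _ _ _     = cong (_ *_) (sum-cong λ t →
    cong (m ψ (i ℕ.+ toℕ t) (suc j) *_) (b-history-correct ψ i (bound t)))
    where
    sum-cong : ∀ {n} {f g : Fin n → RatFun} →
               (∀ t → f t ≡ g t) → sum f ≡ sum g
    sum-cong {zero}  e = refl
    sum-cong {suc n} e = cong₂ _+_ (e Fin.zero) (sum-cong λ t → e (Fin.suc t))

    bound : (t : Fin (suc j ℕ.∸ i)) → i ℕ.+ toℕ t ℕ.< suc j
    bound t = subst (i ℕ.+ toℕ t ℕ.<_) (ℕ.m+[n∸m]≡n (ℕ.<⇒≤ i<1+j))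
                (ℕ.+-monoʳ-< i (toℕ<n t))

module Submission where

-- Put μ_j = m_jj = p^{js - j(j+1)/2}. The recursion for B says B M = D B with D = diag(μ_j), and
-- the μ_j are distinct. Hence a unitriangular C with M C = C D is the inverse of B, and it remains to
-- verify this eigenvector equation for the closed formula. With q = p² and Z = p^{i+j+1-2s} (j - i
-- even) or Z = p^{i+j+2-2s} (j - i odd), cancelling common factors turns its (i, j) entry into the
-- q-binomial identity Σ_{a+b=n} [n over b]_q Z^b (Z; q)_a = 1. For χ₀ the sum over k contains terms
-- with k - i of both parities, which combine to that same sum.

open import Algebra.Bundles using (CommutativeRing)
import Algebra.Properties.CommutativeMonoid.Sum as CommutativeMonoidSum
import Algebra.Properties.CommutativeSemigroup as CommutativeSemigroupProperties
import Algebra.Properties.CommutativeSemiring.Exp as Exp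
import Algebra.Properties.Ring as RingProperties
import Algebra.Properties.Semiring.Exp as SemiringExp
import Algebra.Properties.Semiring.Sum as SemiringSum
import Algebra.Solver.CommutativeMonoid as CommutativeMonoidSolver
import Algebra.Solver.Ring.NaturalCoefficients.Default as SemiringSolver
open import Data.Bool using (if_then_else_)
open import Data.Fin as Fin using (Fin; toℕ)
open import Data.Fin.Properties as Fin using (punchInᵢ≢i; <-cmp; toℕ<n; toℕ-injective)
open import Data.Integer as ℤ using (ℤ; +_; 0ℤ; 1ℤ; -1ℤ)
import Data.Integer.Properties as ℤ
open import Data.List using ([]; _∷_)
open import Data.List.Relation.Unary.Any as Any using (here; there)
open import Data.Nat as ℕ using (ℕ; zero; suc; z≤n; s≤s)
open import Data.Nat.Divisibility using (_∣_)
import Data.Nat.DivMod as ℕ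
open import Data.Nat.Primality using (Prime; prime⇒nonTrivial)
import Data.Nat.Properties as ℕ
open import Data.Nat.Tactic.RingSolver using (solve-∀)
open import Data.Product using (∃; _×_; _,_; proj₁)
open import Data.Sum using (inj₁; inj₂)
open import Function using (_∘_)
open import Level using (_⊔_)
open import Relation.Binary.Bundles using (Setoid)
open import Relation.Binary.Definitions using (tri<; tri≈; tri>)
open import Relation.Binary.PropositionalEquality as ≡ using (_≡_; _≢_)
open import Relation.Nullary using (¬_; ¬?; yes; no; does; contradiction)
open import Relation.Nullary.Decidable using (dec-true; dec-false; decidable-stable)

-- M replaces B because B is known only through its recursion, while the entries of M are explicit
-- products and can be summed against the closed formula. In a product m_ik c_kj the factors p^r - 1
-- concatenate at k, the denominator of c_kj is a tail of that of c_ij, and the monomials collapse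
-- to a power of Z. For χ₀ the factors 1 - p^{k-s} leave an extra weight on each term; the weights
-- of two neighbouring k have a sum that does not depend on k, and this is what lets both parities
-- combine. What it needs from P and X is that the relevant monomials differ from 1. The other
-- obstacle is subtraction and division in exponents. Entries are therefore addressed by i and half
-- the distance to j, and powers carry separate positive and negative natural exponents, which turns
-- every comparison of exponents into a polynomial identity over ℕ.

-- Cross-multiplied identities behind the laws of fractions

module CrossMultiplication {c ℓ} (R : CommutativeRing c ℓ) where

  open CommutativeRing R renaming (Carrier to A)
  open RingProperties ring using (-‿distribˡ-*)
  open SemiringSolver commutativeSemiring using (solve; _:=_; _:+_; _:*_)
  open import Relation.Binary.Reasoning.Setoid setoid

  xy-swap : ∀ x y z → x * y * z ≈ x * z * y
  xy-swap = solve 3 (λ x y z → x :* y :* z := x :* z :* y) refl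

  -- Chaining a/a′ = b/b′ = c/c′ yields the cross-multiplied equation only up to the middle
  -- denominator b′, which `*ₚ-cancelʳ` removes later in the domain ℤ[X].
  trans-lemma : ∀ a a′ b b′ c c′ → a * b′ ≈ b * a′ → b * c′ ≈ c * b′ →
                (a * c′) * b′ ≈ (c * a′) * b′
  trans-lemma a a′ b b′ c c′ e₁ e₂ = begin
    (a * c′) * b′  ≈⟨ xy-swap a c′ b′ ⟩
    (a * b′) * c′  ≈⟨ *-congʳ e₁ ⟩
    (b * a′) * c′  ≈⟨ xy-swap b a′ c′ ⟩
    (b * c′) * a′  ≈⟨ *-congʳ e₂ ⟩
    (c * b′) * a′  ≈⟨ xy-swap c b′ a′ ⟩
    (c * a′) * b′  ∎

  *-interchange : ∀ w x y z → (w * x) * (y * z) ≈ (w * y) * (x * z)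
  *-interchange = solve 4 (λ w x y z → (w :* x) :* (y :* z) := (w :* y) :* (x :* z)) refl

  *-lemma : ∀ a a′ b b′ c c′ d d′ → a * b′ ≈ b * a′ → c * d′ ≈ d * c′ →
            (a * c) * (b′ * d′) ≈ (b * d) * (a′ * c′)
  *-lemma a a′ b b′ c c′ d d′ e₁ e₂ = trans (*-interchange _ _ _ _)
    (trans (*-cong e₁ e₂) (*-interchange _ _ _ _))

  +-lemma : ∀ a a′ b b′ c c′ d d′ → a * b′ ≈ b * a′ → c * d′ ≈ d * c′ →
            (a * c′ + c * a′) * (b′ * d′) ≈ (b * d′ + d * b′) * (a′ * c′)
  +-lemma a a′ b b′ c c′ d d′ e₁ e₂ = begin
    (a * c′ + c * a′) * (b′ * d′)
      ≈⟨ regroup a a′ b′ c c′ d′ ⟩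
    (a * b′) * (c′ * d′) + (c * d′) * (a′ * b′)
      ≈⟨ +-cong (*-congʳ e₁) (*-congʳ e₂) ⟩
    (b * a′) * (c′ * d′) + (d * c′) * (a′ * b′)
      ≈⟨ regroup′ a′ b b′ c′ d d′ ⟩
    (b * d′ + d * b′) * (a′ * c′) ∎
    where
    regroup : ∀ a a′ b′ c c′ d′ → (a * c′ + c * a′) * (b′ * d′) ≈
              (a * b′) * (c′ * d′) + (c * d′) * (a′ * b′)
    regroup = solve 6 (λ a a′ b′ c c′ d′ → (a :* c′ :+ c :* a′) :* (b′ :* d′) :=
              (a :* b′) :* (c′ :* d′) :+ (c :* d′) :* (a′ :* b′)) refl
    regroup′ : ∀ a′ b b′ c′ d d′ → (b * a′) * (c′ * d′) + (d * c′) * (a′ * b′) ≈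
               (b * d′ + d * b′) * (a′ * c′)
    regroup′ = solve 6 (λ a′ b b′ c′ d d′ → (b :* a′) :* (c′ :* d′) :+ (d :* c′) :* (a′ :* b′) :=
               (b :* d′ :+ d :* b′) :* (a′ :* c′)) refl

  +-assoc-lemma : ∀ a a′ b b′ c c′ →
    ((a * b′ + b * a′) * c′ + c * (a′ * b′)) * (a′ * (b′ * c′)) ≈
    (a * (b′ * c′) + (b * c′ + c * b′) * a′) * ((a′ * b′) * c′)
  +-assoc-lemma = solve 6 (λ a a′ b b′ c c′ →
    ((a :* b′ :+ b :* a′) :* c′ :+ c :* (a′ :* b′)) :* (a′ :* (b′ :* c′)) :=
    (a :* (b′ :* c′) :+ (b :* c′ :+ c :* b′) :* a′) :* ((a′ :* b′) :* c′)) refl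

  +-comm-lemma : ∀ a a′ b b′ → (a * b′ + b * a′) * (b′ * a′) ≈ (b * a′ + a * b′) * (a′ * b′)
  +-comm-lemma = solve 4 (λ a a′ b b′ →
    (a :* b′ :+ b :* a′) :* (b′ :* a′) := (b :* a′ :+ a :* b′) :* (a′ :* b′)) refl

  *-assoc-lemma : ∀ a a′ b b′ c c′ → ((a * b) * c) * (a′ * (b′ * c′)) ≈ (a * (b * c)) * ((a′ * b′) * c′)
  *-assoc-lemma = solve 6 (λ a a′ b b′ c c′ →
    ((a :* b) :* c) :* (a′ :* (b′ :* c′)) := (a :* (b :* c)) :* ((a′ :* b′) :* c′)) refl

  distribˡ-lemma : ∀ a a′ b b′ c c′ →
    (a * (b * c′ + c * b′)) * ((a′ * b′) * (a′ * c′)) ≈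
    ((a * b) * (a′ * c′) + (a * c) * (a′ * b′)) * (a′ * (b′ * c′))
  distribˡ-lemma = solve 6 (λ a a′ b b′ c c′ →
    (a :* (b :* c′ :+ c :* b′)) :* ((a′ :* b′) :* (a′ :* c′)) :=
    ((a :* b) :* (a′ :* c′) :+ (a :* c) :* (a′ :* b′)) :* (a′ :* (b′ :* c′))) refl

  +-identityˡ-lemma : ∀ a a′ → (0# * a′ + a * 1#) * a′ ≈ a * (1# * a′)
  +-identityˡ-lemma a a′ = begin
    (0# * a′ + a * 1#) * a′  ≈⟨ *-congʳ (+-congʳ (zeroˡ a′)) ⟩
    (0# + a * 1#) * a′       ≈⟨ *-congʳ (+-identityˡ _) ⟩
    a * 1# * a′              ≈⟨ *-assoc a 1# a′ ⟩
    a * (1# * a′)            ∎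

  -‿lemma : ∀ a a′ b b′ → a * b′ ≈ b * a′ → (- a) * b′ ≈ (- b) * a′
  -‿lemma a a′ b b′ e = trans (sym (-‿distribˡ-* _ _)) (trans (-‿cong e) (-‿distribˡ-* _ _))

  -‿inverseˡ-lemma : ∀ a a′ → ((- a) * a′ + a * a′) * 1# ≈ 0# * (a′ * a′)
  -‿inverseˡ-lemma a a′ = begin
    ((- a) * a′ + a * a′) * 1#  ≈⟨ *-identityʳ _ ⟩
    (- a) * a′ + a * a′         ≈⟨ distribʳ a′ (- a) a ⟨
    (- a + a) * a′              ≈⟨ *-congʳ (-‿inverseˡ a) ⟩
    0# * a′                     ≈⟨ zeroˡ a′ ⟩
    0#                          ≈⟨ zeroˡ (a′ * a′) ⟨
    0# * (a′ * a′)              ∎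

  *-inverse-lemma : ∀ a a′ → (a * a′) * 1# ≈ 1# * (a′ * a)
  *-inverse-lemma a a′ = trans (*-identityʳ _) (trans (*-comm a a′) (sym (*-identityˡ _)))

  *-identityˡ-lemma : ∀ a a′ → (1# * a) * a′ ≈ a * (1# * a′)
  *-identityˡ-lemma a a′ = trans (*-congʳ (*-comm 1# a)) (*-assoc a 1# a′)

-- Unitriangular matrices, eigenvectors and inverses

module TriangularMatrices {c ℓ} (R : CommutativeRing c ℓ) where

  open CommutativeRing R
  open RingProperties ring using (+-cancelʳ)
  open SemiringSum semiring using (sum; sum-cong-≋; sum-remove; ∑-comm; *-distribˡ-sum; *-distribʳ-sum;
    sum-replicate-zero)
  open import Relation.Binary.Reasoning.Setoid setoid

  sum-zero : ∀ {n} {f : Fin n → Carrier} → (∀ k → f k ≈ 0#) → sum f ≈ 0#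
  sum-zero {n} f≈0 = trans (sum-cong-≋ f≈0) (sum-replicate-zero n)

  sum-single : ∀ {n} i {f : Fin n → Carrier} → (∀ k → k ≢ i → f k ≈ 0#) → sum f ≈ f i
  sum-single {suc n} i {f} f≈0 = begin
    sum f                              ≈⟨ sum-remove {i = i} f ⟩
    f i + sum (f ∘ Fin.punchIn i)      ≈⟨ +-congˡ (sum-zero {n} λ k → f≈0 _ (punchInᵢ≢i i k)) ⟩
    f i + 0#                           ≈⟨ +-identityʳ (f i) ⟩
    f i                                ∎

  SquareMatrix : ℕ → Set c
  SquareMatrix n = Fin n → Fin n → Carrier

  infixl 7 _⊠_
  _⊠_ : ∀ {n} → SquareMatrix n → SquareMatrix n → SquareMatrix n
  (A ⊠ B) i j = sum λ k → A i k * B k j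

  δ : ∀ {n} → SquareMatrix n
  δ i j = if does (i Fin.≟ j) then 1# else 0#

  δ-diagonal : ∀ {n} (i : Fin n) → δ i i ≡ 1#
  δ-diagonal i rewrite dec-true (i Fin.≟ i) ≡.refl = ≡.refl

  δ-off-diagonal : ∀ {n} {i j : Fin n} → i ≢ j → δ i j ≡ 0#
  δ-off-diagonal {i = i} {j} i≢j rewrite dec-false (i Fin.≟ j) i≢j = ≡.refl

  ⊠-assoc : ∀ {n} (A B C : SquareMatrix n) i j → (A ⊠ B ⊠ C) i j ≈ (A ⊠ (B ⊠ C)) i j
  ⊠-assoc A B C i j = begin
    sum (λ k → sum (λ l → A i l * B l k) * C k j)
      ≈⟨ sum-cong-≋ (λ k → *-distribʳ-sum (C k j) (λ l → A i l * B l k)) ⟩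
    sum (λ k → sum (λ l → A i l * B l k * C k j))
      ≈⟨ ∑-comm (λ k l → A i l * B l k * C k j) ⟩
    sum (λ l → sum (λ k → A i l * B l k * C k j))
      ≈⟨ sum-cong-≋ (λ l → sum-cong-≋ λ k → *-assoc (A i l) (B l k) (C k j)) ⟩
    sum (λ l → sum (λ k → A i l * (B l k * C k j)))
      ≈⟨ sum-cong-≋ (λ l → *-distribˡ-sum (A i l) (λ k → B l k * C k j)) ⟨
    sum (λ l → A i l * sum (λ k → B l k * C k j)) ∎

  ⊠-identityˡ : ∀ {n} (A : SquareMatrix n) i j → (δ ⊠ A) i j ≈ A i j
  ⊠-identityˡ A i j = begin
    sum (λ k → δ i k * A k j)  ≈⟨ sum-single i (λ k k≢i →
      trans (*-congʳ (reflexive (δ-off-diagonal (k≢i ∘ ≡.sym)))) (zeroˡ _)) ⟩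
    δ i i * A i j              ≈⟨ *-congʳ (reflexive (δ-diagonal i)) ⟩
    1# * A i j                 ≈⟨ *-identityˡ _ ⟩
    A i j                      ∎

  ⊠-identityʳ : ∀ {n} (A : SquareMatrix n) i j → (A ⊠ δ) i j ≈ A i j
  ⊠-identityʳ A i j = begin
    sum (λ k → A i k * δ k j)  ≈⟨ sum-single j (λ k k≢j →
      trans (*-congˡ (reflexive (δ-off-diagonal k≢j))) (zeroʳ _)) ⟩
    A i j * δ j j              ≈⟨ *-congˡ (reflexive (δ-diagonal j)) ⟩
    A i j * 1#                 ≈⟨ *-identityʳ _ ⟩
    A i j                      ∎

  ⊠-congˡ : ∀ {n} (A : SquareMatrix n) {B B′} → (∀ i j → B i j ≈ B′ i j) →
            ∀ i j → (A ⊠ B) i j ≈ (A ⊠ B′) i j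
  ⊠-congˡ A e i j = sum-cong-≋ λ k → *-congˡ (e k j)

  ⊠-congʳ : ∀ {n} {A A′} (B : SquareMatrix n) → (∀ i j → A i j ≈ A′ i j) →
            ∀ i j → (A ⊠ B) i j ≈ (A′ ⊠ B) i j
  ⊠-congʳ B e i j = sum-cong-≋ λ k → *-congʳ (e i k)

  record UpperUnitriangular {n} (A : SquareMatrix n) : Set ℓ where
    field
      lower    : ∀ {i j} → j Fin.< i → A i j ≈ 0#
      diagonal : ∀ i → A i i ≈ 1#

  open UpperUnitriangular

  ⊠-diagonal : ∀ {n} {A B : SquareMatrix n} → UpperUnitriangular A → UpperUnitriangular B →
               ∀ i → (A ⊠ B) i i ≈ 1#
  ⊠-diagonal {A = A} {B} uA uB i = begin
    (A ⊠ B) i i    ≈⟨ sum-single i off-diagonal ⟩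
    A i i * B i i  ≈⟨ *-cong (diagonal uA i) (diagonal uB i) ⟩
    1# * 1#        ≈⟨ *-identityˡ 1# ⟩
    1#             ∎
    where
    off-diagonal : ∀ k → k ≢ i → A i k * B k i ≈ 0#
    off-diagonal k k≢i with <-cmp k i
    ... | tri< k<i _ _ = trans (*-congʳ (lower uA k<i)) (zeroˡ _)
    ... | tri≈ _ k≡i _ = contradiction k≡i k≢i
    ... | tri> _ _ i<k = trans (*-congˡ (lower uB i<k)) (zeroʳ _)

  -- The rows of B and the columns of C are left and right eigenvectors of M,
  -- and eigenvectors to different eigenvalues are orthogonal.
  eigenvectors⇒inverseʳ : ∀ {n} {B M C : SquareMatrix n} (μ : Fin n → Carrier) →
    UpperUnitriangular B → UpperUnitriangular C →
    (∀ i j → (B ⊠ M) i j ≈ μ i * B i j) →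
    (∀ i j → (M ⊠ C) i j ≈ μ j * C i j) →
    (∀ {i j x} → i ≢ j → μ i * x ≈ μ j * x → x ≈ 0#) →
    ∀ i j → (B ⊠ C) i j ≈ δ i j
  eigenvectors⇒inverseʳ {B = B} {M} {C} μ uB uC BM MC distinct i j with i Fin.≟ j
  ... | yes ≡.refl = ⊠-diagonal uB uC i
  ... | no  i≢j = distinct i≢j (begin
    μ i * (B ⊠ C) i j                  ≈⟨ *-distribˡ-sum (μ i) (λ k → B i k * C k j) ⟩
    sum (λ k → μ i * (B i k * C k j))  ≈⟨ sum-cong-≋ (λ k → *-assoc (μ i) (B i k) (C k j)) ⟨
    sum (λ k → μ i * B i k * C k j)    ≈⟨ sum-cong-≋ (λ k → *-congʳ (BM i k)) ⟨
    (B ⊠ M ⊠ C) i j                    ≈⟨ ⊠-assoc B M C i j ⟩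
    (B ⊠ (M ⊠ C)) i j                  ≈⟨ sum-cong-≋ (λ k → *-congˡ (MC k j)) ⟩
    sum (λ k → B i k * (μ j * C k j))  ≈⟨ sum-cong-≋ (λ k → x∙yz≈y∙xz (B i k) (μ j) (C k j)) ⟩
    sum (λ k → μ j * (B i k * C k j))  ≈⟨ *-distribˡ-sum (μ j) (λ k → B i k * C k j) ⟨
    μ j * (B ⊠ C) i j                  ∎)
    where open import Algebra.Properties.CommutativeSemigroup *-commutativeSemigroup using (x∙yz≈y∙xz)

  -- Strong induction on the column j, with m as its bound. In the (i, j) entry of the products the
  -- terms with k < j agree by induction, those with k > j vanish because C is upper triangular, and
  -- the term k = j has coefficient C j j = 1.
  ⊠-cancelʳ : ∀ {n} {A A′ C : SquareMatrix n} → UpperUnitriangular C →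
              (∀ i j → (A ⊠ C) i j ≈ (A′ ⊠ C) i j) → ∀ i j → A i j ≈ A′ i j
  ⊠-cancelʳ {zero}  uC e ()
  ⊠-cancelʳ {suc n} {A} {A′} {C} uC e i j = below (suc (toℕ j)) j ℕ.≤-refl
    where
    below : ∀ m j → toℕ j ℕ.< m → A i j ≈ A′ i j
    below (suc m) j (ℕ.s≤s j≤m) = begin
      A i j           ≈⟨ *-identityʳ _ ⟨
      A i j * 1#      ≈⟨ *-congˡ (diagonal uC j) ⟨
      A i j * C j j   ≈⟨ +-cancelʳ _ _ _ sums ⟩
      A′ i j * C j j  ≈⟨ *-congˡ (diagonal uC j) ⟩
      A′ i j * 1#     ≈⟨ *-identityʳ _ ⟩
      A′ i j          ∎
      where
      rest : SquareMatrix (suc n) → Carrier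
      rest A = sum λ k → A i (Fin.punchIn j k) * C (Fin.punchIn j k) j

      off-diagonal : ∀ k → k ≢ j → A i k * C k j ≈ A′ i k * C k j
      off-diagonal k k≢j with <-cmp k j
      ... | tri< k<j _ _ = *-congʳ (below m k (ℕ.<-≤-trans k<j j≤m))
      ... | tri≈ _ k≡j _ = contradiction k≡j k≢j
      ... | tri> _ _ j<k = trans (trans (*-congˡ (lower uC j<k)) (zeroʳ _))
                             (sym (trans (*-congˡ (lower uC j<k)) (zeroʳ _)))

      sums : A i j * C j j + rest A ≈ A′ i j * C j j + rest A
      sums = begin
        A i j * C j j + rest A    ≈⟨ sum-remove {i = j} (λ k → A i k * C k j) ⟨
        (A ⊠ C) i j               ≈⟨ e i j ⟩
        (A′ ⊠ C) i j              ≈⟨ sum-remove {i = j} (λ k → A′ i k * C k j) ⟩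
        A′ i j * C j j + rest A′  ≈⟨ +-congˡ (sum-cong-≋ λ k →
                                       off-diagonal _ (punchInᵢ≢i j k)) ⟨
        A′ i j * C j j + rest A   ∎

  -- From B C = 1 one gets (C B) C = C = 1 C, and a unitriangular C cancels on the right.
  inverseʳ⇒inverseˡ : ∀ {n} {B C : SquareMatrix n} → UpperUnitriangular C →
    (∀ i j → (B ⊠ C) i j ≈ δ i j) → ∀ i j → (C ⊠ B) i j ≈ δ i j
  inverseʳ⇒inverseˡ {B = B} {C} uC BC = ⊠-cancelʳ uC λ i j → begin
    (C ⊠ B ⊠ C) i j    ≈⟨ ⊠-assoc C B C i j ⟩
    (C ⊠ (B ⊠ C)) i j  ≈⟨ ⊠-congˡ C BC i j ⟩
    (C ⊠ δ) i j        ≈⟨ ⊠-identityʳ C i j ⟩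
    C i j              ≈⟨ ⊠-identityˡ C i j ⟨
    (δ ⊠ C) i j        ∎

  -- The theorem speaks about every inverse of B; this carries the closed formula over to all of
  -- them.
  inverse-unique : ∀ {n} {B C C′ : SquareMatrix n} → (∀ i j → (C′ ⊠ B) i j ≈ δ i j) →
    (∀ i j → (B ⊠ C) i j ≈ δ i j) → ∀ i j → C′ i j ≈ C i j
  inverse-unique {B = B} {C} {C′} C′B BC i j = begin
    C′ i j              ≈⟨ ⊠-identityʳ C′ i j ⟨
    (C′ ⊠ δ) i j        ≈⟨ ⊠-congˡ C′ BC i j ⟨
    (C′ ⊠ (B ⊠ C)) i j  ≈⟨ ⊠-assoc C′ B C i j ⟨
    (C′ ⊠ B ⊠ C) i j    ≈⟨ ⊠-congʳ C C′B i j ⟩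
    (δ ⊠ C) i j         ≈⟨ ⊠-identityˡ C i j ⟩
    C i j               ∎

-- Sums over a + b = n and their splitting by parity

module Convolution {c ℓ} (R : CommutativeRing c ℓ) where

  open CommutativeRing R
  open CommutativeSemigroupProperties +-commutativeSemigroup using (interchange; x∙yz≈y∙xz)
  open SemiringSum semiring using (sum; sum-cong-≋; sum-replicate-zero)
  open import Relation.Binary.Reasoning.Setoid setoid

  -- Σ f a b over a + b = n.
  conv : ℕ → (ℕ → ℕ → Carrier) → Carrier
  conv zero    f = f 0 0
  conv (suc n) f = f 0 (suc n) + conv n (f ∘ suc)

  conv-cong : ∀ n {f g} → (∀ a b → a ℕ.+ b ≡ n → f a b ≈ g a b) → conv n f ≈ conv n g
  conv-cong zero    e = e 0 0 ≡.refl
  conv-cong (suc n) e = +-cong (e 0 (suc n) ≡.refl)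
    (conv-cong n λ a b a+b≡n → e (suc a) b (≡.cong suc a+b≡n))

  conv-0 : ∀ n → conv n (λ _ _ → 0#) ≈ 0#
  conv-0 zero    = refl
  conv-0 (suc n) = trans (+-identityˡ _) (conv-0 n)

  conv-+ : ∀ n f g → conv n (λ a b → f a b + g a b) ≈ conv n f + conv n g
  conv-+ zero    f g = refl
  conv-+ (suc n) f g = trans (+-congˡ (conv-+ n (f ∘ suc) (g ∘ suc))) (interchange _ _ _ _)

  *-distribˡ-conv : ∀ n x f → x * conv n f ≈ conv n (λ a b → x * f a b)
  *-distribˡ-conv zero    x f = refl
  *-distribˡ-conv (suc n) x f = trans (distribˡ x _ _) (+-congˡ (*-distribˡ-conv n x (f ∘ suc)))

  conv-dropˡ : ∀ n f → f 0 (suc n) ≈ 0# → conv (suc n) f ≈ conv n (f ∘ suc)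
  conv-dropˡ n f e = trans (+-congʳ e) (+-identityˡ _)

  conv-dropʳ : ∀ n f → f (suc n) 0 ≈ 0# → conv (suc n) f ≈ conv n (λ a b → f a (suc b))
  conv-dropʳ zero    f e = trans (+-congˡ e) (+-identityʳ _)
  conv-dropʳ (suc n) f e = +-congˡ (conv-dropʳ n (f ∘ suc) e)

  -- When the total is odd exactly one of the two indices is odd, so the terms pair off completely;
  -- the even total of `conv-even` leaves one term without a partner.
  conv-odd : ∀ n f → conv (suc (n ℕ.* 2)) f ≈
             conv n (λ a b → f (a ℕ.* 2) (suc (b ℕ.* 2)) + f (suc (a ℕ.* 2)) (b ℕ.* 2))
  conv-odd zero    f = refl
  conv-odd (suc n) f = trans (sym (+-assoc _ _ _)) (+-congˡ (conv-odd n (f ∘ suc ∘ suc)))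

  shift : (ℕ → ℕ → Carrier) → ℕ → ℕ → Carrier
  shift f zero    b = 0#
  shift f (suc a) b = f a b

  shift-conv : ∀ n f → f 0 n + conv n (shift (f ∘ suc)) ≈ conv n f
  shift-conv zero    f = +-identityʳ _
  shift-conv (suc n) f = +-congˡ (+-identityˡ _)

  -- The odd terms are those of a + b = n - 1, shifted to run over a + b = n.
  conv-even : ∀ n f → conv (n ℕ.* 2) f ≈
              conv n (λ a b → f (a ℕ.* 2) (b ℕ.* 2)
                            + shift (λ a b → f (suc (a ℕ.* 2)) (suc (b ℕ.* 2))) a b)
  conv-even zero    f = sym (+-identityʳ _)
  conv-even (suc n) f = begin
    even 0 (suc n) + (odd 0 n + conv (n ℕ.* 2) (f ∘ suc ∘ suc))
      ≈⟨ +-congˡ (+-congˡ (conv-even n (f ∘ suc ∘ suc))) ⟩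
    even 0 (suc n) + (odd 0 n + conv n (λ a b → even (suc a) b + shift (odd ∘ suc) a b))
      ≈⟨ +-congˡ (+-congˡ (conv-+ n (even ∘ suc) (shift (odd ∘ suc)))) ⟩
    even 0 (suc n) + (odd 0 n + (conv n (even ∘ suc) + conv n (shift (odd ∘ suc))))
      ≈⟨ +-congˡ (x∙yz≈y∙xz _ _ _) ⟩
    even 0 (suc n) + (conv n (even ∘ suc) + (odd 0 n + conv n (shift (odd ∘ suc))))
      ≈⟨ +-congˡ (+-congˡ (shift-conv n odd)) ⟩
    even 0 (suc n) + (conv n (even ∘ suc) + conv n odd)
      ≈⟨ +-cong (+-identityʳ _) (conv-+ n (even ∘ suc) odd) ⟨
    even 0 (suc n) + 0# + conv n (λ a b → even (suc a) b + odd a b) ∎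
    where
    even odd : ℕ → ℕ → Carrier
    even a b = f (a ℕ.* 2) (b ℕ.* 2)
    odd  a b = f (suc (a ℕ.* 2)) (suc (b ℕ.* 2))

  sum-conv : ∀ n (g : ℕ → Carrier) f → (∀ a b → a ℕ.+ b ≡ n → g a ≈ f a b) →
             sum {suc n} (g ∘ toℕ) ≈ conv n f
  sum-conv zero    g f e = trans (+-identityʳ _) (e 0 0 ≡.refl)
  sum-conv (suc n) g f e = +-cong (e 0 (suc n) ≡.refl)
    (sum-conv n (g ∘ suc) (f ∘ suc) λ a b a+b≡n → e (suc a) b (≡.cong suc a+b≡n))

  sum-prefix : ∀ l r (g : ℕ → Carrier) → (∀ k → l ℕ.≤ k → g k ≈ 0#) →
               sum {l ℕ.+ r} (g ∘ toℕ) ≈ sum {l} (g ∘ toℕ)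
  sum-prefix zero    r g e = trans (sum-cong-≋ {r} λ k → e (toℕ k) z≤n) (sum-replicate-zero r)
  sum-prefix (suc l) r g e = +-congˡ (sum-prefix l r (g ∘ suc) λ k l≤k → e (suc k) (s≤s l≤k))

  sum-suffix : ∀ i n (g : ℕ → Carrier) → (∀ k → k ℕ.< i → g k ≈ 0#) →
               sum {i ℕ.+ n} (g ∘ toℕ) ≈ sum {n} (λ t → g (i ℕ.+ toℕ t))
  sum-suffix zero    n g e = refl
  sum-suffix (suc i) n g e = trans (+-congʳ (e 0 (s≤s z≤n))) (trans (+-identityˡ _)
    (sum-suffix i n (g ∘ suc) λ k k<i → e (suc k) (s≤s k<i)))

  -- For the product of two upper triangular matrices: the sum over all k in `Fin n` is carried by i
  -- ≤ k ≤ j.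
  sum-range : ∀ i l r {n} → i ℕ.+ (l ℕ.+ r) ≡ n → (g : ℕ → Carrier) →
              (∀ k → k ℕ.< i → g k ≈ 0#) → (∀ k → i ℕ.+ l ℕ.≤ k → g k ≈ 0#) →
              sum {n} (g ∘ toℕ) ≈ sum {l} (λ t → g (i ℕ.+ toℕ t))
  sum-range i l r ≡.refl g below above = trans (sum-suffix i (l ℕ.+ r) g below)
    (sum-prefix l r (g ∘ (i ℕ.+_)) λ k l≤k → above (i ℕ.+ k) (ℕ.+-monoʳ-≤ i l≤k))

  sum-last : ∀ n (g : ℕ → Carrier) → sum {suc n} (g ∘ toℕ) ≈ sum {n} (g ∘ toℕ) + g n
  sum-last zero    g = trans (+-identityʳ _) (sym (+-identityˡ _))
  sum-last (suc n) g = trans (+-congˡ (sum-last n (g ∘ suc))) (sym (+-assoc _ _ _))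

-- Fields and finite products

record IsField {c ℓ} (R : CommutativeRing c ℓ)
               (_⁻¹ : CommutativeRing.Carrier R → CommutativeRing.Carrier R) : Set (c ⊔ ℓ) where
  open CommutativeRing R
  field
    1≉0        : ¬ 1# ≈ 0#
    *-inverseʳ : ∀ {x} → ¬ x ≈ 0# → x * x ⁻¹ ≈ 1#

module FieldProperties {c ℓ} (R : CommutativeRing c ℓ)
  (_⁻¹ : CommutativeRing.Carrier R → CommutativeRing.Carrier R) (isField : IsField R _⁻¹) where

  open CommutativeRing R
  open IsField isField
  open CommutativeSemigroupProperties *-commutativeSemigroup using (interchange)
  open CommutativeMonoidSum *-commutativeMonoid using () renaming (sum to product)
  open import Relation.Binary.Reasoning.Setoid setoid

  cancelled : ∀ {x} y → ¬ x ≈ 0# → x ⁻¹ * (x * y) ≈ y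
  cancelled {x} y x≉0 = begin
    x ⁻¹ * (x * y)  ≈⟨ *-assoc (x ⁻¹) x y ⟨
    x ⁻¹ * x * y    ≈⟨ *-congʳ (trans (*-comm (x ⁻¹) x) (*-inverseʳ x≉0)) ⟩
    1# * y          ≈⟨ *-identityˡ y ⟩
    y               ∎

  *-cancelˡ : ∀ {x y z} → ¬ x ≈ 0# → x * y ≈ x * z → y ≈ z
  *-cancelˡ x≉0 e = trans (sym (cancelled _ x≉0)) (trans (*-congˡ e) (cancelled _ x≉0))

  unit⇒≉0 : ∀ {x y} → x * y ≈ 1# → ¬ x ≈ 0#
  unit⇒≉0 {x} {y} xy≈1 x≈0 = 1≉0 (trans (sym xy≈1) (trans (*-congʳ x≈0) (zeroˡ y)))

  ⁻¹-unique : ∀ {x y} → x * y ≈ 1# → x ⁻¹ ≈ y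
  ⁻¹-unique xy≈1 = *-cancelˡ (unit⇒≉0 xy≈1) (trans (*-inverseʳ (unit⇒≉0 xy≈1)) (sym xy≈1))

  ⁻¹-cong : ∀ {x y} → ¬ x ≈ 0# → x ≈ y → x ⁻¹ ≈ y ⁻¹
  ⁻¹-cong x≉0 x≈y = sym (⁻¹-unique (trans (*-congʳ (sym x≈y)) (*-inverseʳ x≉0)))

  *-unit : ∀ {x x′ y y′} → x * x′ ≈ 1# → y * y′ ≈ 1# → (x * y) * (x′ * y′) ≈ 1#
  *-unit e e′ = trans (interchange _ _ _ _) (trans (*-cong e e′) (*-identityˡ 1#))

  -- Peels off the last factor, while `product` peels off the first. Thus `E`, `F` and `G` at
  -- `suc n` extend their values at `n`, as the induction for the q-binomial identity requires.
  Π : ℕ → (ℕ → Carrier) → Carrier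
  Π zero    h = 1#
  Π (suc n) h = Π n h * h n

  Π-cong : ∀ n {g h} → (∀ k → g k ≈ h k) → Π n g ≈ Π n h
  Π-cong zero    e = refl
  Π-cong (suc n) e = *-cong (Π-cong n e) (e n)

  Π-* : ∀ n g h → Π n (λ k → g k * h k) ≈ Π n g * Π n h
  Π-* zero    g h = sym (*-identityˡ 1#)
  Π-* (suc n) g h = trans (*-congʳ (Π-* n g h)) (interchange _ _ _ _)

  Π-shift : ∀ n h → Π (suc n) h ≈ h 0 * Π n (h ∘ suc)
  Π-shift zero    h = *-comm 1# (h 0)
  Π-shift (suc n) h = trans (*-congʳ (Π-shift n h)) (*-assoc _ _ _)

  Π-split : ∀ m n h → Π (m ℕ.+ n) h ≈ Π m h * Π n (λ k → h (m ℕ.+ k))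
  Π-split zero    n h = sym (*-identityˡ _)
  Π-split (suc m) n h = begin
    Π (suc m ℕ.+ n) h                                         ≈⟨ Π-shift (m ℕ.+ n) h ⟩
    h 0 * Π (m ℕ.+ n) (h ∘ suc)                               ≈⟨ *-congˡ (Π-split m n (h ∘ suc)) ⟩
    h 0 * (Π m (h ∘ suc) * Π n (λ k → h (suc m ℕ.+ k)))       ≈⟨ *-assoc _ _ _ ⟨
    h 0 * Π m (h ∘ suc) * Π n (λ k → h (suc m ℕ.+ k))         ≈⟨ *-congʳ (Π-shift m h) ⟨
    Π (suc m) h * Π n (λ k → h (suc m ℕ.+ k))                 ∎

  Π-inverseʳ : ∀ n {h} → (∀ k → ¬ h k ≈ 0#) → Π n h * Π n (_⁻¹ ∘ h) ≈ 1#
  Π-inverseʳ zero    h≉0 = *-identityˡ 1#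
  Π-inverseʳ (suc n) h≉0 = *-unit (Π-inverseʳ n h≉0) (*-inverseʳ (h≉0 n))

  product-Π : ∀ n h → product {n} (h ∘ toℕ) ≈ Π n h
  product-Π zero    h = refl
  product-Π (suc n) h = trans (*-congˡ (product-Π n (h ∘ suc))) (sym (Π-shift n h))

-- Triangular numbers in the exponents

-- Has the shape of the exponents in `m` and `b-entry`, so that it agrees with them by computation.
-- `T-unique` and `T-double` trade the division for equations that the ring solver handles.
T : ℕ → ℕ
T n = n ℕ.* (n ℕ.+ 1) ℕ./ 2

T-unique : ∀ n t → n ℕ.* (n ℕ.+ 1) ≡ t ℕ.* 2 → T n ≡ t
T-unique n t e = ≡.trans (≡.cong (ℕ._/ 2) e) (ℕ.m*n/n≡m t 2)

T-double : ∀ n → n ℕ.* (n ℕ.+ 1) ≡ T n ℕ.* 2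
T-double n = ≡.trans (proof n) (≡.cong (ℕ._* 2) (≡.sym (T-unique n (triangle n) (proof n))))
  where
  triangle : ℕ → ℕ
  triangle zero    = 0
  triangle (suc n) = triangle n ℕ.+ suc n

  lemma : ∀ n → suc n ℕ.* (suc n ℕ.+ 1) ≡ n ℕ.* (n ℕ.+ 1) ℕ.+ suc n ℕ.* 2
  lemma = solve-∀

  proof : ∀ n → n ℕ.* (n ℕ.+ 1) ≡ triangle n ℕ.* 2
  proof zero    = ≡.refl
  proof (suc n) = ≡.trans (lemma n) (≡.trans (≡.cong (ℕ._+ suc n ℕ.* 2) (proof n))
    (≡.sym (ℕ.*-distribʳ-+ 2 (triangle n) (suc n))))

T-+ : ∀ i d → T (i ℕ.+ d) ≡ T i ℕ.+ (i ℕ.* d ℕ.+ T d)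
T-+ i d = T-unique (i ℕ.+ d) _ (begin
  (i ℕ.+ d) ℕ.* (i ℕ.+ d ℕ.+ 1)                                 ≡⟨ expand i d ⟩
  i ℕ.* (i ℕ.+ 1) ℕ.+ i ℕ.* d ℕ.* 2 ℕ.+ d ℕ.* (d ℕ.+ 1)
    ≡⟨ ≡.cong₂ (λ x y → x ℕ.+ i ℕ.* d ℕ.* 2 ℕ.+ y) (T-double i) (T-double d) ⟩
  T i ℕ.* 2 ℕ.+ i ℕ.* d ℕ.* 2 ℕ.+ T d ℕ.* 2                      ≡⟨ collect (T i) (i ℕ.* d) (T d) ⟩
  (T i ℕ.+ (i ℕ.* d ℕ.+ T d)) ℕ.* 2                             ∎)
  where
  open ≡.≡-Reasoning
  expand : ∀ i d → (i ℕ.+ d) ℕ.* (i ℕ.+ d ℕ.+ 1) ≡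
           i ℕ.* (i ℕ.+ 1) ℕ.+ i ℕ.* d ℕ.* 2 ℕ.+ d ℕ.* (d ℕ.+ 1)
  expand = solve-∀
  collect : ∀ x y z → x ℕ.* 2 ℕ.+ y ℕ.* 2 ℕ.+ z ℕ.* 2 ≡ (x ℕ.+ (y ℕ.+ z)) ℕ.* 2
  collect = solve-∀

T-+even : ∀ i a → T (i ℕ.+ a ℕ.* 2) ≡ T i ℕ.+ (i ℕ.* (a ℕ.* 2) ℕ.+ (a ℕ.* a ℕ.* 2 ℕ.+ a))
T-+even i a = ≡.trans (T-+ i (a ℕ.* 2)) (≡.cong (λ t → T i ℕ.+ (i ℕ.* (a ℕ.* 2) ℕ.+ t))
  (T-unique (a ℕ.* 2) (a ℕ.* a ℕ.* 2 ℕ.+ a) (expand a)))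
  where
  expand : ∀ a → a ℕ.* 2 ℕ.* (a ℕ.* 2 ℕ.+ 1) ≡ (a ℕ.* a ℕ.* 2 ℕ.+ a) ℕ.* 2
  expand = solve-∀

T-+odd : ∀ i a → T (i ℕ.+ suc (a ℕ.* 2)) ≡
         T i ℕ.+ (i ℕ.* suc (a ℕ.* 2) ℕ.+ suc (a ℕ.* 2) ℕ.* suc a)
T-+odd i a = ≡.trans (T-+ i (suc (a ℕ.* 2))) (≡.cong (λ t → T i ℕ.+ (i ℕ.* suc (a ℕ.* 2) ℕ.+ t))
  (T-unique (suc (a ℕ.* 2)) (suc (a ℕ.* 2) ℕ.* suc a) (expand a)))
  where
  expand : ∀ a → suc (a ℕ.* 2) ℕ.* (suc (a ℕ.* 2) ℕ.+ 1) ≡ suc (a ℕ.* 2) ℕ.* suc a ℕ.* 2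
  expand = solve-∀

-- The eigenvector equation for the closed formula

-- `P^≉1` keeps the factors p^{2r} - 1 away from zero; `PX≉1` does so for the factors 1 - p^{k-s}
-- and 1 - p^{k-2s}, and it also separates the eigenvalues, whose ratios are monomials containing X.
record Independent {c ℓ} (R : CommutativeRing c ℓ) (P X : CommutativeRing.Carrier R) : Set ℓ where
  open CommutativeRing R
  open SemiringExp semiring using (_^_)
  field
    P≉0  : ¬ P ≈ 0#
    X≉0  : ¬ X ≈ 0#
    P^≉1 : ∀ k → ¬ P ^ suc k ≈ 1#
    PX≉1 : ∀ k l → ¬ P ^ k * X ^ suc l ≈ 1#

module Eigenvectors {c ℓ} (R : CommutativeRing c ℓ)
  (_⁻¹ : CommutativeRing.Carrier R → CommutativeRing.Carrier R) (isField : IsField R _⁻¹)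
  (P X ε : CommutativeRing.Carrier R) (independent : Independent R P X) where

  open CommutativeRing R
  open Independent independent
  open IsField isField
  open FieldProperties R _⁻¹ isField
  open Convolution R
  open RingProperties ring using (x∙y⁻¹≈ε⇒x≈y; -‿distribˡ-*; -‿distribʳ-*)
  open SemiringExp semiring using (_^_; ^-homo-*; ^-assocʳ)
  open Exp commutativeSemiring using (^-distrib-*)
  open CommutativeSemigroupProperties *-commutativeSemigroup using (interchange)
  open CommutativeMonoidSolver *-commutativeMonoid using (solve) renaming (_⊕_ to infixl 7 _:*_; _⊜_ to infix 4 _:=_)
  open import Relation.Binary.Reasoning.Setoid setoid

  telescope : ∀ x y → (x - 1#) + x * (y - 1#) ≈ x * y - 1#
  telescope x y = begin
    (x - 1#) + x * (y - 1#)         ≈⟨ +-congˡ (distribˡ x y (- 1#)) ⟩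
    (x - 1#) + (x * y + x * - 1#)   ≈⟨ +-congˡ (+-congˡ (trans (sym (-‿distribʳ-* x 1#)) (-‿cong (*-identityʳ x)))) ⟩
    (x - 1#) + (x * y - x)          ≈⟨ +-congˡ (+-comm (x * y) (- x)) ⟩
    (x - 1#) + (- x + x * y)        ≈⟨ +-assoc (x - 1#) (- x) (x * y) ⟨
    (x - 1#) - x + x * y            ≈⟨ +-congʳ (+-assoc x (- 1#) (- x)) ⟩
    x + (- 1# - x) + x * y          ≈⟨ +-congʳ (+-congˡ (+-comm (- 1#) (- x))) ⟩
    x + (- x - 1#) + x * y          ≈⟨ +-congʳ (+-assoc x (- x) (- 1#)) ⟨
    (x - x) - 1# + x * y            ≈⟨ +-congʳ (+-congʳ (-‿inverseʳ x)) ⟩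
    0# - 1# + x * y                 ≈⟨ +-congʳ (+-identityˡ (- 1#)) ⟩
    - 1# + x * y                    ≈⟨ +-comm (- 1#) (x * y) ⟩
    x * y - 1#                      ∎

  1-x+x : ∀ x → (1# - x) + x ≈ 1#
  1-x+x x = trans (+-assoc 1# (- x) x) (trans (+-congˡ (-‿inverseˡ x)) (+-identityʳ 1#))

  convex : ∀ t x → t * (1# - x) + t * x ≈ t
  convex t x = trans (sym (distribˡ t (1# - x) x)) (trans (*-congˡ (1-x+x x)) (*-identityʳ t))

  -- The origin of the numerator 1 - p^{i-s} of c_ij for χ₀: with x = q^a and w = p^{i-s} the two
  -- summands are an even and an odd term of the sum over k, and x drops out.
  blend : ∀ t x w → t * (1# - x * w) + t * ((x - 1#) * w) ≈ t * (1# - w)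
  blend t x w = trans (sym (distribˡ t _ _)) (*-congˡ (begin
    (1# - x * w) + (x - 1#) * w        ≈⟨ +-congˡ (distribʳ w x (- 1#)) ⟩
    (1# - x * w) + (x * w + - 1# * w)  ≈⟨ +-assoc _ _ _ ⟨
    (1# - x * w) + x * w + - 1# * w    ≈⟨ +-cong (1-x+x (x * w)) (trans (sym (-‿distribˡ-* 1# w)) (-‿cong (*-identityˡ w))) ⟩
    1# - w                             ∎))


  -- Since x y = 1, only the integer u - v matters; the hypothesis compares these differences
  -- without subtracting. Both sides are padded by x^k y^k = 1 until their exponents agree.
  cancel-powers : ∀ {x y} → x * y ≈ 1# → ∀ u v u′ v′ → u ℕ.+ v′ ≡ u′ ℕ.+ v →
                  x ^ u * y ^ v ≈ x ^ u′ * y ^ v′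
  cancel-powers {x} {y} xy≈1 u v u′ v′ e = begin
    x ^ u * y ^ v                       ≈⟨ extend u v v′ ⟩
    x ^ (u ℕ.+ v′) * y ^ (v ℕ.+ v′)     ≡⟨ ≡.cong₂ (λ k l → x ^ k * y ^ l) e (ℕ.+-comm v v′) ⟩
    x ^ (u′ ℕ.+ v) * y ^ (v′ ℕ.+ v)     ≈⟨ extend u′ v′ v ⟨
    x ^ u′ * y ^ v′                     ∎
    where
    power≈1 : ∀ k → x ^ k * y ^ k ≈ 1#
    power≈1 zero    = *-identityˡ 1#
    power≈1 (suc k) = trans (interchange _ _ _ _) (trans (*-cong xy≈1 (power≈1 k)) (*-identityˡ 1#))

    extend : ∀ u v k → x ^ u * y ^ v ≈ x ^ (u ℕ.+ k) * y ^ (v ℕ.+ k)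
    extend u v k = begin
      x ^ u * y ^ v                        ≈⟨ *-identityʳ _ ⟨
      x ^ u * y ^ v * 1#                   ≈⟨ *-congˡ (power≈1 k) ⟨
      x ^ u * y ^ v * (x ^ k * y ^ k)      ≈⟨ interchange _ _ _ _ ⟩
      x ^ u * x ^ k * (y ^ v * y ^ k)      ≈⟨ *-cong (^-homo-* x u k) (^-homo-* y v k) ⟨
      x ^ (u ℕ.+ k) * y ^ (v ℕ.+ k)        ∎

  -- The monomial p^{u-v} p^{(z-w)s}. With both signs kept apart in ℕ, equality of monomials reduces
  -- to two equations for `solve-∀`.
  mono : ℕ → ℕ → ℕ → ℕ → Carrier
  mono u v w z = (P ^ u * (P ⁻¹) ^ v) * (X ^ w * (X ⁻¹) ^ z)

  mono-≈ : ∀ u v w z u′ v′ w′ z′ → u ℕ.+ v′ ≡ u′ ℕ.+ v → w ℕ.+ z′ ≡ w′ ℕ.+ z →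
           mono u v w z ≈ mono u′ v′ w′ z′
  mono-≈ u v w z u′ v′ w′ z′ e e′ = *-cong
    (cancel-powers (*-inverseʳ P≉0) u v u′ v′ e) (cancel-powers (*-inverseʳ X≉0) w z w′ z′ e′)

  mono-* : ∀ u v w z u′ v′ w′ z′ → mono u v w z * mono u′ v′ w′ z′ ≈
           mono (u ℕ.+ u′) (v ℕ.+ v′) (w ℕ.+ w′) (z ℕ.+ z′)
  mono-* u v w z u′ v′ w′ z′ = trans (interchange _ _ _ _) (*-cong
    (trans (interchange _ _ _ _) (sym (*-cong (^-homo-* P u u′) (^-homo-* (P ⁻¹) v v′))))
    (trans (interchange _ _ _ _) (sym (*-cong (^-homo-* X w w′) (^-homo-* (X ⁻¹) z z′)))))

  mono-^ : ∀ u v w z k → mono u v w z ^ k ≈ mono (u ℕ.* k) (v ℕ.* k) (w ℕ.* k) (z ℕ.* k)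
  mono-^ u v w z k = trans (^-distrib-* _ _ k) (*-cong
    (trans (^-distrib-* _ _ k) (*-cong (^-assocʳ P u k) (^-assocʳ (P ⁻¹) v k)))
    (trans (^-distrib-* _ _ k) (*-cong (^-assocʳ X w k) (^-assocʳ (X ⁻¹) z k))))

  mono-0 : mono 0 0 0 0 ≈ 1#
  mono-0 = trans (*-cong (*-identityˡ 1#) (*-identityˡ 1#)) (*-identityˡ 1#)

  mono-≉0 : ∀ u v w z → ¬ mono u v w z ≈ 0#
  mono-≉0 u v w z = unit⇒≉0 (trans (mono-* u v w z v u z w)
    (trans (mono-≈ (u ℕ.+ v) (v ℕ.+ u) (w ℕ.+ z) (z ℕ.+ w) 0 0 0 0
      (≡.trans (ℕ.+-identityʳ _) (ℕ.+-comm u v)) (≡.trans (ℕ.+-identityʳ _) (ℕ.+-comm w z))) mono-0))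

  -- Writing q = P², the powers q^a are q a, and F s n = (Z s; q)_n, G s n = 1 / (Z s; q)_n.
  q : ℕ → Carrier
  q a = mono (a ℕ.* 2) 0 0 0

  Z L U : ℕ → Carrier
  Z s = mono s 0 2 0
  L k = 1# - mono k 0 1 0
  U k = 1# - Z k

  D F G : ℕ → ℕ → Carrier
  D i d = Π d λ t → mono (suc (i ℕ.+ t)) 0 0 0 - 1#
  F s n = Π n λ r → U (s ℕ.+ r ℕ.* 2)
  G s n = Π n λ r → U (s ℕ.+ r ℕ.* 2) ⁻¹

  -- Up to the sign (-1)^n this is 1 / (q; q)_n. For a + b = n the signs cancel in E a E b / E n,
  -- which is the q-binomial coefficient [n over b]_q.
  E : ℕ → Carrier
  E n = Π n λ r → (q (suc r) - 1#) ⁻¹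

  μ : ℕ → Carrier
  μ j = mono 0 (T j) 0 j

  term : ℕ → ℕ → ℕ → Carrier
  term s a b = E a * E b * (Z s ^ b * F s a)

  q-+ : ∀ a b → q a * q b ≈ q (a ℕ.+ b)
  q-+ a b = trans (mono-* (a ℕ.* 2) 0 0 0 (b ℕ.* 2) 0 0 0)
    (reflexive (≡.cong (λ k → mono k 0 0 0) (≡.sym (ℕ.*-distribʳ-+ 2 a b))))

  L-shift : ∀ i a → L (i ℕ.+ a ℕ.* 2) ≈ 1# - q a * mono i 0 1 0
  L-shift i a = +-congˡ (-‿cong (trans
    (reflexive (≡.cong (λ k → mono k 0 1 0) (ℕ.+-comm i (a ℕ.* 2))))
    (sym (mono-* (a ℕ.* 2) 0 0 0 i 0 1 0))))

  U-shift : ∀ s a → U (s ℕ.+ a ℕ.* 2) ≈ 1# - q a * Z s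
  U-shift s a = +-congˡ (-‿cong (trans
    (reflexive (≡.cong (λ k → mono k 0 2 0) (ℕ.+-comm s (a ℕ.* 2))))
    (sym (mono-* (a ℕ.* 2) 0 0 0 s 0 2 0))))

  -- The numerators of m_ik and c_kj join to a product independent of k, which can leave the sum.
  D-split : ∀ i d e → D i d * D (i ℕ.+ d) e ≈ D i (d ℕ.+ e)
  D-split i d e = sym (trans (Π-split d e _) (*-congˡ (Π-cong e λ t →
    reflexive (≡.cong (λ k → mono (suc k) 0 0 0 - 1#) (≡.sym (ℕ.+-assoc i d t))))))

  monoP : ∀ k → mono k 0 0 0 ≈ P ^ k
  monoP k = trans (*-cong (*-identityʳ _) (*-identityˡ 1#)) (*-identityʳ _)

  monoPX : ∀ k l → mono k 0 l 0 ≈ P ^ k * X ^ l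
  monoPX k l = *-cong (*-identityʳ _) (*-identityʳ _)

  1-x≉0 : ∀ {x} → ¬ x ≈ 1# → ¬ 1# - x ≈ 0#
  1-x≉0 x≉1 e = x≉1 (sym (x∙y⁻¹≈ε⇒x≈y 1# _ e))

  P-1≉0 : ∀ k → ¬ mono (suc k) 0 0 0 - 1# ≈ 0#
  P-1≉0 k e = P^≉1 k (trans (sym (monoP (suc k))) (x∙y⁻¹≈ε⇒x≈y _ 1# e))

  q≉1 : ∀ a → ¬ q (suc a) - 1# ≈ 0#
  q≉1 a = P-1≉0 (suc (a ℕ.* 2))

  PX-1≉0 : ∀ k l → ¬ mono k 0 (suc l) 0 - 1# ≈ 0#
  PX-1≉0 k l e = PX≉1 k l (trans (sym (monoPX k (suc l))) (x∙y⁻¹≈ε⇒x≈y _ 1# e))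

  L≉0 : ∀ k → ¬ L k ≈ 0#
  L≉0 k = 1-x≉0 λ e → PX≉1 k 0 (trans (sym (monoPX k 1)) e)

  U≉0 : ∀ k → ¬ U k ≈ 0#
  U≉0 k = 1-x≉0 λ e → PX≉1 k 1 (trans (sym (monoPX k 2)) e)


  E-suc : ∀ a → (q (suc a) - 1#) * E (suc a) ≈ E a
  E-suc a = begin
    (q (suc a) - 1#) * (E a * (q (suc a) - 1#) ⁻¹)  ≈⟨ solve 3 (λ x y z → x :* (y :* z) := (x :* z) :* y) refl _ _ _ ⟩
    (q (suc a) - 1#) * (q (suc a) - 1#) ⁻¹ * E a    ≈⟨ *-congʳ (*-inverseʳ (q≉1 a)) ⟩
    1# * E a                                        ≈⟨ *-identityˡ _ ⟩
    E a                                             ∎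

  -- The identity Σ [n over b] Z^b (Z; q)_{n-b} = 1, divided by Π_{r=1}^n (q^r - 1).
  -- Multiplying by q^n - 1 = (q^a - 1) + q^a (q^b - 1) reduces n to n - 1.
  q-binomial : ∀ s n → conv n (term s) ≈ E n
  q-binomial s zero    = trans (*-cong (*-identityˡ 1#) (*-identityˡ 1#)) (*-identityˡ 1#)
  q-binomial s (suc n) = *-cancelˡ (q≉1 n) (begin
    (q (suc n) - 1#) * conv (suc n) (term s)
      ≈⟨ *-distribˡ-conv (suc n) _ (term s) ⟩
    conv (suc n) (λ a b → (q (suc n) - 1#) * term s a b)
      ≈⟨ conv-cong (suc n) split ⟩
    conv (suc n) (λ a b → left a b + right a b)
      ≈⟨ conv-+ (suc n) left right ⟩
    conv (suc n) left + conv (suc n) right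
      -- The factor q^a - 1 kills the end a = 0 and q^b - 1 the end b = 0, so that both sums become
      -- sums over a + b = n.
      ≈⟨ +-cong (conv-dropˡ n left left-0) (conv-dropʳ n right right-0) ⟩
    conv n (λ a b → left (suc a) b) + conv n (λ a b → right a (suc b))
      ≈⟨ conv-+ n _ _ ⟨
    conv n (λ a b → left (suc a) b + right a (suc b))
      ≈⟨ conv-cong n (λ a b _ → merge a b) ⟩
    conv n (term s)
      ≈⟨ q-binomial s n ⟩
    E n
      ≈⟨ E-suc n ⟨
    (q (suc n) - 1#) * E (suc n) ∎)
    where
    left right : ℕ → ℕ → Carrier
    left  a b = (q a - 1#) * term s a b
    right a b = q a * (q b - 1#) * term s a b

    q0-1≈0 : q 0 - 1# ≈ 0#
    q0-1≈0 = trans (+-congʳ mono-0) (-‿inverseʳ 1#)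

    left-0 : left 0 (suc n) ≈ 0#
    left-0 = trans (*-congʳ q0-1≈0) (zeroˡ _)

    right-0 : right (suc n) 0 ≈ 0#
    right-0 = trans (*-congʳ (trans (*-congˡ q0-1≈0) (zeroʳ _))) (zeroˡ _)

    split : ∀ a b → a ℕ.+ b ≡ suc n → (q (suc n) - 1#) * term s a b ≈ left a b + right a b
    split a b a+b≡1+n = begin
      (q (suc n) - 1#) * term s a b     ≡⟨ ≡.cong (λ k → (q k - 1#) * term s a b) a+b≡1+n ⟨
      (q (a ℕ.+ b) - 1#) * term s a b   ≈⟨ *-congʳ (+-congʳ (q-+ a b)) ⟨
      (q a * q b - 1#) * term s a b     ≈⟨ *-congʳ (telescope (q a) (q b)) ⟨
      ((q a - 1#) + q a * (q b - 1#)) * term s a b  ≈⟨ distribʳ _ _ _ ⟩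
      left a b + right a b              ∎

    -- Raising a extends (Z; q)_a by 1 - q^a Z, and raising b extends Z^b by Z, which comes with the
    -- factor q^a of `right`. These two contributions add up to 1.
    merge : ∀ a b → left (suc a) b + right a (suc b) ≈ term s a b
    merge a b = begin
      left (suc a) b + right a (suc b)
        ≈⟨ +-cong
          (solve 6 (λ v e e′ z f u → v :* ((e :* e′) :* (z :* (f :* u))) := ((v :* e) :* e′) :* (z :* f) :* u) refl _ _ _ _ _ _)
          (solve 7 (λ x v e e′ z zb f → (x :* v) :* ((e :* e′) :* ((z :* zb) :* f)) := (e :* (v :* e′)) :* (zb :* f) :* (x :* z)) refl _ _ _ _ _ _ _) ⟩
      ((q (suc a) - 1#) * E (suc a)) * E b * (Z s ^ b * F s a) * U (s ℕ.+ a ℕ.* 2)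
      + E a * ((q (suc b) - 1#) * E (suc b)) * (Z s ^ b * F s a) * (q a * Z s)
        ≈⟨ +-cong (*-cong (*-congʳ (*-congʳ (E-suc a))) (U-shift s a))
                  (*-congʳ (*-congʳ (*-congˡ (E-suc b)))) ⟩
      term s a b * (1# - q a * Z s) + term s a b * (q a * Z s)
        ≈⟨ convex (term s a b) (q a * Z s) ⟩
      term s a b ∎


  -- This is (Z; q)_{a+b} = (Z; q)_a (q^a Z; q)_b. It produces the factor (Z; q)_a of the q-binomial
  -- sum: the denominator of c_kj consists of the last b factors of a denominator that depends on i
  -- and j alone.
  G-tail : ∀ s a b → G (s ℕ.+ a ℕ.* 2) b ≈ F s a * G s (a ℕ.+ b)
  G-tail s a b = sym (begin
    F s a * G s (a ℕ.+ b)
      ≈⟨ *-congˡ (Π-split a b _) ⟩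
    F s a * (G s a * Π b (λ r → U (s ℕ.+ (a ℕ.+ r) ℕ.* 2) ⁻¹))
      ≈⟨ *-assoc _ _ _ ⟨
    F s a * G s a * Π b (λ r → U (s ℕ.+ (a ℕ.+ r) ℕ.* 2) ⁻¹)
      ≈⟨ *-cong (Π-inverseʳ a λ r → U≉0 (s ℕ.+ r ℕ.* 2))
           (Π-cong b λ r → reflexive (≡.cong (λ k → U k ⁻¹) (index s a r))) ⟩
    1# * G (s ℕ.+ a ℕ.* 2) b
      ≈⟨ *-identityˡ _ ⟩
    G (s ℕ.+ a ℕ.* 2) b ∎)
    where
    index : ∀ s a r → s ℕ.+ (a ℕ.+ r) ℕ.* 2 ≡ s ℕ.+ a ℕ.* 2 ℕ.+ r ℕ.* 2
    index = solve-∀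

  -- The left side holds the monomials of m_ik and c_kj; on the right stand μ_j, the monomial of
  -- c_ij, the power Z^b of the q-binomial sum and a residue P^x X^y. The two equations compare
  -- exponents of P and of X with all negative exponents moved across.
  monomials : ∀ u v i u′ w′ t j u″ w″ s b x y →
    u ℕ.+ u′ ℕ.+ t ≡ u″ ℕ.+ (s ℕ.* b ℕ.+ x) ℕ.+ v →
    w′ ℕ.+ j ≡ w″ ℕ.+ (2 ℕ.* b ℕ.+ y) ℕ.+ i →
    mono u v 0 i * mono u′ 0 w′ 0 ≈
    mono 0 t 0 j * mono u″ 0 w″ 0 * (Z s ^ b * mono x 0 y 0)
  monomials u v i u′ w′ t j u″ w″ s b x y e e′ = begin
    mono u v 0 i * mono u′ 0 w′ 0
      ≈⟨ mono-* u v 0 i u′ 0 w′ 0 ⟩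
    mono (u ℕ.+ u′) (v ℕ.+ 0) w′ (i ℕ.+ 0)
      ≈⟨ mono-≈ (u ℕ.+ u′) (v ℕ.+ 0) w′ (i ℕ.+ 0)
                (u″ ℕ.+ (s ℕ.* b ℕ.+ x)) (t ℕ.+ 0 ℕ.+ 0) (w″ ℕ.+ (2 ℕ.* b ℕ.+ y)) (j ℕ.+ 0 ℕ.+ 0)
           (pad (u ℕ.+ u′) (u″ ℕ.+ (s ℕ.* b ℕ.+ x)) t v e) (pad w′ (w″ ℕ.+ (2 ℕ.* b ℕ.+ y)) j i e′) ⟩
    mono (u″ ℕ.+ (s ℕ.* b ℕ.+ x)) (t ℕ.+ 0 ℕ.+ 0) (w″ ℕ.+ (2 ℕ.* b ℕ.+ y)) (j ℕ.+ 0 ℕ.+ 0)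
      ≈⟨ mono-* u″ (t ℕ.+ 0) w″ (j ℕ.+ 0) (s ℕ.* b ℕ.+ x) 0 (2 ℕ.* b ℕ.+ y) 0 ⟨
    mono u″ (t ℕ.+ 0) w″ (j ℕ.+ 0) * mono (s ℕ.* b ℕ.+ x) 0 (2 ℕ.* b ℕ.+ y) 0
      ≈⟨ *-cong (mono-* 0 t 0 j u″ 0 w″ 0) (mono-* (s ℕ.* b) 0 (2 ℕ.* b) 0 x 0 y 0) ⟨
    mono 0 t 0 j * mono u″ 0 w″ 0 * (mono (s ℕ.* b) 0 (2 ℕ.* b) 0 * mono x 0 y 0)
      ≈⟨ *-congˡ (*-congʳ (mono-^ s 0 2 0 b)) ⟨
    mono 0 t 0 j * mono u″ 0 w″ 0 * (Z s ^ b * mono x 0 y 0) ∎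
    where
    pad : ∀ k l m o → k ℕ.+ m ≡ l ℕ.+ o → k ℕ.+ (m ℕ.+ 0 ℕ.+ 0) ≡ l ℕ.+ (o ℕ.+ 0)
    pad k l m o e = ≡.trans (≡.cong (k ℕ.+_) (≡.trans (ℕ.+-identityʳ _) (ℕ.+-identityʳ m)))
      (≡.trans e (≡.cong (l ℕ.+_) (≡.sym (ℕ.+-identityʳ o))))

  -- The common shape of all summands. The hypotheses come from `monomials`, `D-split` and `G-tail`;
  -- the result is a factor independent of k, times a q-binomial term, times the weight x that the
  -- term carries.
  assemble : ∀ {m₁ m₂ m z x d₁ d₂ d g f g′} e₁ e₂ →
    m₁ * m₂ ≈ m * (z * x) → d₁ * d₂ ≈ d → g ≈ f * g′ →
    (m₁ * d₁ * e₁) * (m₂ * d₂ * (g * e₂)) ≈ (m * d * g′) * (e₁ * e₂ * (z * f) * x)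
  assemble {m₁} {m₂} {m} {z} {x} {d₁} {d₂} {d} {g} {f} {g′} e₁ e₂ em ed eg = begin
    (m₁ * d₁ * e₁) * (m₂ * d₂ * (g * e₂))
      ≈⟨ solve 7 (λ m₁ m₂ d₁ d₂ e₁ e₂ g → (m₁ :* d₁ :* e₁) :* (m₂ :* d₂ :* (g :* e₂)) :=
           (m₁ :* m₂) :* (d₁ :* d₂) :* g :* (e₁ :* e₂)) refl m₁ m₂ d₁ d₂ e₁ e₂ g ⟩
    (m₁ * m₂) * (d₁ * d₂) * g * (e₁ * e₂)
      ≈⟨ *-congʳ (*-cong (*-cong em ed) eg) ⟩
    (m * (z * x)) * d * (f * g′) * (e₁ * e₂)
      ≈⟨ solve 8 (λ m z x d f g e₁ e₂ → (m :* (z :* x)) :* d :* (f :* g) :* (e₁ :* e₂) :=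
           (m :* d :* g) :* (e₁ :* e₂ :* (z :* f) :* x)) refl m z x d f g′ e₁ e₂ ⟩
    (m * d * g′) * (e₁ * e₂ * (z * f) * x) ∎

  -- mᵨ i a and cᵨ i a are the entries of m_{χ_p} and c_{χ_p} at (i, i + 2a);
  -- m₀, c₀ and m₁, c₁ are those of m_{χ_0} and c_{χ_0} at (i, i + 2a) and (i, i + 2a + 1).
  mᵨ cᵨ m₀ c₀ m₁ c₁ : ℕ → ℕ → Carrier
  mᵨ i a = (ε ^ a * mono (a ℕ.* a) (T (i ℕ.+ a ℕ.* 2)) 0 i) * D i (a ℕ.* 2) * E a
  cᵨ i a = (ε ^ a * mono (a ℕ.* a) 0 (a ℕ.* 2) 0) * D i (a ℕ.* 2)
         * (G (i ℕ.* 2 ℕ.+ a ℕ.* 2 ℕ.+ 1) a * E a)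
  m₀ i a = mono (a ℕ.* (a ℕ.+ 1)) (T (i ℕ.+ a ℕ.* 2)) 0 i * D i (a ℕ.* 2) * E a
  c₀ i a = (mono (a ℕ.* (a ℕ.+ 1)) 0 (a ℕ.* 2) 0 * L i) * D i (a ℕ.* 2)
         * (L (i ℕ.+ a ℕ.* 2) ⁻¹ * G (i ℕ.* 2 ℕ.+ a ℕ.* 2 ℕ.+ 1) a * E a)
  m₁ i a = mono (a ℕ.* (a ℕ.+ 1)) (T (i ℕ.+ suc (a ℕ.* 2))) 0 i * D i (suc (a ℕ.* 2)) * E a
  c₁ i a = mono (a ℕ.* (a ℕ.+ 1)) 0 (suc (a ℕ.* 2)) 0 * D i (suc (a ℕ.* 2))
         * (L (i ℕ.+ suc (a ℕ.* 2)) ⁻¹ * G (i ℕ.* 2 ℕ.+ a ℕ.* 2 ℕ.+ 3) a * E a)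

  -- Replaces values of `T`, which the ring solver cannot open, by their expansions over `T i`,
  -- which then enters the solver as a variable.
  substitute : ∀ {t t′ u u′} l r → t ≡ u → t′ ≡ u′ → l ℕ.+ u ≡ r ℕ.+ u′ → l ℕ.+ t ≡ r ℕ.+ t′
  substitute l r ≡.refl ≡.refl e = e

  conv-factor : ∀ n {f g} K → (∀ a b → a ℕ.+ b ≡ n → f a b ≈ K * g a b) → conv n f ≈ K * conv n g
  conv-factor n {g = g} K e = trans (conv-cong n e) (sym (*-distribˡ-conv n K g))

  eigenᵨ : ∀ i n → conv n (λ a b → mᵨ i a * cᵨ (i ℕ.+ a ℕ.* 2) b) ≈ μ (i ℕ.+ n ℕ.* 2) * cᵨ i n
  eigenᵨ i n = begin
    conv n (λ a b → mᵨ i a * cᵨ (i ℕ.+ a ℕ.* 2) b)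
      ≈⟨ conv-factor n K summand ⟩
    K * conv n (term s)
      ≈⟨ *-congˡ (q-binomial s n) ⟩
    K * E n
      ≈⟨ solve 6 (λ l e m d g e′ → l :* (e :* m) :* d :* g :* e′ := l :* (e :* m :* d :* (g :* e′)))
           refl (μ (i ℕ.+ n ℕ.* 2)) (ε ^ n) (mono (n ℕ.* n) 0 (n ℕ.* 2) 0) (D i (n ℕ.* 2)) (G s n) (E n) ⟩
    μ (i ℕ.+ n ℕ.* 2) * cᵨ i n ∎
    where
    s : ℕ
    -- Equal to i + j + 1, as j = i + 2n.
    s = i ℕ.* 2 ℕ.+ n ℕ.* 2 ℕ.+ 1

    K : Carrier
    K = μ (i ℕ.+ n ℕ.* 2) * (ε ^ n * mono (n ℕ.* n) 0 (n ℕ.* 2) 0) * D i (n ℕ.* 2) * G s n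

    exponent₁ : ∀ t i a b →
      a ℕ.* a ℕ.+ b ℕ.* b ℕ.+ (t ℕ.+ (i ℕ.* ((a ℕ.+ b) ℕ.* 2) ℕ.+ ((a ℕ.+ b) ℕ.* (a ℕ.+ b) ℕ.* 2 ℕ.+ (a ℕ.+ b)))) ≡
      (a ℕ.+ b) ℕ.* (a ℕ.+ b) ℕ.+ ((i ℕ.* 2 ℕ.+ (a ℕ.+ b) ℕ.* 2 ℕ.+ 1) ℕ.* b ℕ.+ 0)
        ℕ.+ (t ℕ.+ (i ℕ.* (a ℕ.* 2) ℕ.+ (a ℕ.* a ℕ.* 2 ℕ.+ a)))
    exponent₁ = solve-∀

    exponent₂ : ∀ i a b → b ℕ.* 2 ℕ.+ (i ℕ.+ (a ℕ.+ b) ℕ.* 2) ≡ (a ℕ.+ b) ℕ.* 2 ℕ.+ (2 ℕ.* b ℕ.+ 0) ℕ.+ i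
    exponent₂ = solve-∀

    index : ∀ i a b → (i ℕ.+ a ℕ.* 2) ℕ.* 2 ℕ.+ b ℕ.* 2 ℕ.+ 1 ≡ i ℕ.* 2 ℕ.+ (a ℕ.+ b) ℕ.* 2 ℕ.+ 1 ℕ.+ a ℕ.* 2
    index = solve-∀

    summand : ∀ a b → a ℕ.+ b ≡ n → mᵨ i a * cᵨ (i ℕ.+ a ℕ.* 2) b ≈ K * term s a b
    summand a b ≡.refl = trans
      -- For χ_p the terms carry no weight, so the residue is the monomial 1.
      (assemble {x = mono 0 0 0 0} (E a) (E b) monomial
        (trans (D-split i (a ℕ.* 2) (b ℕ.* 2)) (reflexive (≡.cong (D i) (≡.sym (ℕ.*-distribʳ-+ 2 a b)))))
        (trans (reflexive (≡.cong (λ k → G k b) (index i a b))) (G-tail s a b)))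
      (*-congˡ (trans (*-congˡ mono-0) (*-identityʳ _)))
      where
      monomial : (ε ^ a * mono (a ℕ.* a) (T (i ℕ.+ a ℕ.* 2)) 0 i) * (ε ^ b * mono (b ℕ.* b) 0 (b ℕ.* 2) 0) ≈
                 μ (i ℕ.+ n ℕ.* 2) * (ε ^ n * mono (n ℕ.* n) 0 (n ℕ.* 2) 0) * (Z s ^ b * mono 0 0 0 0)
      monomial = begin
        _ ≈⟨ interchange _ _ _ _ ⟩
        (ε ^ a * ε ^ b) * (mono (a ℕ.* a) (T (i ℕ.+ a ℕ.* 2)) 0 i * mono (b ℕ.* b) 0 (b ℕ.* 2) 0)
          ≈⟨ *-cong (sym (^-homo-* ε a b)) (monomials (a ℕ.* a) (T (i ℕ.+ a ℕ.* 2)) i (b ℕ.* b) (b ℕ.* 2)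
              (T (i ℕ.+ n ℕ.* 2)) (i ℕ.+ n ℕ.* 2) (n ℕ.* n) (n ℕ.* 2) s b 0 0
              (substitute (a ℕ.* a ℕ.+ b ℕ.* b) (n ℕ.* n ℕ.+ (s ℕ.* b ℕ.+ 0))
                (T-+even i n) (T-+even i a) (exponent₁ (T i) i a b))
              (exponent₂ i a b)) ⟩
        ε ^ n * (μ (i ℕ.+ n ℕ.* 2) * mono (n ℕ.* n) 0 (n ℕ.* 2) 0 * (Z s ^ b * mono 0 0 0 0))
          ≈⟨ solve 4 (λ e l m z → e :* (l :* m :* z) := l :* (e :* m) :* z) refl _ _ _ _ ⟩
        _ ∎

  -- Put w = p^{i-s}. For k = i + 2a the numerator 1 - p^{k-s} of c_kj is the weight 1 - q^a w. For
  -- k = i + 2a - 1 the monomials leave w, and E (a - 1) = (q^a - 1) E a supplies the rest of the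
  -- weight (q^a - 1) w. `blend` adds the two.
  eigen₀ : ∀ i n →
    conv n (λ a b → m₀ i a * c₀ (i ℕ.+ a ℕ.* 2) b
                  + shift (λ a b → m₁ i a * c₁ (i ℕ.+ suc (a ℕ.* 2)) b) a b) ≈
    μ (i ℕ.+ n ℕ.* 2) * c₀ i n
  eigen₀ i n = begin
    conv n (λ a b → m₀ i a * c₀ (i ℕ.+ a ℕ.* 2) b + shift odd a b)
      ≈⟨ conv-factor n (K * L i) summand ⟩
    K * L i * conv n (term s)
      ≈⟨ *-congˡ (q-binomial s n) ⟩
    K * L i * E n
      ≈⟨ solve 6 (λ l m x d g e → l :* m :* d :* g :* x :* e := l :* (m :* x :* d :* (g :* e)))
           refl (μ j) (mono (n ℕ.* (n ℕ.+ 1)) 0 (n ℕ.* 2) 0) (L i) (D i (n ℕ.* 2)) (L j ⁻¹ * G s n) (E n) ⟩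
    μ j * c₀ i n ∎
    where
    j s : ℕ
    j = i ℕ.+ n ℕ.* 2
    s = i ℕ.* 2 ℕ.+ n ℕ.* 2 ℕ.+ 1

    w K : Carrier
    w = mono i 0 1 0
    K = μ j * mono (n ℕ.* (n ℕ.+ 1)) 0 (n ℕ.* 2) 0 * D i (n ℕ.* 2) * (L j ⁻¹ * G s n)

    odd : ℕ → ℕ → Carrier
    odd a b = m₁ i a * c₁ (i ℕ.+ suc (a ℕ.* 2)) b

    even-exponent₁ : ∀ t i a b →
      a ℕ.* (a ℕ.+ 1) ℕ.+ b ℕ.* (b ℕ.+ 1)
        ℕ.+ (t ℕ.+ (i ℕ.* ((a ℕ.+ b) ℕ.* 2) ℕ.+ ((a ℕ.+ b) ℕ.* (a ℕ.+ b) ℕ.* 2 ℕ.+ (a ℕ.+ b)))) ≡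
      (a ℕ.+ b) ℕ.* (a ℕ.+ b ℕ.+ 1) ℕ.+ ((i ℕ.* 2 ℕ.+ (a ℕ.+ b) ℕ.* 2 ℕ.+ 1) ℕ.* b ℕ.+ 0)
        ℕ.+ (t ℕ.+ (i ℕ.* (a ℕ.* 2) ℕ.+ (a ℕ.* a ℕ.* 2 ℕ.+ a)))
    even-exponent₁ = solve-∀

    even-exponent₂ : ∀ i a b → b ℕ.* 2 ℕ.+ (i ℕ.+ (a ℕ.+ b) ℕ.* 2) ≡ (a ℕ.+ b) ℕ.* 2 ℕ.+ (2 ℕ.* b ℕ.+ 0) ℕ.+ i
    even-exponent₂ = solve-∀

    even-index₁ : ∀ i a b → i ℕ.+ a ℕ.* 2 ℕ.+ b ℕ.* 2 ≡ i ℕ.+ (a ℕ.+ b) ℕ.* 2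
    even-index₁ = solve-∀

    even-index₂ : ∀ i a b → (i ℕ.+ a ℕ.* 2) ℕ.* 2 ℕ.+ b ℕ.* 2 ℕ.+ 1 ≡ i ℕ.* 2 ℕ.+ (a ℕ.+ b) ℕ.* 2 ℕ.+ 1 ℕ.+ a ℕ.* 2
    even-index₂ = solve-∀

    even-summand : ∀ a b → a ℕ.+ b ≡ n →
      m₀ i a * c₀ (i ℕ.+ a ℕ.* 2) b ≈ K * (term s a b * (1# - q a * w))
    even-summand a b ≡.refl = trans
      (assemble (E a) (E b) monomial
        (trans (D-split i (a ℕ.* 2) (b ℕ.* 2)) (reflexive (≡.cong (D i) (≡.sym (ℕ.*-distribʳ-+ 2 a b)))))
        (trans (*-cong (reflexive (≡.cong (λ k → L k ⁻¹) (even-index₁ i a b)))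
                       (trans (reflexive (≡.cong (λ k → G k b) (even-index₂ i a b))) (G-tail s a b)))
               (solve 3 (λ l f g → l :* (f :* g) := f :* (l :* g)) refl _ _ _)))
      (*-congˡ (*-congˡ (L-shift i a)))
      where
      monomial : mono (a ℕ.* (a ℕ.+ 1)) (T (i ℕ.+ a ℕ.* 2)) 0 i
                 * (mono (b ℕ.* (b ℕ.+ 1)) 0 (b ℕ.* 2) 0 * L (i ℕ.+ a ℕ.* 2)) ≈
                 μ j * mono (n ℕ.* (n ℕ.+ 1)) 0 (n ℕ.* 2) 0 * (Z s ^ b * L (i ℕ.+ a ℕ.* 2))
      monomial = begin
        _ ≈⟨ *-assoc _ _ _ ⟨
        mono (a ℕ.* (a ℕ.+ 1)) (T (i ℕ.+ a ℕ.* 2)) 0 i * mono (b ℕ.* (b ℕ.+ 1)) 0 (b ℕ.* 2) 0 * L (i ℕ.+ a ℕ.* 2)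
          ≈⟨ *-congʳ (monomials (a ℕ.* (a ℕ.+ 1)) (T (i ℕ.+ a ℕ.* 2)) i (b ℕ.* (b ℕ.+ 1)) (b ℕ.* 2)
               (T j) j (n ℕ.* (n ℕ.+ 1)) (n ℕ.* 2) s b 0 0
               (substitute (a ℕ.* (a ℕ.+ 1) ℕ.+ b ℕ.* (b ℕ.+ 1)) (n ℕ.* (n ℕ.+ 1) ℕ.+ (s ℕ.* b ℕ.+ 0))
                 (T-+even i n) (T-+even i a) (even-exponent₁ (T i) i a b))
               (even-exponent₂ i a b)) ⟩
        μ j * mono (n ℕ.* (n ℕ.+ 1)) 0 (n ℕ.* 2) 0 * (Z s ^ b * mono 0 0 0 0) * L (i ℕ.+ a ℕ.* 2)
          ≈⟨ *-congʳ (*-congˡ (trans (*-congˡ mono-0) (*-identityʳ _))) ⟩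
        μ j * mono (n ℕ.* (n ℕ.+ 1)) 0 (n ℕ.* 2) 0 * Z s ^ b * L (i ℕ.+ a ℕ.* 2)
          ≈⟨ *-assoc _ _ _ ⟩
        _ ∎

    odd-exponent₁ : ∀ t i a b →
      a ℕ.* (a ℕ.+ 1) ℕ.+ b ℕ.* (b ℕ.+ 1)
        ℕ.+ (t ℕ.+ (i ℕ.* (suc (a ℕ.+ b) ℕ.* 2) ℕ.+ (suc (a ℕ.+ b) ℕ.* suc (a ℕ.+ b) ℕ.* 2 ℕ.+ suc (a ℕ.+ b)))) ≡
      suc (a ℕ.+ b) ℕ.* (suc (a ℕ.+ b) ℕ.+ 1) ℕ.+ ((i ℕ.* 2 ℕ.+ suc (a ℕ.+ b) ℕ.* 2 ℕ.+ 1) ℕ.* b ℕ.+ i)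
        ℕ.+ (t ℕ.+ (i ℕ.* suc (a ℕ.* 2) ℕ.+ suc (a ℕ.* 2) ℕ.* suc a))
    odd-exponent₁ = solve-∀

    odd-exponent₂ : ∀ i a b → suc (b ℕ.* 2) ℕ.+ (i ℕ.+ suc (a ℕ.+ b) ℕ.* 2) ≡
      suc (a ℕ.+ b) ℕ.* 2 ℕ.+ (2 ℕ.* b ℕ.+ 1) ℕ.+ i
    odd-exponent₂ = solve-∀

    odd-index₀ : ∀ a b → suc (a ℕ.* 2) ℕ.+ suc (b ℕ.* 2) ≡ suc (a ℕ.+ b) ℕ.* 2
    odd-index₀ = solve-∀

    odd-index₁ : ∀ i a b → i ℕ.+ suc (a ℕ.* 2) ℕ.+ suc (b ℕ.* 2) ≡ i ℕ.+ suc (a ℕ.+ b) ℕ.* 2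
    odd-index₁ = solve-∀

    odd-index₂ : ∀ i a b → (i ℕ.+ suc (a ℕ.* 2)) ℕ.* 2 ℕ.+ b ℕ.* 2 ℕ.+ 3 ≡
      i ℕ.* 2 ℕ.+ suc (a ℕ.+ b) ℕ.* 2 ℕ.+ 1 ℕ.+ suc a ℕ.* 2
    odd-index₂ = solve-∀

    odd-summand : ∀ a b → a ℕ.+ b ≡ n →
      shift odd a b ≈ K * (term s a b * ((q a - 1#) * w))
    -- The weight contains q^0 - 1 = 0, in agreement with the zero that `shift` puts at a = 0.
    odd-summand zero    b _      = sym (begin
      K * (term s 0 b * ((q 0 - 1#) * w))
        ≈⟨ *-congˡ (*-congˡ (trans (*-congʳ (trans (+-congʳ mono-0) (-‿inverseʳ 1#))) (zeroˡ w))) ⟩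
      K * (term s 0 b * 0#)  ≈⟨ *-congˡ (zeroʳ _) ⟩
      K * 0#                 ≈⟨ zeroʳ K ⟩
      0#                     ∎)
    odd-summand (suc a) b ≡.refl = trans
      (assemble (E a) (E b)
        (monomials (a ℕ.* (a ℕ.+ 1)) (T (i ℕ.+ suc (a ℕ.* 2))) i (b ℕ.* (b ℕ.+ 1)) (suc (b ℕ.* 2))
           (T j) j (n ℕ.* (n ℕ.+ 1)) (n ℕ.* 2) s b i 1
           (substitute (a ℕ.* (a ℕ.+ 1) ℕ.+ b ℕ.* (b ℕ.+ 1)) (n ℕ.* (n ℕ.+ 1) ℕ.+ (s ℕ.* b ℕ.+ i))
             (T-+even i n) (T-+odd i a) (odd-exponent₁ (T i) i a b))
           (odd-exponent₂ i a b))
        (trans (D-split i (suc (a ℕ.* 2)) (suc (b ℕ.* 2))) (reflexive (≡.cong (D i) (odd-index₀ a b))))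
        (trans (*-cong (reflexive (≡.cong (λ k → L k ⁻¹) (odd-index₁ i a b)))
                       (trans (reflexive (≡.cong (λ k → G k b) (odd-index₂ i a b))) (G-tail s (suc a) b)))
               (solve 3 (λ l f g → l :* (f :* g) := f :* (l :* g)) refl _ _ _)))
      (*-congˡ (trans (*-congʳ (*-congʳ (*-congʳ (sym (E-suc a)))))
        (solve 5 (λ v e e′ z w → v :* e :* e′ :* z :* w := e :* e′ :* z :* (v :* w)) refl _ _ _ _ _)))

    summand : ∀ a b → a ℕ.+ b ≡ n →
      m₀ i a * c₀ (i ℕ.+ a ℕ.* 2) b + shift odd a b ≈ K * L i * term s a b
    summand a b e = begin
      m₀ i a * c₀ (i ℕ.+ a ℕ.* 2) b + shift odd a b
        ≈⟨ +-cong (even-summand a b e) (odd-summand a b e) ⟩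
      K * (term s a b * (1# - q a * w)) + K * (term s a b * ((q a - 1#) * w))
        ≈⟨ distribˡ K _ _ ⟨
      K * (term s a b * (1# - q a * w) + term s a b * ((q a - 1#) * w))
        ≈⟨ *-congˡ (blend (term s a b) (q a) w) ⟩
      K * (term s a b * L i)
        ≈⟨ solve 3 (λ k t l → k :* (t :* l) := k :* l :* t) refl K (term s a b) (L i) ⟩
      K * L i * term s a b ∎

  -- Here the neighbours k = i + 2a and k = i + 2a + 1 are paired. With w = p^{i+2a+1-s}, the first
  -- has weight w from its monomials and the second has weight 1 - w, the numerator factor of c_kj.
  -- Their sum is 1, in accordance with the missing factor 1 - p^{i-s} in c_ij.
  eigen₁ : ∀ i n →
    conv n (λ a b → m₀ i a * c₁ (i ℕ.+ a ℕ.* 2) b + m₁ i a * c₀ (i ℕ.+ suc (a ℕ.* 2)) b) ≈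
    μ (i ℕ.+ suc (n ℕ.* 2)) * c₁ i n
  eigen₁ i n = begin
    conv n (λ a b → m₀ i a * c₁ (i ℕ.+ a ℕ.* 2) b + m₁ i a * c₀ (i ℕ.+ suc (a ℕ.* 2)) b)
      ≈⟨ conv-factor n K summand ⟩
    K * conv n (term s)
      ≈⟨ *-congˡ (q-binomial s n) ⟩
    K * E n
      ≈⟨ solve 5 (λ l m d g e → l :* m :* d :* g :* e := l :* (m :* d :* (g :* e)))
           refl (μ j) (mono (n ℕ.* (n ℕ.+ 1)) 0 (suc (n ℕ.* 2)) 0) (D i (suc (n ℕ.* 2))) (L j ⁻¹ * G s n) (E n) ⟩
    μ j * c₁ i n ∎
    where
    j s : ℕ
    j = i ℕ.+ suc (n ℕ.* 2)
    -- Equal to i + j + 2, as j = i + 2n + 1.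
    s = i ℕ.* 2 ℕ.+ n ℕ.* 2 ℕ.+ 3

    K : Carrier
    K = μ j * mono (n ℕ.* (n ℕ.+ 1)) 0 (suc (n ℕ.* 2)) 0 * D i (suc (n ℕ.* 2)) * (L j ⁻¹ * G s n)

    even-exponent₁ : ∀ t i a b →
      a ℕ.* (a ℕ.+ 1) ℕ.+ b ℕ.* (b ℕ.+ 1)
        ℕ.+ (t ℕ.+ (i ℕ.* suc ((a ℕ.+ b) ℕ.* 2) ℕ.+ suc ((a ℕ.+ b) ℕ.* 2) ℕ.* suc (a ℕ.+ b))) ≡
      (a ℕ.+ b) ℕ.* (a ℕ.+ b ℕ.+ 1) ℕ.+ ((i ℕ.* 2 ℕ.+ (a ℕ.+ b) ℕ.* 2 ℕ.+ 3) ℕ.* b ℕ.+ (i ℕ.+ suc (a ℕ.* 2)))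
        ℕ.+ (t ℕ.+ (i ℕ.* (a ℕ.* 2) ℕ.+ (a ℕ.* a ℕ.* 2 ℕ.+ a)))
    even-exponent₁ = solve-∀

    even-exponent₂ : ∀ i a b → suc (b ℕ.* 2) ℕ.+ (i ℕ.+ suc ((a ℕ.+ b) ℕ.* 2)) ≡
      suc ((a ℕ.+ b) ℕ.* 2) ℕ.+ (2 ℕ.* b ℕ.+ 1) ℕ.+ i
    even-exponent₂ = solve-∀

    even-index₀ : ∀ a b → a ℕ.* 2 ℕ.+ suc (b ℕ.* 2) ≡ suc ((a ℕ.+ b) ℕ.* 2)
    even-index₀ = solve-∀

    even-index₁ : ∀ i a b → i ℕ.+ a ℕ.* 2 ℕ.+ suc (b ℕ.* 2) ≡ i ℕ.+ suc ((a ℕ.+ b) ℕ.* 2)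
    even-index₁ = solve-∀

    even-index₂ : ∀ i a b → (i ℕ.+ a ℕ.* 2) ℕ.* 2 ℕ.+ b ℕ.* 2 ℕ.+ 3 ≡
      i ℕ.* 2 ℕ.+ (a ℕ.+ b) ℕ.* 2 ℕ.+ 3 ℕ.+ a ℕ.* 2
    even-index₂ = solve-∀

    even-summand : ∀ a b → a ℕ.+ b ≡ n →
      m₀ i a * c₁ (i ℕ.+ a ℕ.* 2) b ≈ K * (term s a b * mono (i ℕ.+ suc (a ℕ.* 2)) 0 1 0)
    even-summand a b ≡.refl = assemble (E a) (E b)
      (monomials (a ℕ.* (a ℕ.+ 1)) (T (i ℕ.+ a ℕ.* 2)) i (b ℕ.* (b ℕ.+ 1)) (suc (b ℕ.* 2))
         (T j) j (n ℕ.* (n ℕ.+ 1)) (suc (n ℕ.* 2)) s b (i ℕ.+ suc (a ℕ.* 2)) 1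
         (substitute (a ℕ.* (a ℕ.+ 1) ℕ.+ b ℕ.* (b ℕ.+ 1))
           (n ℕ.* (n ℕ.+ 1) ℕ.+ (s ℕ.* b ℕ.+ (i ℕ.+ suc (a ℕ.* 2))))
           (T-+odd i n) (T-+even i a) (even-exponent₁ (T i) i a b))
         (even-exponent₂ i a b))
      (trans (D-split i (a ℕ.* 2) (suc (b ℕ.* 2))) (reflexive (≡.cong (D i) (even-index₀ a b))))
      (trans (*-cong (reflexive (≡.cong (λ k → L k ⁻¹) (even-index₁ i a b)))
                     (trans (reflexive (≡.cong (λ k → G k b) (even-index₂ i a b))) (G-tail s a b)))
             (solve 3 (λ l f g → l :* (f :* g) := f :* (l :* g)) refl _ _ _))

    odd-exponent₁ : ∀ t i a b →
      a ℕ.* (a ℕ.+ 1) ℕ.+ b ℕ.* (b ℕ.+ 1)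
        ℕ.+ (t ℕ.+ (i ℕ.* suc ((a ℕ.+ b) ℕ.* 2) ℕ.+ suc ((a ℕ.+ b) ℕ.* 2) ℕ.* suc (a ℕ.+ b))) ≡
      (a ℕ.+ b) ℕ.* (a ℕ.+ b ℕ.+ 1) ℕ.+ ((i ℕ.* 2 ℕ.+ (a ℕ.+ b) ℕ.* 2 ℕ.+ 3) ℕ.* b ℕ.+ 0)
        ℕ.+ (t ℕ.+ (i ℕ.* suc (a ℕ.* 2) ℕ.+ suc (a ℕ.* 2) ℕ.* suc a))
    odd-exponent₁ = solve-∀

    odd-exponent₂ : ∀ i a b → b ℕ.* 2 ℕ.+ (i ℕ.+ suc ((a ℕ.+ b) ℕ.* 2)) ≡
      suc ((a ℕ.+ b) ℕ.* 2) ℕ.+ (2 ℕ.* b ℕ.+ 0) ℕ.+ i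
    odd-exponent₂ = solve-∀

    odd-index₀ : ∀ a b → suc (a ℕ.* 2) ℕ.+ b ℕ.* 2 ≡ suc ((a ℕ.+ b) ℕ.* 2)
    odd-index₀ = solve-∀

    odd-index₁ : ∀ i a b → i ℕ.+ suc (a ℕ.* 2) ℕ.+ b ℕ.* 2 ≡ i ℕ.+ suc ((a ℕ.+ b) ℕ.* 2)
    odd-index₁ = solve-∀

    odd-index₂ : ∀ i a b → (i ℕ.+ suc (a ℕ.* 2)) ℕ.* 2 ℕ.+ b ℕ.* 2 ℕ.+ 1 ≡
      i ℕ.* 2 ℕ.+ (a ℕ.+ b) ℕ.* 2 ℕ.+ 3 ℕ.+ a ℕ.* 2
    odd-index₂ = solve-∀

    odd-summand : ∀ a b → a ℕ.+ b ≡ n →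
      m₁ i a * c₀ (i ℕ.+ suc (a ℕ.* 2)) b ≈ K * (term s a b * L (i ℕ.+ suc (a ℕ.* 2)))
    odd-summand a b ≡.refl = assemble (E a) (E b) monomial
      (trans (D-split i (suc (a ℕ.* 2)) (b ℕ.* 2)) (reflexive (≡.cong (D i) (odd-index₀ a b))))
      (trans (*-cong (reflexive (≡.cong (λ k → L k ⁻¹) (odd-index₁ i a b)))
                     (trans (reflexive (≡.cong (λ k → G k b) (odd-index₂ i a b))) (G-tail s a b)))
             (solve 3 (λ l f g → l :* (f :* g) := f :* (l :* g)) refl _ _ _))
      where
      monomial : mono (a ℕ.* (a ℕ.+ 1)) (T (i ℕ.+ suc (a ℕ.* 2))) 0 i
                 * (mono (b ℕ.* (b ℕ.+ 1)) 0 (b ℕ.* 2) 0 * L (i ℕ.+ suc (a ℕ.* 2))) ≈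
                 μ j * mono (n ℕ.* (n ℕ.+ 1)) 0 (suc (n ℕ.* 2)) 0 * (Z s ^ b * L (i ℕ.+ suc (a ℕ.* 2)))
      monomial = begin
        _ ≈⟨ *-assoc _ _ _ ⟨
        mono (a ℕ.* (a ℕ.+ 1)) (T (i ℕ.+ suc (a ℕ.* 2))) 0 i * mono (b ℕ.* (b ℕ.+ 1)) 0 (b ℕ.* 2) 0 * L (i ℕ.+ suc (a ℕ.* 2))
          ≈⟨ *-congʳ (monomials (a ℕ.* (a ℕ.+ 1)) (T (i ℕ.+ suc (a ℕ.* 2))) i (b ℕ.* (b ℕ.+ 1)) (b ℕ.* 2)
               (T j) j (n ℕ.* (n ℕ.+ 1)) (suc (n ℕ.* 2)) s b 0 0
               (substitute (a ℕ.* (a ℕ.+ 1) ℕ.+ b ℕ.* (b ℕ.+ 1)) (n ℕ.* (n ℕ.+ 1) ℕ.+ (s ℕ.* b ℕ.+ 0))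
                 (T-+odd i n) (T-+odd i a) (odd-exponent₁ (T i) i a b))
               (odd-exponent₂ i a b)) ⟩
        μ j * mono (n ℕ.* (n ℕ.+ 1)) 0 (suc (n ℕ.* 2)) 0 * (Z s ^ b * mono 0 0 0 0) * L (i ℕ.+ suc (a ℕ.* 2))
          ≈⟨ *-congʳ (*-congˡ (trans (*-congˡ mono-0) (*-identityʳ _))) ⟩
        μ j * mono (n ℕ.* (n ℕ.+ 1)) 0 (suc (n ℕ.* 2)) 0 * Z s ^ b * L (i ℕ.+ suc (a ℕ.* 2))
          ≈⟨ *-assoc _ _ _ ⟩
        _ ∎

    summand : ∀ a b → a ℕ.+ b ≡ n →
      m₀ i a * c₁ (i ℕ.+ a ℕ.* 2) b + m₁ i a * c₀ (i ℕ.+ suc (a ℕ.* 2)) b ≈ K * term s a b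
    summand a b e = begin
      m₀ i a * c₁ (i ℕ.+ a ℕ.* 2) b + m₁ i a * c₀ (i ℕ.+ suc (a ℕ.* 2)) b
        ≈⟨ +-cong (even-summand a b e) (odd-summand a b e) ⟩
      K * (term s a b * w) + K * (term s a b * (1# - w))
        ≈⟨ distribˡ K _ _ ⟨
      K * (term s a b * w + term s a b * (1# - w))
        ≈⟨ *-congˡ (trans (+-comm _ _) (convex (term s a b) w)) ⟩
      K * term s a b ∎
      where
      w : Carrier
      w = mono (i ℕ.+ suc (a ℕ.* 2)) 0 1 0

  mono-μ : ∀ i → mono 0 (T (i ℕ.+ 0)) 0 i ≈ μ i
  mono-μ i = reflexive (≡.cong (λ k → mono 0 (T k) 0 i) (ℕ.+-identityʳ i))

  mᵨ-diagonal : ∀ i → mᵨ i 0 ≈ μ i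
  mᵨ-diagonal i = trans (*-identityʳ _) (trans (*-identityʳ _) (trans (*-identityˡ _) (mono-μ i)))

  m₀-diagonal : ∀ i → m₀ i 0 ≈ μ i
  m₀-diagonal i = trans (*-identityʳ _) (trans (*-identityʳ _) (mono-μ i))

  cᵨ-diagonal : ∀ i → cᵨ i 0 ≈ 1#
  cᵨ-diagonal i = trans (*-cong
    (trans (*-identityʳ _) (trans (*-identityˡ _) mono-0)) (*-identityˡ 1#)) (*-identityˡ 1#)

  c₀-diagonal : ∀ i → c₀ i 0 ≈ 1#
  c₀-diagonal i = begin
    c₀ i 0                ≈⟨ *-cong (trans (*-identityʳ _) (trans (*-congʳ mono-0) (*-identityˡ (L i))))
                               (trans (*-identityʳ _) (*-identityʳ _)) ⟩
    L i * L (i ℕ.+ 0) ⁻¹  ≡⟨ ≡.cong (λ k → L i * L k ⁻¹) (ℕ.+-identityʳ i) ⟩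
    L i * L i ⁻¹          ≈⟨ *-inverseʳ (L≉0 i) ⟩
    1#                    ∎

-- From superdiagonals to matrices: B and the closed formula are inverse

data Parity : ℕ → Set where
  even : ∀ a → Parity (a ℕ.* 2)
  odd  : ∀ a → Parity (suc (a ℕ.* 2))

parity : ∀ n → Parity n
parity zero = even 0
parity (suc n) with parity n
... | even a = odd a
... | odd a  = even (suc a)

parity-even : ∀ a → parity (a ℕ.* 2) ≡ even a
parity-even zero = ≡.refl
parity-even (suc a) rewrite parity-even a = ≡.refl

parity-odd : ∀ a → parity (suc (a ℕ.* 2)) ≡ odd a
parity-odd a rewrite parity-even a = ≡.refl

module Diagonalization {r ℓ} (R : CommutativeRing r ℓ)
  (_⁻¹ : CommutativeRing.Carrier R → CommutativeRing.Carrier R) (isField : IsField R _⁻¹)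
  (P X ε : CommutativeRing.Carrier R) (independent : Independent R P X) where

  open CommutativeRing R
  open IsField isField
  open FieldProperties R _⁻¹ isField
  open Convolution R
  open TriangularMatrices R
  open Eigenvectors R _⁻¹ isField P X ε independent using (mono; mono-*; mono-≈; mono-0; mono-≉0; μ; PX-1≉0)
  open RingProperties ring using (-‿distribˡ-*; x≈y⇒x∙y⁻¹≈ε)
  open SemiringSum semiring using (sum; sum-cong-≋)
  open CommutativeMonoidSolver *-commutativeMonoid using (solve) renaming (_⊕_ to infixl 7 _:*_; _⊜_ to infix 4 _:=_)
  open import Relation.Binary.Reasoning.Setoid setoid

  -- The eigenvalue ratio μ_i / μ_j for j = i + d. It is the power p^{(j-i)((j+i+1)/2-s)} in the
  -- denominator of the recursion for b.
  gap : ℕ → ℕ → Carrier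
  gap i d = mono (i ℕ.* d ℕ.+ T d) 0 d 0

  μ-gap : ∀ i d → μ (i ℕ.+ d) * gap i d ≈ μ i
  μ-gap i d = trans (mono-* 0 (T (i ℕ.+ d)) 0 (i ℕ.+ d) (i ℕ.* d ℕ.+ T d) 0 d 0)
    (mono-≈ (i ℕ.* d ℕ.+ T d) (T (i ℕ.+ d) ℕ.+ 0) d (i ℕ.+ d ℕ.+ 0) 0 (T i) 0 i
      (≡.trans (ℕ.+-comm (i ℕ.* d ℕ.+ T d) (T i)) (≡.trans (≡.sym (T-+ i d)) (≡.sym (ℕ.+-identityʳ _))))
      (≡.trans (ℕ.+-comm d i) (≡.sym (ℕ.+-identityʳ _))))

  μ-inverse : ∀ j → μ j * mono (T j) 0 j 0 ≈ 1#
  μ-inverse j = trans (mono-* 0 (T j) 0 j (T j) 0 j 0) (trans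
    (mono-≈ (T j) (T j ℕ.+ 0) j (j ℕ.+ 0) 0 0 0 0
      ≡.refl ≡.refl) mono-0)

  -1+1 : ∀ x → (x - 1#) + 1# ≈ x
  -1+1 x = trans (+-assoc x (- 1#) 1#) (trans (+-congˡ (-‿inverseˡ 1#)) (+-identityʳ x))

  -- Dividing by the second eigenvalue gives (g - 1) x = 0, where the ratio g contains X to a
  -- positive power and hence is not 1.
  μ-distinct : ∀ i d {x} → μ i * x ≈ μ (i ℕ.+ suc d) * x → x ≈ 0#
  μ-distinct i d {x} e = *-cancelˡ (PX-1≉0 (i ℕ.* suc d ℕ.+ T (suc d)) d) (begin
    (g - 1#) * x      ≈⟨ distribʳ x g (- 1#) ⟩
    g * x + - 1# * x  ≈⟨ +-congˡ (trans (sym (-‿distribˡ-* 1# x)) (-‿cong (*-identityˡ x))) ⟩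
    g * x - x         ≈⟨ x≈y⇒x∙y⁻¹≈ε gx≈x ⟩
    0#                ≈⟨ zeroʳ _ ⟨
    (g - 1#) * 0#     ∎)
    where
    g : Carrier
    g = gap i (suc d)

    gx≈x : g * x ≈ x
    gx≈x = *-cancelˡ (mono-≉0 0 (T (i ℕ.+ suc d)) 0 (i ℕ.+ suc d)) (begin
      μ (i ℕ.+ suc d) * (g * x)  ≈⟨ *-assoc _ g x ⟨
      μ (i ℕ.+ suc d) * g * x    ≈⟨ *-congʳ (μ-gap i (suc d)) ⟩
      μ i * x                    ≈⟨ e ⟩
      μ (i ℕ.+ suc d) * x        ∎)

  byParity : (ℕ → Carrier) → (ℕ → Carrier) → ∀ {n} → Parity n → Carrier
  byParity f g (even a) = f a
  byParity f g (odd a)  = g a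

  fromDiagonals : (ℕ → ℕ → Carrier) → (ℕ → ℕ → Carrier) → ℕ → ℕ → Carrier
  fromDiagonals f g i j with i ℕ.≤? j
  ... | yes _ = byParity (f i) (g i) (parity (j ℕ.∸ i))
  ... | no  _ = 0#

  fromDiagonals-upper : ∀ f g i d → fromDiagonals f g i (i ℕ.+ d) ≡ byParity (f i) (g i) (parity d)
  fromDiagonals-upper f g i d with i ℕ.≤? i ℕ.+ d
  ... | yes _ = ≡.cong (λ d → byParity (f i) (g i) (parity d)) (ℕ.m+n∸m≡n i d)
  ... | no i≰ = contradiction (ℕ.m≤m+n i d) i≰

  fromDiagonals-even : ∀ f g i a → fromDiagonals f g i (i ℕ.+ a ℕ.* 2) ≡ f i a
  fromDiagonals-even f g i a = ≡.trans (fromDiagonals-upper f g i (a ℕ.* 2))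
    (≡.cong (byParity (f i) (g i)) (parity-even a))

  fromDiagonals-odd : ∀ f g i a → fromDiagonals f g i (i ℕ.+ suc (a ℕ.* 2)) ≡ g i a
  fromDiagonals-odd f g i a = ≡.trans (fromDiagonals-upper f g i (suc (a ℕ.* 2)))
    (≡.cong (byParity (f i) (g i)) (parity-odd a))

  fromDiagonals-lower : ∀ f g {i j} → j ℕ.< i → fromDiagonals f g i j ≡ 0#
  fromDiagonals-lower f g {i} {j} j<i with i ℕ.≤? j
  ... | yes i≤j = contradiction j<i (ℕ.≤⇒≯ i≤j)
  ... | no  _   = ≡.refl

  -- mE, cE and mO, cO list the entries of m and c on the even and the odd superdiagonals.
  record System : Set (r ⊔ ℓ) where
    field
      m b         : ℕ → ℕ → Carrier
      mE mO cE cO : ℕ → ℕ → Carrier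
      m-lower     : ∀ {i j} → j ℕ.< i → m i j ≈ 0#
      m-even      : ∀ i a → m i (i ℕ.+ a ℕ.* 2) ≈ mE i a
      m-odd       : ∀ i a → m i (i ℕ.+ suc (a ℕ.* 2)) ≈ mO i a
      mE-0        : ∀ i → mE i 0 ≈ μ i
      cE-0        : ∀ i → cE i 0 ≈ 1#
      eigen-even  : ∀ i n →
        conv n (λ a b → mE i a * cE (i ℕ.+ a ℕ.* 2) b
                      + shift (λ a b → mO i a * cO (i ℕ.+ suc (a ℕ.* 2)) b) a b) ≈
        μ (i ℕ.+ n ℕ.* 2) * cE i n
      eigen-odd   : ∀ i n →
        conv n (λ a b → mE i a * cO (i ℕ.+ a ℕ.* 2) b + mO i a * cE (i ℕ.+ suc (a ℕ.* 2)) b) ≈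
        μ (i ℕ.+ suc (n ℕ.* 2)) * cO i n
      b-lower     : ∀ {i j} → j ℕ.< i → b i j ≈ 0#
      b-diagonal  : ∀ i → b i i ≈ 1#
      b-upper     : ∀ i d → b i (i ℕ.+ suc d) ≈
        mono (T (i ℕ.+ suc d)) 0 (i ℕ.+ suc d) 0 * (gap i (suc d) - 1#) ⁻¹
        * sum {suc d} (λ t → m (i ℕ.+ toℕ t) (i ℕ.+ suc d) * b i (i ℕ.+ toℕ t))

    c : ℕ → ℕ → Carrier
    c = fromDiagonals cE cO

    c-lower : ∀ {i j} → j ℕ.< i → c i j ≈ 0#
    c-lower j<i = reflexive (fromDiagonals-lower cE cO j<i)

    c-even : ∀ i a → c i (i ℕ.+ a ℕ.* 2) ≈ cE i a
    c-even i a = reflexive (fromDiagonals-even cE cO i a)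

    c-odd : ∀ i a → c i (i ℕ.+ suc (a ℕ.* 2)) ≈ cO i a
    c-odd i a = reflexive (fromDiagonals-odd cE cO i a)

    matrix : (ℕ → ℕ → Carrier) → ∀ n → SquareMatrix n
    matrix f n i j = f (toℕ i) (toℕ j)

    diagonalᵐ : ∀ i → m i i ≈ μ i
    diagonalᵐ i = trans (reflexive (≡.cong (m i) (≡.sym (ℕ.+-identityʳ i)))) (trans (m-even i 0) (mE-0 i))

    diagonalᶜ : ∀ i → c i i ≈ 1#
    diagonalᶜ i = trans (reflexive (≡.cong (c i) (≡.sym (ℕ.+-identityʳ i)))) (trans (c-even i 0) (cE-0 i))

    -- An even distance j - i splits at k into two even or two odd distances, an odd one into one of
    -- each kind; these are the two equations that a `System` provides.
    eigen : ∀ i N → conv N (λ d e → m i (i ℕ.+ d) * c (i ℕ.+ d) (i ℕ.+ d ℕ.+ e)) ≈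
            μ (i ℕ.+ N) * c i (i ℕ.+ N)
    eigen i N = cases (parity N)
      where
      summand : ℕ → ℕ → Carrier
      summand d e = m i (i ℕ.+ d) * c (i ℕ.+ d) (i ℕ.+ d ℕ.+ e)

      odds : ∀ a b →
        shift (λ a b → summand (suc (a ℕ.* 2)) (suc (b ℕ.* 2))) a b ≈
        shift (λ a b → mO i a * cO (i ℕ.+ suc (a ℕ.* 2)) b) a b
      odds zero    b = refl
      odds (suc a) b = *-cong (m-odd i a) (c-odd _ b)

      cases : ∀ {N} → Parity N → conv N summand ≈ μ (i ℕ.+ N) * c i (i ℕ.+ N)
      cases (even n) = begin
        conv (n ℕ.* 2) summand
          ≈⟨ conv-even n summand ⟩
        _ ≈⟨ conv-cong n (λ a b _ → +-cong (*-cong (m-even i a) (c-even _ b)) (odds a b)) ⟩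
        _ ≈⟨ eigen-even i n ⟩
        μ (i ℕ.+ n ℕ.* 2) * cE i n
          ≈⟨ *-congˡ (c-even i n) ⟨
        μ (i ℕ.+ n ℕ.* 2) * c i (i ℕ.+ n ℕ.* 2) ∎
      cases (odd n) = begin
        conv (suc (n ℕ.* 2)) summand
          ≈⟨ conv-odd n summand ⟩
        _ ≈⟨ conv-cong n (λ a b _ → +-cong (*-cong (m-even i a) (c-odd _ b)) (*-cong (m-odd i a) (c-even _ b))) ⟩
        _ ≈⟨ eigen-odd i n ⟩
        μ (i ℕ.+ suc (n ℕ.* 2)) * cO i n
          ≈⟨ *-congˡ (c-odd i n) ⟨
        μ (i ℕ.+ suc (n ℕ.* 2)) * c i (i ℕ.+ suc (n ℕ.* 2)) ∎

    upper-product : ∀ {f g : ℕ → ℕ → Carrier} →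
      (∀ {i j} → j ℕ.< i → f i j ≈ 0#) → (∀ {i j} → j ℕ.< i → g i j ≈ 0#) →
      ∀ i N {n} → i ℕ.+ N ℕ.< n →
      sum {n} (λ k → f i (toℕ k) * g (toℕ k) (i ℕ.+ N)) ≈
      sum {suc N} (λ t → f i (i ℕ.+ toℕ t) * g (i ℕ.+ toℕ t) (i ℕ.+ N))
    upper-product {f} {g} f-lower g-lower i N {n} i+N<n =
      sum-range i (suc N) (n ℕ.∸ suc (i ℕ.+ N)) length (λ k → f i k * g k (i ℕ.+ N))
        (λ k k<i → trans (*-congʳ (f-lower k<i)) (zeroˡ _))
        (λ k i+N<k → trans (*-congˡ (g-lower (ℕ.≤-trans (ℕ.≤-reflexive (≡.sym (ℕ.+-suc i N))) i+N<k))) (zeroʳ _))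
      where
      length : i ℕ.+ (suc N ℕ.+ (n ℕ.∸ suc (i ℕ.+ N))) ≡ n
      length = ≡.trans (≡.sym (ℕ.+-assoc i (suc N) _))
        (≡.trans (≡.cong (ℕ._+ (n ℕ.∸ suc (i ℕ.+ N))) (ℕ.+-suc i N)) (ℕ.m+[n∸m]≡n i+N<n))

    lower-product : ∀ {f g : ℕ → ℕ → Carrier} →
      (∀ {i j} → j ℕ.< i → f i j ≈ 0#) → (∀ {i j} → j ℕ.< i → g i j ≈ 0#) →
      ∀ {i j} n → j ℕ.< i → sum {n} (λ k → f i (toℕ k) * g (toℕ k) j) ≈ 0#
    lower-product {f} {g} f-lower g-lower {i} {j} n j<i = sum-zero {n} vanishing
      where
      vanishing : ∀ k → f i (toℕ k) * g (toℕ k) j ≈ 0#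
      vanishing k with toℕ k ℕ.<? i
      ... | yes k<i = trans (*-congʳ (f-lower k<i)) (zeroˡ _)
      ... | no  k≮i = trans (*-congˡ (g-lower (ℕ.<-≤-trans j<i (ℕ.≮⇒≥ k≮i)))) (zeroʳ _)

    mc : ∀ {n} i j → j ℕ.< n → sum {n} (λ k → m i (toℕ k) * c (toℕ k) j) ≈ μ j * c i j
    mc {n} i j j<n with ℕ.<-≤-connex j i
    ... | inj₁ j<i = trans (lower-product m-lower c-lower n j<i)
      (sym (trans (*-congˡ (c-lower j<i)) (zeroʳ _)))
    ... | inj₂ i≤j with ℕ.m≤n⇒∃[o]m+o≡n i≤j
    ...   | N , ≡.refl = begin
      sum {n} (λ k → m i (toℕ k) * c (toℕ k) (i ℕ.+ N))
        ≈⟨ upper-product m-lower c-lower i N j<n ⟩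
      sum {suc N} (λ t → m i (i ℕ.+ toℕ t) * c (i ℕ.+ toℕ t) (i ℕ.+ N))
        ≈⟨ sum-conv N (λ t → m i (i ℕ.+ t) * c (i ℕ.+ t) (i ℕ.+ N)) _ (λ d e d+e≡N →
             *-congˡ (reflexive (≡.cong (c (i ℕ.+ d))
               (≡.trans (≡.cong (i ℕ.+_) (≡.sym d+e≡N)) (≡.sym (ℕ.+-assoc i d e)))))) ⟩
      conv N (λ d e → m i (i ℕ.+ d) * c (i ℕ.+ d) (i ℕ.+ d ℕ.+ e))
        ≈⟨ eigen i N ⟩
      μ (i ℕ.+ N) * c i (i ℕ.+ N) ∎

    recursion : ∀ i d →
      sum {suc d} (λ t → b i (i ℕ.+ toℕ t) * m (i ℕ.+ toℕ t) (i ℕ.+ suc d))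
        + b i (i ℕ.+ suc d) * m (i ℕ.+ suc d) (i ℕ.+ suc d) ≈
      μ i * b i (i ℕ.+ suc d)
    recursion i d = begin
      sum {suc d} (λ t → b i (i ℕ.+ toℕ t) * m (i ℕ.+ toℕ t) j) + b i j * m j j
        ≈⟨ +-cong (sum-cong-≋ {suc d} λ t → *-comm (b i (i ℕ.+ toℕ t)) (m (i ℕ.+ toℕ t) j)) (*-congˡ (diagonalᵐ j)) ⟩
      S + b i j * μ j
        ≈⟨ +-congʳ S≈ ⟩
      μ j * ((g - 1#) * b i j) + b i j * μ j
        ≈⟨ +-congˡ (trans (*-comm _ _) (*-congˡ (sym (*-identityˡ _)))) ⟩
      μ j * ((g - 1#) * b i j) + μ j * (1# * b i j)
        ≈⟨ distribˡ _ _ _ ⟨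
      μ j * ((g - 1#) * b i j + 1# * b i j)
        ≈⟨ *-congˡ (distribʳ _ _ _) ⟨
      μ j * (((g - 1#) + 1#) * b i j)
        ≈⟨ *-congˡ (*-congʳ (-1+1 g)) ⟩
      μ j * (g * b i j)
        ≈⟨ *-assoc _ _ _ ⟨
      μ j * g * b i j
        ≈⟨ *-congʳ (μ-gap i (suc d)) ⟩
      μ i * b i j ∎
      where
      j : ℕ
      j = i ℕ.+ suc d

      g S : Carrier
      g = gap i (suc d)
      S = sum {suc d} (λ t → m (i ℕ.+ toℕ t) j * b i (i ℕ.+ toℕ t))

      S≈ : S ≈ μ j * ((g - 1#) * b i j)
      S≈ = sym (begin
        μ j * ((g - 1#) * b i j)
          ≈⟨ *-congˡ (*-congˡ (b-upper i d)) ⟩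
        μ j * ((g - 1#) * (mono (T j) 0 j 0 * (g - 1#) ⁻¹ * S))
          ≈⟨ solve 5 (λ l g m g′ s → l :* (g :* (m :* g′ :* s)) := (l :* m) :* (g :* g′) :* s)
               refl (μ j) (g - 1#) (mono (T j) 0 j 0) ((g - 1#) ⁻¹) S ⟩
        μ j * mono (T j) 0 j 0 * ((g - 1#) * (g - 1#) ⁻¹) * S
          ≈⟨ *-congʳ (*-cong (μ-inverse j) (*-inverseʳ (PX-1≉0 (i ℕ.* suc d ℕ.+ T (suc d)) d))) ⟩
        1# * 1# * S
          ≈⟨ trans (*-congʳ (*-identityˡ 1#)) (*-identityˡ S) ⟩
        S ∎)

    bm : ∀ {n} i j → j ℕ.< n → sum {n} (λ k → b i (toℕ k) * m (toℕ k) j) ≈ μ i * b i j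
    bm {n} i j j<n with ℕ.<-≤-connex j i
    ... | inj₁ j<i = trans (lower-product b-lower m-lower n j<i)
      (sym (trans (*-congˡ (b-lower j<i)) (zeroʳ _)))
    ... | inj₂ i≤j with ℕ.m≤n⇒∃[o]m+o≡n i≤j
    ...   | N , ≡.refl = trans (upper-product b-lower m-lower i N j<n)
      (trans (sum-last N (λ t → b i (i ℕ.+ t) * m (i ℕ.+ t) (i ℕ.+ N))) (last N))
      where
      last : ∀ N → sum {N} (λ t → b i (i ℕ.+ toℕ t) * m (i ℕ.+ toℕ t) (i ℕ.+ N))
                   + b i (i ℕ.+ N) * m (i ℕ.+ N) (i ℕ.+ N) ≈ μ i * b i (i ℕ.+ N)
      last (suc d) = recursion i d
      last zero rewrite ℕ.+-identityʳ i =
        trans (+-identityˡ _) (trans (*-comm _ _) (*-congʳ (diagonalᵐ i)))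

    unitriangular-b : ∀ n → UpperUnitriangular (matrix b n)
    unitriangular-b n = record { lower = b-lower ; diagonal = λ i → b-diagonal (toℕ i) }

    unitriangular-c : ∀ n → UpperUnitriangular (matrix c n)
    unitriangular-c n = record { lower = c-lower ; diagonal = λ i → diagonalᶜ (toℕ i) }

    distinct : ∀ i j {x} → i ≢ j → μ i * x ≈ μ j * x → x ≈ 0#
    distinct i j {x} i≢j e with ℕ.<-cmp i j
    ... | tri≈ _ i≡j _ = contradiction i≡j i≢j
    ... | tri< i<j _ _ with ℕ.m≤n⇒∃[o]m+o≡n i<j
    ...   | d , ≡.refl = μ-distinct i d (trans e (reflexive (≡.cong (λ j → μ j * x) (≡.sym (ℕ.+-suc i d)))))
    distinct i j {x} i≢j e | tri> _ _ j<i with ℕ.m≤n⇒∃[o]m+o≡n j<i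
    ...   | d , ≡.refl = μ-distinct j d (trans (sym e) (reflexive (≡.cong (λ i → μ i * x) (≡.sym (ℕ.+-suc j d)))))

    inverseʳ : ∀ n i j → (matrix b n ⊠ matrix c n) i j ≈ δ i j
    inverseʳ n = eigenvectors⇒inverseʳ {M = matrix m n} (λ i → μ (toℕ i)) (unitriangular-b n) (unitriangular-c n)
      (λ i j → bm (toℕ i) (toℕ j) (toℕ<n j)) (λ i j → mc (toℕ i) (toℕ j) (toℕ<n j))
      (λ {i} {j} i≢j → distinct (toℕ i) (toℕ j) (i≢j ∘ toℕ-injective))

    inverseˡ : ∀ n i j → (matrix c n ⊠ matrix b n) i j ≈ δ i j
    inverseˡ n = inverseʳ⇒inverseˡ (unitriangular-c n) (inverseʳ n)

open import Defs

-- ℤ[X] as a commutative ring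

coeff-+ : ∀ f g k → coeff (f +ₚ g) k ≡ coeff f k ℤ.+ coeff g k
coeff-+ []      g       k       = ≡.sym (ℤ.+-identityˡ _)
coeff-+ (a ∷ f) []      k       = ≡.sym (ℤ.+-identityʳ _)
coeff-+ (a ∷ f) (b ∷ g) zero    = ≡.refl
coeff-+ (a ∷ f) (b ∷ g) (suc k) = coeff-+ f g k

coeff-· : ∀ a f k → coeff (a ·ₚ f) k ≡ a ℤ.* coeff f k
coeff-· a []      k       = ≡.sym (ℤ.*-zeroʳ a)
coeff-· a (b ∷ f) zero    = ≡.refl
coeff-· a (b ∷ f) (suc k) = coeff-· a f k

-- _≈ₚ_ is a function type, from which Agda cannot infer the two polynomials.
infix 4 _≋_
record _≋_ (f g : Poly) : Set where
  constructor mk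
  field at : f ≈ₚ g
open _≋_

module PolyProperties where

  setoid : Setoid _ _
  setoid = record
    { Carrier = Poly
    ; _≈_     = _≋_
    ; isEquivalence = record
      { refl  = mk λ k → ≡.refl
      ; sym   = λ e → mk λ k → ≡.sym (at e k)
      ; trans = λ e e′ → mk λ k → ≡.trans (at e k) (at e′ k)
      }
    }

  open Setoid setoid public using () renaming (refl to ≋-refl; sym to ≋-sym; trans to ≋-trans)
  open import Relation.Binary.Reasoning.Setoid setoid

  ∷-cong : ∀ {a b f g} → a ≡ b → f ≋ g → a ∷ f ≋ b ∷ g
  ∷-cong e e′ = mk λ { zero → e ; (suc k) → at e′ k }

  0∷[] : 0ℤ ∷ [] ≋ []
  0∷[] = mk λ { zero → ≡.refl ; (suc k) → ≡.refl }

  +-cong : ∀ {f f′ g g′} → f ≋ f′ → g ≋ g′ → f +ₚ g ≋ f′ +ₚ g′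
  +-cong {f} {f′} {g} {g′} e e′ = mk eq
    where
    eq : f +ₚ g ≈ₚ f′ +ₚ g′
    eq k rewrite coeff-+ f g k | coeff-+ f′ g′ k | at e k | at e′ k = ≡.refl

  ·-cong : ∀ a {f g} → f ≋ g → a ·ₚ f ≋ a ·ₚ g
  ·-cong a {f} {g} e = mk eq
    where
    eq : a ·ₚ f ≈ₚ a ·ₚ g
    eq k rewrite coeff-· a f k | coeff-· a g k | at e k = ≡.refl

  +-assoc : ∀ f g h → (f +ₚ g) +ₚ h ≋ f +ₚ (g +ₚ h)
  +-assoc f g h = mk eq
    where
    eq : (f +ₚ g) +ₚ h ≈ₚ f +ₚ (g +ₚ h)
    eq k rewrite coeff-+ (f +ₚ g) h k | coeff-+ f g k
               | coeff-+ f (g +ₚ h) k | coeff-+ g h k = ℤ.+-assoc (coeff f k) _ _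

  +-comm : ∀ f g → f +ₚ g ≋ g +ₚ f
  +-comm f g = mk eq
    where
    eq : f +ₚ g ≈ₚ g +ₚ f
    eq k rewrite coeff-+ f g k | coeff-+ g f k = ℤ.+-comm (coeff f k) _

  +-identityʳ : ∀ f → f +ₚ [] ≋ f
  +-identityʳ f = +-comm f []

  +-inverseʳ : ∀ f → f +ₚ (-1ℤ ·ₚ f) ≋ []
  +-inverseʳ f = mk eq
    where
    eq : f +ₚ (-1ℤ ·ₚ f) ≈ₚ []
    eq k rewrite coeff-+ f (-1ℤ ·ₚ f) k | coeff-· -1ℤ f k
               | ℤ.-1*i≡-i (coeff f k) = ℤ.+-inverseʳ (coeff f k)

  0·f : ∀ f → 0ℤ ·ₚ f ≋ []
  0·f f = mk λ k → ≡.trans (coeff-· 0ℤ f k) (ℤ.*-zeroˡ (coeff f k))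

  1·f : ∀ f → 1ℤ ·ₚ f ≋ f
  1·f f = mk λ k → ≡.trans (coeff-· 1ℤ f k) (ℤ.*-identityˡ _)

  ·-assoc : ∀ a b f → (a ℤ.* b) ·ₚ f ≋ a ·ₚ (b ·ₚ f)
  ·-assoc a b f = mk eq
    where
    eq : (a ℤ.* b) ·ₚ f ≈ₚ a ·ₚ (b ·ₚ f)
    eq k rewrite coeff-· (a ℤ.* b) f k | coeff-· a (b ·ₚ f) k
               | coeff-· b f k = ℤ.*-assoc a b _

  ·-distribˡ : ∀ a f g → a ·ₚ (f +ₚ g) ≋ a ·ₚ f +ₚ a ·ₚ g
  ·-distribˡ a f g = mk eq
    where
    eq : a ·ₚ (f +ₚ g) ≈ₚ a ·ₚ f +ₚ a ·ₚ g
    eq k rewrite coeff-· a (f +ₚ g) k | coeff-+ f g k | coeff-+ (a ·ₚ f) (a ·ₚ g) k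
               | coeff-· a f k | coeff-· a g k = ℤ.*-distribˡ-+ a (coeff f k) _

  ·-distribʳ : ∀ a b f → (a ℤ.+ b) ·ₚ f ≋ a ·ₚ f +ₚ b ·ₚ f
  ·-distribʳ a b f = mk eq
    where
    eq : (a ℤ.+ b) ·ₚ f ≈ₚ a ·ₚ f +ₚ b ·ₚ f
    eq k rewrite coeff-· (a ℤ.+ b) f k | coeff-+ (a ·ₚ f) (b ·ₚ f) k
               | coeff-· a f k | coeff-· b f k = ℤ.*-distribʳ-+ (coeff f k) a b

  +-interchange : ∀ f g h l → (f +ₚ g) +ₚ (h +ₚ l) ≋ (f +ₚ h) +ₚ (g +ₚ l)
  +-interchange f g h l = mk eq
    where
    eq : (f +ₚ g) +ₚ (h +ₚ l) ≈ₚ (f +ₚ h) +ₚ (g +ₚ l)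
    eq k rewrite coeff-+ (f +ₚ g) (h +ₚ l) k | coeff-+ f g k | coeff-+ h l k
               | coeff-+ (f +ₚ h) (g +ₚ l) k | coeff-+ f h k | coeff-+ g l k =
      CommutativeSemigroupProperties.interchange ℤ.+-commutativeSemigroup (coeff f k) _ _ _

  *-zeroʳ : ∀ f → f *ₚ [] ≋ []
  *-zeroʳ []      = ≋-refl
  *-zeroʳ (a ∷ f) = ≋-trans (∷-cong ≡.refl (*-zeroʳ f)) 0∷[]

  *-∷ʳ : ∀ f b g → f *ₚ (b ∷ g) ≋ b ·ₚ f +ₚ (0ℤ ∷ f *ₚ g)
  *-∷ʳ []      b g = ≋-sym 0∷[]
  *-∷ʳ (a ∷ f) b g = ∷-cong (≡.cong (ℤ._+ 0ℤ) (ℤ.*-comm a b)) (begin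
    a ·ₚ g +ₚ f *ₚ (b ∷ g)               ≈⟨ +-cong ≋-refl (*-∷ʳ f b g) ⟩
    a ·ₚ g +ₚ (b ·ₚ f +ₚ (0ℤ ∷ f *ₚ g))  ≈⟨ +-assoc (a ·ₚ g) _ _ ⟨
    (a ·ₚ g +ₚ b ·ₚ f) +ₚ (0ℤ ∷ f *ₚ g)  ≈⟨ +-cong (+-comm (a ·ₚ g) _) ≋-refl ⟩
    (b ·ₚ f +ₚ a ·ₚ g) +ₚ (0ℤ ∷ f *ₚ g)  ≈⟨ +-assoc (b ·ₚ f) _ _ ⟩
    b ·ₚ f +ₚ (a ·ₚ g +ₚ (0ℤ ∷ f *ₚ g))  ∎)

  *-comm : ∀ f g → f *ₚ g ≋ g *ₚ f
  *-comm []      g = ≋-sym (*-zeroʳ g)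
  *-comm (a ∷ f) g = ≋-trans
    (+-cong ≋-refl (∷-cong ≡.refl (*-comm f g))) (≋-sym (*-∷ʳ g a f))

  *-congˡ : ∀ f {g g′} → g ≋ g′ → f *ₚ g ≋ f *ₚ g′
  *-congˡ []      e = ≋-refl
  *-congˡ (a ∷ f) e = +-cong (·-cong a e) (∷-cong ≡.refl (*-congˡ f e))

  *-cong : ∀ {f f′ g g′} → f ≋ f′ → g ≋ g′ → f *ₚ g ≋ f′ *ₚ g′
  *-cong {f} {f′} {g} {g′} e e′ = begin
    f *ₚ g    ≈⟨ *-congˡ f e′ ⟩
    f *ₚ g′   ≈⟨ *-comm f g′ ⟩
    g′ *ₚ f   ≈⟨ *-congˡ g′ e ⟩
    g′ *ₚ f′  ≈⟨ *-comm g′ f′ ⟩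
    f′ *ₚ g′  ∎

  *-distribʳ : ∀ h f g → (f +ₚ g) *ₚ h ≋ f *ₚ h +ₚ g *ₚ h
  *-distribʳ h []      g       = ≋-refl
  *-distribʳ h (a ∷ f) []      = ≋-sym (+-identityʳ ((a ∷ f) *ₚ h))
  *-distribʳ h (a ∷ f) (b ∷ g) = begin
    (a ℤ.+ b) ·ₚ h +ₚ (0ℤ ∷ (f +ₚ g) *ₚ h)
      ≈⟨ +-cong (·-distribʳ a b h) (∷-cong ≡.refl (*-distribʳ h f g)) ⟩
    (a ·ₚ h +ₚ b ·ₚ h) +ₚ ((0ℤ ∷ f *ₚ h) +ₚ (0ℤ ∷ g *ₚ h))
      ≈⟨ +-interchange (a ·ₚ h) _ _ _ ⟩
    (a ∷ f) *ₚ h +ₚ (b ∷ g) *ₚ h ∎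

  ·-*-assoc : ∀ a f g → (a ·ₚ f) *ₚ g ≋ a ·ₚ (f *ₚ g)
  ·-*-assoc a []      g = ≋-refl
  ·-*-assoc a (b ∷ f) g = begin
    (a ℤ.* b) ·ₚ g +ₚ (0ℤ ∷ (a ·ₚ f) *ₚ g)
      ≈⟨ +-cong (·-assoc a b g) (∷-cong (≡.sym (ℤ.*-zeroʳ a)) (·-*-assoc a f g)) ⟩
    a ·ₚ (b ·ₚ g) +ₚ a ·ₚ (0ℤ ∷ f *ₚ g)  ≈⟨ ·-distribˡ a (b ·ₚ g) _ ⟨
    a ·ₚ (b ·ₚ g +ₚ (0ℤ ∷ f *ₚ g))       ∎

  *-assoc : ∀ f g h → (f *ₚ g) *ₚ h ≋ f *ₚ (g *ₚ h)
  *-assoc []      g h = ≋-refl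
  *-assoc (a ∷ f) g h = begin
    (a ·ₚ g +ₚ (0ℤ ∷ f *ₚ g)) *ₚ h         ≈⟨ *-distribʳ h (a ·ₚ g) _ ⟩
    (a ·ₚ g) *ₚ h +ₚ (0ℤ ·ₚ h +ₚ (0ℤ ∷ (f *ₚ g) *ₚ h))
      ≈⟨ +-cong (·-*-assoc a g h) (+-cong (0·f h) (∷-cong ≡.refl (*-assoc f g h))) ⟩
    a ·ₚ (g *ₚ h) +ₚ (0ℤ ∷ f *ₚ (g *ₚ h))  ∎

  *-identityˡ : ∀ f → (1ℤ ∷ []) *ₚ f ≋ f
  *-identityˡ f = begin
    1ℤ ·ₚ f +ₚ (0ℤ ∷ [])  ≈⟨ +-cong (1·f f) 0∷[] ⟩
    f +ₚ []               ≈⟨ +-identityʳ f ⟩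
    f                     ∎

polyRing : CommutativeRing _ _
polyRing = record
  { Carrier = Poly ; _≈_ = _≋_ ; _+_ = _+ₚ_ ; _*_ = _*ₚ_ ; -_ = -1ℤ ·ₚ_
  ; 0# = [] ; 1# = 1ℤ ∷ []
  ; isCommutativeRing = record
    { isRing = record
      { +-isAbelianGroup = record
        { isGroup = record
          { isMonoid = record
            { isSemigroup = record
              { isMagma = record
                { isEquivalence = Setoid.isEquivalence setoid
                ; ∙-cong = +-cong }
              ; assoc = +-assoc }
            ; identity = (λ f → ≋-refl) , +-identityʳ }
          ; inverse = (λ f → ≋-trans (+-comm (-1ℤ ·ₚ f) f) (+-inverseʳ f)) , +-inverseʳ
          ; ⁻¹-cong = ·-cong -1ℤ }
        ; comm = +-comm }
      ; *-cong = *-cong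
      ; *-assoc = *-assoc
      ; *-identity = *-identityˡ , λ f → ≋-trans (*-comm f (1ℤ ∷ [])) (*-identityˡ f)
      ; distrib = (λ f g h → ≋-trans (*-comm f (g +ₚ h)) (≋-trans (*-distribʳ f g h)
          (+-cong (*-comm g f) (*-comm h f)))) , *-distribʳ }
    ; *-comm = *-comm } }
  where open PolyProperties

module ≋ = CommutativeRing polyRing

nonzero⇒≉0 : ∀ {f} → Nonzero f → ¬ f ≋ []
nonzero⇒≉0 (here a≢0) e = a≢0 (at e 0)
nonzero⇒≉0 (there nz) e = nonzero⇒≉0 nz (mk λ k → at e (suc k))

¬nonzero⇒≈0 : ∀ {f} → ¬ Nonzero f → f ≋ []
¬nonzero⇒≈0 nz = mk (vanishes nz)
  where
  vanishes : ∀ {f} → ¬ Nonzero f → f ≈ₚ []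
  vanishes {[]}    nz k       = ≡.refl
  vanishes {a ∷ f} nz zero    = decidable-stable (a ℤ.≟ 0ℤ) (nz ∘ here)
  vanishes {a ∷ f} nz (suc k) = vanishes (nz ∘ there) k

-- ℚ(X) as a field

infix 4 _≃_
-- A wrapper for the same reason as `_≋_`: `_≈_` unfolds to a function type from which x and y
-- cannot be recovered.
record _≃_ (x y : RatFun) : Set where
  constructor mk
  field at : num x *ₚ den y ≋ num y *ₚ den x

≃⇒≈ : ∀ {x y} → x ≃ y → x ≈ y
≃⇒≈ (mk (mk e)) = e

≈⇒≃ : ∀ {x y} → x ≈ y → x ≃ y
≈⇒≃ e = mk (mk e)

module _ where
  open CommutativeRing polyRing using (ring; distribʳ; -‿inverseʳ)
    renaming (sym to ≋-sym; trans to ≋-trans; refl to ≋-refl; +-cong to +ₚ-cong)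
  open RingProperties ring using (-‿distribˡ-*; x∙y⁻¹≈ε⇒x≈y)

  -- If f - g had a nonzero coefficient, so would (f - g) h by `*-nonzero`. Equality in ℤ is
  -- decidable, so the absence of nonzero coefficients does make f - g vanish.
  *ₚ-cancelʳ : ∀ {f g h} → Nonzero h → f *ₚ h ≋ g *ₚ h → f ≋ g
  *ₚ-cancelʳ {f} {g} {h} nh e =
    x∙y⁻¹≈ε⇒x≈y f g (¬nonzero⇒≈0 λ n → nonzero⇒≉0 (*-nonzero n nh) difference≈0)
    where
    difference≈0 : (f +ₚ -1ℤ ·ₚ g) *ₚ h ≋ []
    difference≈0 = ≋-trans (distribʳ h f (-1ℤ ·ₚ g)) (≋-trans
      (+ₚ-cong e (≋-sym (-‿distribˡ-* g h))) (-‿inverseʳ (g *ₚ h)))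

ratFunRing : CommutativeRing _ _
ratFunRing = record
  { Carrier = RatFun ; _≈_ = _≃_ ; _+_ = _+_ ; _*_ = _*_ ; -_ = -_
  ; 0# = 0# ; 1# = 1#
  ; isCommutativeRing = record
    { isRing = record
      { +-isAbelianGroup = record
        { isGroup = record
          { isMonoid = record
            { isSemigroup = record
              { isMagma = record
                { isEquivalence = record
                  { refl = mk ≋.refl ; sym = λ (mk e) → mk (≋.sym e) ; trans = ≃-trans }
                ; ∙-cong = +-cong }
              ; assoc = λ { (a ÷ a′ ⟨ _ ⟩) (b ÷ b′ ⟨ _ ⟩) (c ÷ c′ ⟨ _ ⟩) →
                  mk (+-assoc-lemma a a′ b b′ c c′) } }
            ; identity = +-idˡ , λ x → ≃-trans (+-comm x 0#) (+-idˡ x) }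
          ; inverse = -‿invˡ , λ x → ≃-trans (+-comm x (- x)) (-‿invˡ x)
          ; ⁻¹-cong = -‿cong }
        ; comm = +-comm }
      ; *-cong = *-cong
      ; *-assoc = λ { (a ÷ a′ ⟨ _ ⟩) (b ÷ b′ ⟨ _ ⟩) (c ÷ c′ ⟨ _ ⟩) →
          mk (*-assoc-lemma a a′ b b′ c c′) }
      ; *-identity = *-idˡ , λ x → ≃-trans (*-comm x 1#) (*-idˡ x)
      ; distrib = distribˡ , λ x y z → ≃-trans (*-comm (y + z) x) (≃-trans (distribˡ x y z)
          (+-cong (*-comm x y) (*-comm x z))) }
    ; *-comm = *-comm } }
  where
  open CrossMultiplication polyRing

  ≃-trans : ∀ {x y z} → x ≃ y → y ≃ z → x ≃ z
  ≃-trans {a ÷ a′ ⟨ _ ⟩} {b ÷ b′ ⟨ n ⟩} {c ÷ c′ ⟨ _ ⟩} (mk e) (mk e′) =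
    mk (*ₚ-cancelʳ n (trans-lemma a a′ b b′ c c′ e e′))

  +-cong : ∀ {x x′ y y′} → x ≃ x′ → y ≃ y′ → x + y ≃ x′ + y′
  +-cong {a ÷ a′ ⟨ _ ⟩} {b ÷ b′ ⟨ _ ⟩} {c ÷ c′ ⟨ _ ⟩} {d ÷ d′ ⟨ _ ⟩} (mk e) (mk e′) =
    mk (+-lemma a a′ b b′ c c′ d d′ e e′)

  *-cong : ∀ {x x′ y y′} → x ≃ x′ → y ≃ y′ → x * y ≃ x′ * y′
  *-cong {a ÷ a′ ⟨ _ ⟩} {b ÷ b′ ⟨ _ ⟩} {c ÷ c′ ⟨ _ ⟩} {d ÷ d′ ⟨ _ ⟩} (mk e) (mk e′) =
    mk (*-lemma a a′ b b′ c c′ d d′ e e′)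

  -‿cong : ∀ {x y} → x ≃ y → - x ≃ - y
  -‿cong {a ÷ a′ ⟨ _ ⟩} {b ÷ b′ ⟨ _ ⟩} (mk e) = mk (-‿lemma a a′ b b′ e)

  +-comm : ∀ x y → x + y ≃ y + x
  +-comm (a ÷ a′ ⟨ _ ⟩) (b ÷ b′ ⟨ _ ⟩) = mk (+-comm-lemma a a′ b b′)

  *-comm : ∀ x y → x * y ≃ y * x
  *-comm (a ÷ a′ ⟨ _ ⟩) (b ÷ b′ ⟨ _ ⟩) = mk (≋.*-cong (≋.*-comm a b) (≋.*-comm b′ a′))

  +-idˡ : ∀ x → 0# + x ≃ x
  -- The numerator of `0#` is the list `0ℤ ∷ []`, whereas the zero of `polyRing` is `[]`; `0∷[]`
  -- mediates.
  +-idˡ (a ÷ a′ ⟨ _ ⟩) = mk (≋.trans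
    (≋.*-congʳ {a′} (≋.+-congʳ {a *ₚ (1ℤ ∷ [])} (≋.*-congʳ {a′} PolyProperties.0∷[]))) (+-identityˡ-lemma a a′))

  *-idˡ : ∀ x → 1# * x ≃ x
  *-idˡ (a ÷ a′ ⟨ _ ⟩) = mk (*-identityˡ-lemma a a′)

  -‿invˡ : ∀ x → - x + x ≃ 0#
  -‿invˡ (a ÷ a′ ⟨ _ ⟩) = mk (≋.trans (-‿inverseˡ-lemma a a′)
    (≋.*-congʳ {a′ *ₚ a′} (≋.sym PolyProperties.0∷[])))

  distribˡ : ∀ x y z → x * (y + z) ≃ x * y + x * z
  distribˡ (a ÷ a′ ⟨ _ ⟩) (b ÷ b′ ⟨ _ ⟩) (c ÷ c′ ⟨ _ ⟩) = mk (distribˡ-lemma a a′ b b′ c c′)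

1≄0 : ¬ 1# ≃ 0#
1≄0 (mk (mk e)) with () ← e 0

*-inverseʳ : ∀ {x} → ¬ x ≃ 0# → x * x ⁻¹ ≃ 1#
*-inverseʳ {f ÷ f′ ⟨ _ ⟩} x≄0 with Any.any? (λ a → ¬? (a ℤ.≟ 0ℤ)) f
... | yes _  = mk (CrossMultiplication.*-inverse-lemma polyRing f f′)
... | no  ¬n = contradiction
  (mk (≋.trans (≋.*-identityʳ f) (≋.trans (¬nonzero⇒≈0 {f} ¬n)
    (≋.sym (≋.trans (≋.*-congʳ {f′} PolyProperties.0∷[]) (≋.zeroˡ f′))))))
  x≄0

module ≃ = CommutativeRing ratFunRing
open SemiringExp ≃.semiring using () renaming (_^_ to _^′_)

isField : IsField ratFunRing _⁻¹
isField = record { 1≉0 = 1≄0 ; *-inverseʳ = *-inverseʳ }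

-- The two powers are taken over raw semirings with different equality relations, so they agree only
-- by induction on the exponent.
^≡^′ : ∀ x k → x ^ k ≡ x ^′ k
^≡^′ x zero    = ≡.refl
^≡^′ x (suc k) = ≡.cong (x *_) (^≡^′ x k)

-- Independence of p and X

coeff-*-0 : ∀ f g → coeff (f *ₚ g) 0 ≡ coeff f 0 ℤ.* coeff g 0
coeff-*-0 []      g = ≡.sym (ℤ.*-zeroˡ (coeff g 0))
coeff-*-0 (a ∷ f) g = ≡.trans (coeff-+ (a ·ₚ g) _ 0)
  (≡.trans (ℤ.+-identityʳ _) (coeff-· a g 0))

embed : Poly → RatFun
embed f = f ÷ (1ℤ ∷ []) ⟨ here (λ ()) ⟩

embed-* : ∀ f g → embed f * embed g ≃ embed (f *ₚ g)
embed-* f g = mk ≋.refl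

-- Evaluation at X = 0. It refutes p^k = 1 for k > 0 inside ℤ, and p^k X^l = 1 for l > 0 because the
-- constant coefficient is then 0.
constant-coefficient : ∀ {x f} → x ≃ embed f → x ≃ 1# → coeff f 0 ≡ 1ℤ
constant-coefficient {x} {f} x≃f x≃1 with ≃.trans (≃.sym x≃f) x≃1
... | mk (mk e) = ≡.trans (≡.sym (ℤ.*-identityʳ (coeff f 0)))
  (≡.trans (≡.sym (coeff-*-0 f (1ℤ ∷ []))) (e 0))

fromℤ-^ : ∀ p k → fromℤ (+ p) ^′ k ≃ fromℤ (+ (p ℕ.^ k))
fromℤ-^ p zero    = ≃.refl
fromℤ-^ p (suc k) = ≃.trans (≃.*-congˡ (fromℤ-^ p k)) (≃.trans (embed-* (+ p ∷ []) (+ (p ℕ.^ k) ∷ [])) (≃.reflexive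
  (≡.cong fromℤ (≡.trans (ℤ.+-identityʳ _) (≡.sym (ℤ.pos-* p (p ℕ.^ k)))))))

X^-polynomial : ∀ k → ∃ λ f → X ^′ k ≃ embed f
X^-polynomial zero    = 1ℤ ∷ [] , ≃.refl
X^-polynomial (suc k) with X^-polynomial k
... | f , e = _ , ≃.trans (≃.*-congˡ e) (embed-* (0ℤ ∷ 1ℤ ∷ []) f)

independent : ∀ {p} → 1 ℕ.< p → Independent ratFunRing (fromℤ (+ p)) X
independent {p} 1<p = record
  { P≉0  = λ { (mk (mk e)) → p≢0 (ℤ.+-injective (≡.trans (≡.sym (≡.trans (ℤ.+-identityʳ _) (ℤ.*-identityʳ (+ p)))) (e 0))) }
  -- Compared in degree 1, since X and 0 share the constant coefficient 0.
  ; X≉0  = λ { (mk (mk e)) → contradiction (e 1) λ () }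
  ; P^≉1 = λ k e → p^≢1 k (ℤ.+-injective (constant-coefficient (fromℤ-^ p (suc k)) e))
  ; PX≉1 = PX≉1
  }
  where
  p≢0 : p ≢ 0
  p≢0 ≡.refl = contradiction 1<p λ ()

  p^≢1 : ∀ k → p ℕ.^ suc k ≢ 1
  p^≢1 k e with ℕ.m^n≡1⇒n≡0∨m≡1 p (suc k) e
  ... | inj₂ ≡.refl = contradiction 1<p λ { (s≤s ()) }

  PX≉1 : ∀ k l → ¬ fromℤ (+ p) ^′ k * X ^′ suc l ≃ 1#
  PX≉1 k l e with X^-polynomial l
  ... | f , X^l≃f = contradiction (≡.trans (≡.sym coefficient≡0) (constant-coefficient polynomial e)) λ ()
    where
    g : Poly
    g = (+ (p ℕ.^ k) ∷ []) *ₚ ((0ℤ ∷ 1ℤ ∷ []) *ₚ f)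

    polynomial : fromℤ (+ p) ^′ k * X ^′ suc l ≃ embed g
    polynomial = ≃.trans
      (≃.*-cong (fromℤ-^ p k) (≃.trans (≃.*-congˡ X^l≃f) (embed-* (0ℤ ∷ 1ℤ ∷ []) f)))
      (embed-* (+ (p ℕ.^ k) ∷ []) ((0ℤ ∷ 1ℤ ∷ []) *ₚ f))

    coefficient≡0 : coeff g 0 ≡ 0ℤ
    coefficient≡0 = ≡.trans (coeff-*-0 (+ (p ℕ.^ k) ∷ []) ((0ℤ ∷ 1ℤ ∷ []) *ₚ f))
      (≡.trans (≡.cong (+ (p ℕ.^ k) ℤ.*_) (≡.trans (coeff-*-0 (0ℤ ∷ 1ℤ ∷ []) f) (ℤ.*-zeroˡ (coeff f 0))))
        (ℤ.*-zeroʳ (+ (p ℕ.^ k))))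

-- Evaluation of the formulas in ℚ(X)

module Evaluation (p : ℕ) (1<p : 1 ℕ.< p) where

  open AtPrime p
  open FieldProperties ratFunRing _⁻¹ isField
  open Convolution ratFunRing using (shift; conv-cong; conv-0)
  module V = Eigenvectors ratFunRing _⁻¹ isField (fromℤ (+ p)) X (fromℤ (legendre -1ℤ)) (independent 1<p)
  open V using (mono; L; U; D; F; G; E; q; cancel-powers; L≉0; U≉0; q≉1; PX-1≉0;
    mᵨ; cᵨ; m₀; c₀; m₁; c₁)
  open Diagonalization ratFunRing _⁻¹ isField (fromℤ (+ p)) X (fromℤ (legendre -1ℤ)) (independent 1<p)
  open import Relation.Binary.Reasoning.Setoid ≃.setoid

  P : RatFun
  P = fromℤ (+ p)

  open Independent (independent 1<p)

  ^ᶻ-neg : ∀ f k → f ^ᶻ (ℤ.- + k) ≡ (f ⁻¹) ^ k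
  ^ᶻ-neg f zero    = ≡.refl
  ^ᶻ-neg f (suc k) = ≡.refl

  ^ᶻ-minus : ∀ {f} → ¬ f ≃ 0# → ∀ u v → f ^ᶻ (+ u ℤ.- + v) ≃ f ^′ u * (f ⁻¹) ^′ v
  ^ᶻ-minus {f} f≉0 u v rewrite ℤ.m-n≡m⊖n u v with v ℕ.≤? u
  ... | yes v≤u rewrite ℤ.⊖-≥ v≤u | ^≡^′ f (u ℕ.∸ v) = ≃.trans (≃.sym (≃.*-identityʳ _))
    (cancel-powers (*-inverseʳ f≉0) (u ℕ.∸ v) 0 u v (≡.trans (ℕ.m∸n+n≡m v≤u) (≡.sym (ℕ.+-identityʳ u))))
  ... | no  v≰u rewrite ℤ.⊖-< (ℕ.≰⇒> v≰u) | ^ᶻ-neg f (v ℕ.∸ u) | ^≡^′ (f ⁻¹) (v ℕ.∸ u) =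
    ≃.trans (≃.sym (≃.*-identityˡ _))
      (cancel-powers (*-inverseʳ f≉0) 0 (v ℕ.∸ u) u v (≡.sym (ℕ.m+[n∸m]≡n (ℕ.<⇒≤ (ℕ.≰⇒> v≰u)))))

  ratio-mono : ∀ u v i → p^[ + u ℤ.- + v ⊕ + i s] ≃ mono u v 0 i
  ratio-mono u v i = ≃.*-cong (^ᶻ-minus P≉0 u v)
    (≃.trans (≃.reflexive (≡.trans (^ᶻ-neg X i) (^≡^′ (X ⁻¹) i))) (≃.sym (≃.*-identityˡ _)))

  power-mono : ∀ u d → p^[ + u ⊕ ℤ.- + d s] ≃ mono u 0 d 0
  power-mono u d = ≃.*-cong
    (≃.trans (≃.reflexive (^≡^′ P u)) (≃.sym (≃.*-identityʳ _)))
    (≃.trans (≃.reflexive (≡.trans (≡.cong (X ^ᶻ_) (ℤ.neg-involutive (+ d))) (^≡^′ X d)))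
      (≃.sym (≃.*-identityʳ _)))

  minus-cong : ∀ {x y x′ y′} → x ≃ x′ → y ≃ y′ → x - y ≃ x′ - y′
  minus-cong e e′ = ≃.+-cong e (≃.-‿cong e′)

  -- An explicit I with M′ I = 1 shows that the denominator is nonzero, so that the convention 0 ⁻¹
  -- = 0 is not met, and evaluates its inverse at the same time.
  quotient : ∀ {N N′ M M′ I} → N ≃ N′ → M ≃ M′ → M′ * I ≃ 1# → N / M ≃ N′ * I
  quotient e e′ e″ = ≃.*-cong e (⁻¹-unique (≃.trans (≃.*-congʳ e′) e″))

  ∏-from-1 : ∀ n h → ∏[ 1 ⋯ n ] h ≃ Π n (h ∘ suc)
  ∏-from-1 n h = product-Π n (h ∘ suc)

  ∏-D : ∀ i d → ∏[ suc i ⋯ i ℕ.+ d ] (λ r → p^ r - 1#) ≃ D i d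
  ∏-D i d = ≃.trans (product-Π (i ℕ.+ d ℕ.∸ i) (λ t → p^ (suc i ℕ.+ t) - 1#))
    (≃.trans (≃.reflexive (≡.cong (λ n → Π n (λ t → p^ (suc i ℕ.+ t) - 1#)) (ℕ.m+n∸m≡n i d)))
      (Π-cong d λ t → minus-cong (power-mono (suc (i ℕ.+ t)) 0) ≃.refl))

  p^2k : ∀ r → p^ (2 ℕ.* suc r) - 1# ≃ q (suc r) - 1#
  p^2k r = minus-cong (≃.trans (power-mono (2 ℕ.* suc r) 0)
    (≃.reflexive (≡.cong (λ k → mono k 0 0 0) (ℕ.*-comm 2 (suc r))))) ≃.refl

  ∏-E : ∀ a → ∏[ 1 ⋯ a ] (λ r → p^ (2 ℕ.* r) - 1#) ≃ Π a (λ r → q (suc r) - 1#)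
  ∏-E a = ≃.trans (∏-from-1 a (λ r → p^ (2 ℕ.* r) - 1#)) (Π-cong a p^2k)

  ∏-E-inverseʳ : ∀ a → Π a (λ r → q (suc r) - 1#) * E a ≃ 1#
  ∏-E-inverseʳ a = Π-inverseʳ a {λ r → q (suc r) - 1#} q≉1

  mono-cong : ∀ {u u′} v w z → u ≡ u′ → mono u v w z ≃ mono u′ v w z
  mono-cong v w z ≡.refl = ≃.refl

  half : ∀ a → a ℕ.* 2 ℕ./ 2 ≡ a
  half a = ℕ.m*n/n≡m a 2

  quarter : ∀ {m} n → m ≡ n ℕ.* 4 → m ℕ./ 4 ≡ n
  quarter n ≡.refl = ℕ.m*n/n≡m n 4

  product-even : ∀ a → a ℕ.* 2 ℕ.* (a ℕ.* 2 ℕ.+ 2) ≡ a ℕ.* (a ℕ.+ 1) ℕ.* 4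
  product-even = solve-∀

  square-odd : ∀ a → suc (a ℕ.* 2) ℕ.* suc (a ℕ.* 2) ≡ suc (a ℕ.* (a ℕ.+ 1) ℕ.* 4)
  square-odd = solve-∀

  square-even : ∀ a → a ℕ.* 2 ℕ.* (a ℕ.* 2) ≡ a ℕ.* a ℕ.* 4
  square-even = solve-∀

  odd%2 : ∀ a → suc (a ℕ.* 2) ℕ.% 2 ≡ 1
  odd%2 a = ℕ.[m+kn]%n≡m%n 1 a 2

  even%2 : ∀ a → a ℕ.* 2 ℕ.% 2 ≡ 0
  even%2 a = ℕ.m*n%n≡0 a 2

  -- Entries of M

  m-numerator : ℕ → ℕ → ℕ → RatFun
  m-numerator e i j = p^[ + e ℤ.- + (j ℕ.* (j ℕ.+ 1) ℕ./ 2) ⊕ + i s] * ∏[ suc i ⋯ j ] (λ r → p^ r - 1#)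

  m-denominator : ℕ → RatFun
  m-denominator a = ∏[ 1 ⋯ a ] (λ r → p^ (2 ℕ.* r) - 1#)

  m-value : ∀ {e e′ a a′} i d → e ≡ e′ → a ≡ a′ →
    m-numerator e i (i ℕ.+ d) / m-denominator a ≃ mono e′ (T (i ℕ.+ d)) 0 i * D i d * E a′
  m-value {e} {a = a} i d ≡.refl ≡.refl =
    quotient (≃.*-cong (ratio-mono e (T (i ℕ.+ d)) i) (∏-D i d)) (∏-E a) (∏-E-inverseʳ a)

  module _ (i : ℕ) where

    -- The distance d is a separate argument, so that all occurrences of `j ∸ i` can be rewritten by
    -- a single `cong`.
    m₀-formula m₁-formula mᵨ-formula : ℕ → ℕ → RatFun
    m₀-formula j d = m-numerator (d ℕ.* (d ℕ.+ 2) ℕ./ 4) i j / m-denominator (d ℕ./ 2)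
    m₁-formula j d = m-numerator ((d ℕ.* d ℕ.∸ 1) ℕ./ 4) i j / m-denominator ((d ℕ.∸ 1) ℕ./ 2)
    mᵨ-formula j d = (fromℤ (legendre -1ℤ) ^ (d ℕ./ 2)
      * p^[ + (d ℕ.* d ℕ./ 4) ℤ.- + (j ℕ.* (j ℕ.+ 1) ℕ./ 2) ⊕ + i s]
      * ∏[ suc i ⋯ j ] (λ k → p^ k - 1#)) / m-denominator (d ℕ./ 2)

    m₀-unfold : ∀ j → i ℕ.≤ j → (j ℕ.∸ i) ℕ.% 2 ≡ 0 → m χ₀ i j ≡ m₀-formula j (j ℕ.∸ i)
    m₀-unfold j i≤j e with i ℕ.≤? j | (j ℕ.∸ i) ℕ.% 2
    ... | yes _  | zero = ≡.refl
    ... | no i≰j | _    = contradiction i≤j i≰j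

    m₁-unfold : ∀ j → i ℕ.≤ j → (j ℕ.∸ i) ℕ.% 2 ≡ 1 → m χ₀ i j ≡ m₁-formula j (j ℕ.∸ i)
    m₁-unfold j i≤j e with i ℕ.≤? j | (j ℕ.∸ i) ℕ.% 2
    ... | yes _  | suc _ = ≡.refl
    ... | no i≰j | _     = contradiction i≤j i≰j

    mᵨ-unfold : ∀ j → i ℕ.≤ j → (j ℕ.∸ i) ℕ.% 2 ≡ 0 → m χₚ i j ≡ mᵨ-formula j (j ℕ.∸ i)
    mᵨ-unfold j i≤j e with i ℕ.≤? j | (j ℕ.∸ i) ℕ.% 2
    ... | yes _  | zero = ≡.refl
    ... | no i≰j | _    = contradiction i≤j i≰j

    mᵨ-unfold-odd : ∀ j → (j ℕ.∸ i) ℕ.% 2 ≡ 1 → m χₚ i j ≡ 0#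
    mᵨ-unfold-odd j e with i ℕ.≤? j | (j ℕ.∸ i) ℕ.% 2
    ... | yes _ | suc _ = ≡.refl
    ... | no _  | _     = ≡.refl

    m-lower : ∀ ψ {j} → j ℕ.< i → m ψ i j ≡ 0#
    m-lower ψ {j} j<i with i ℕ.≤? j
    ... | yes i≤j = contradiction j<i (ℕ.≤⇒≯ i≤j)
    ... | no _    = ≡.refl

    difference%2 : ∀ {d r} → d ℕ.% 2 ≡ r → (i ℕ.+ d ℕ.∸ i) ℕ.% 2 ≡ r
    difference%2 {d} e = ≡.trans (≡.cong (ℕ._% 2) (ℕ.m+n∸m≡n i d)) e

    m₀-entry : ∀ a → m χ₀ i (i ℕ.+ a ℕ.* 2) ≃ m₀ i a
    m₀-entry a = ≃.trans
      (≃.reflexive (≡.trans (m₀-unfold _ (ℕ.m≤m+n i _) (difference%2 (even%2 a)))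
        (≡.cong (m₀-formula _) (ℕ.m+n∸m≡n i (a ℕ.* 2)))))
      (m-value i (a ℕ.* 2) (quarter (a ℕ.* (a ℕ.+ 1)) (product-even a)) (half a))

    m₁-entry : ∀ a → m χ₀ i (i ℕ.+ suc (a ℕ.* 2)) ≃ m₁ i a
    m₁-entry a = ≃.trans
      (≃.reflexive (≡.trans (m₁-unfold _ (ℕ.m≤m+n i _) (difference%2 (odd%2 a)))
        (≡.cong (m₁-formula _) (ℕ.m+n∸m≡n i (suc (a ℕ.* 2))))))
      (m-value i (suc (a ℕ.* 2)) (quarter (a ℕ.* (a ℕ.+ 1)) (≡.cong (ℕ._∸ 1) (square-odd a))) (half a))

    mᵨ-entry : ∀ a → m χₚ i (i ℕ.+ a ℕ.* 2) ≃ mᵨ i a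
    mᵨ-entry a = ≃.trans
      (≃.reflexive (≡.trans (mᵨ-unfold _ (ℕ.m≤m+n i _) (difference%2 (even%2 a)))
        (≡.cong (mᵨ-formula _) (ℕ.m+n∸m≡n i (a ℕ.* 2)))))
      (quotient
        (≃.*-cong
          (≃.*-cong (≃.reflexive (≡.trans (≡.cong (fromℤ (legendre -1ℤ) ^_) (half a)) (^≡^′ _ a)))
            (≃.trans (ratio-mono (a ℕ.* 2 ℕ.* (a ℕ.* 2) ℕ./ 4) (T (i ℕ.+ a ℕ.* 2)) i)
              (mono-cong (T (i ℕ.+ a ℕ.* 2)) 0 i (quarter (a ℕ.* a) (square-even a)))))
          (∏-D i (a ℕ.* 2)))
        (≃.trans (≃.reflexive (≡.cong m-denominator (half a))) (∏-E a))
        (∏-E-inverseʳ a))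

    mᵨ-odd-entry : ∀ a → m χₚ i (i ℕ.+ suc (a ℕ.* 2)) ≃ 0#
    mᵨ-odd-entry a = ≃.reflexive (mᵨ-unfold-odd _ (difference%2 (odd%2 a)))

  -- Entries of the closed formula

  L-entry : ∀ j → 1# - p^[ + j ⊕ -1ℤ s] ≃ L j
  L-entry j = minus-cong ≃.refl (power-mono j 1)

  c-denominator : (ℕ → ℤ) → ℕ → RatFun
  c-denominator z a = ∏[ 1 ⋯ a ] (λ k → (1# - p^[ z k ⊕ ℤ.- + 2 s]) * (p^ (2 ℕ.* k) - 1#))

  ∏-FE : ∀ s a (z : ℕ → ℤ) → (∀ r → z (suc r) ≡ + (s ℕ.+ r ℕ.* 2)) →
         c-denominator z a ≃ F s a * Π a (λ r → q (suc r) - 1#)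
  ∏-FE s a z e = ≃.trans
    (∏-from-1 a (λ k → (1# - p^[ z k ⊕ ℤ.- + 2 s]) * (p^ (2 ℕ.* k) - 1#))) (≃.trans
    (Π-cong a λ r → ≃.*-cong
      (minus-cong ≃.refl (≃.trans (≃.reflexive (≡.cong (λ z → p^[ z ⊕ ℤ.- + 2 s]) (e r)))
        (power-mono (s ℕ.+ r ℕ.* 2) 2)))
      (p^2k r))
    (Π-* a (λ r → U (s ℕ.+ r ℕ.* 2)) (λ r → q (suc r) - 1#)))

  ∏-FE-inverseʳ : ∀ s a → (F s a * Π a (λ r → q (suc r) - 1#)) * (G s a * E a) ≃ 1#
  ∏-FE-inverseʳ s a = *-unit (Π-inverseʳ a {λ r → U (s ℕ.+ r ℕ.* 2)} λ r → U≉0 (s ℕ.+ r ℕ.* 2)) (∏-E-inverseʳ a)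

  L-∏-FE-inverseʳ : ∀ j s a → (L j * (F s a * Π a (λ r → q (suc r) - 1#))) * (L j ⁻¹ * G s a * E a) ≃ 1#
  L-∏-FE-inverseʳ j s a = ≃.trans (≃.*-congˡ {L j * _} (≃.*-assoc (L j ⁻¹) (G s a) (E a)))
    (*-unit (*-inverseʳ (L≉0 j)) (∏-FE-inverseʳ s a))

  module _ (i : ℕ) where

    c₀-formula c₁-formula cᵨ-formula : ℕ → ℕ → RatFun
    c₀-formula j d =
      (p^[ + (d ℕ.* (d ℕ.+ 2) ℕ./ 4) ⊕ ℤ.- + d s] * (1# - p^[ + i ⊕ -1ℤ s]) * ∏[ suc i ⋯ j ] (λ k → p^ k - 1#))
      / ((1# - p^[ + j ⊕ -1ℤ s]) * c-denominator (λ k → + (i ℕ.+ j ℕ.+ 2 ℕ.* k) ℤ.- 1ℤ) (d ℕ./ 2))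
    c₁-formula j d =
      (p^[ + ((d ℕ.* d ℕ.∸ 1) ℕ./ 4) ⊕ ℤ.- + d s] * ∏[ suc i ⋯ j ] (λ k → p^ k - 1#))
      / ((1# - p^[ + j ⊕ -1ℤ s]) * c-denominator (λ k → + (i ℕ.+ j ℕ.+ 2 ℕ.* k)) ((d ℕ.∸ 1) ℕ./ 2))
    cᵨ-formula j d =
      (fromℤ (legendre -1ℤ) ^ (d ℕ./ 2) * p^[ + (d ℕ./ 2 ℕ.* (d ℕ./ 2)) ⊕ ℤ.- + d s]
        * ∏[ suc i ⋯ j ] (λ k → p^ k - 1#))
      / c-denominator (λ k → + (i ℕ.+ j ℕ.+ 2 ℕ.* k) ℤ.- 1ℤ) (d ℕ./ 2)

    -- The product starts at k = r + 1 with r = 0, so 2k - 1 = 2r + 1 absorbs the integer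
    -- subtraction and the first exponent is i + j + 1.
    even-exponent : ∀ a r → + (i ℕ.+ (i ℕ.+ a ℕ.* 2) ℕ.+ 2 ℕ.* suc r) ℤ.- 1ℤ ≡
                    + (i ℕ.* 2 ℕ.+ a ℕ.* 2 ℕ.+ 1 ℕ.+ r ℕ.* 2)
    even-exponent a r = ≡.cong (λ n → + n ℤ.- 1ℤ) (lemma i a r)
      where
      lemma : ∀ i a r → i ℕ.+ (i ℕ.+ a ℕ.* 2) ℕ.+ 2 ℕ.* suc r ≡ suc (i ℕ.* 2 ℕ.+ a ℕ.* 2 ℕ.+ 1 ℕ.+ r ℕ.* 2)
      lemma = solve-∀

    odd-exponent : ∀ a r → + (i ℕ.+ (i ℕ.+ suc (a ℕ.* 2)) ℕ.+ 2 ℕ.* suc r) ≡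
                   + (i ℕ.* 2 ℕ.+ a ℕ.* 2 ℕ.+ 3 ℕ.+ r ℕ.* 2)
    odd-exponent a r = ≡.cong +_ (lemma i a r)
      where
      lemma : ∀ i a r → i ℕ.+ (i ℕ.+ suc (a ℕ.* 2)) ℕ.+ 2 ℕ.* suc r ≡ i ℕ.* 2 ℕ.+ a ℕ.* 2 ℕ.+ 3 ℕ.+ r ℕ.* 2
      lemma = solve-∀

    power-value : ∀ {u u′} d → u ≡ u′ → p^[ + u ⊕ ℤ.- + d s] ≃ mono u′ 0 d 0
    power-value {u} d ≡.refl = power-mono u d

    denominator-value : ∀ {a a′} s z → a ≡ a′ → (∀ r → z (suc r) ≡ + (s ℕ.+ r ℕ.* 2)) →
                        c-denominator z a ≃ F s a′ * Π a′ (λ r → q (suc r) - 1#)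
    denominator-value {a} s z ≡.refl = ∏-FE s a z

    c₀-value : ∀ a → c₀-formula (i ℕ.+ a ℕ.* 2) (a ℕ.* 2) ≃ c₀ i a
    c₀-value a = quotient
      (≃.*-cong (≃.*-cong (power-value (a ℕ.* 2) (quarter (a ℕ.* (a ℕ.+ 1)) (product-even a))) (L-entry i))
        (∏-D i (a ℕ.* 2)))
      (≃.*-cong (L-entry j) (denominator-value s (λ k → + (i ℕ.+ j ℕ.+ 2 ℕ.* k) ℤ.- 1ℤ) (half a) (even-exponent a)))
      (L-∏-FE-inverseʳ j s a)
      where
      j s : ℕ
      j = i ℕ.+ a ℕ.* 2
      s = i ℕ.* 2 ℕ.+ a ℕ.* 2 ℕ.+ 1

    c₁-value : ∀ a → c₁-formula (i ℕ.+ suc (a ℕ.* 2)) (suc (a ℕ.* 2)) ≃ c₁ i a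
    c₁-value a = quotient
      (≃.*-cong (power-value (suc (a ℕ.* 2)) (quarter (a ℕ.* (a ℕ.+ 1)) (≡.cong (ℕ._∸ 1) (square-odd a))))
        (∏-D i (suc (a ℕ.* 2))))
      (≃.*-cong (L-entry j) (denominator-value s (λ k → + (i ℕ.+ j ℕ.+ 2 ℕ.* k)) (half a) (odd-exponent a)))
      (L-∏-FE-inverseʳ j s a)
      where
      j s : ℕ
      j = i ℕ.+ suc (a ℕ.* 2)
      s = i ℕ.* 2 ℕ.+ a ℕ.* 2 ℕ.+ 3

    cᵨ-value : ∀ a → cᵨ-formula (i ℕ.+ a ℕ.* 2) (a ℕ.* 2) ≃ cᵨ i a
    cᵨ-value a = quotient
      (≃.*-cong
        (≃.*-cong (≃.reflexive (≡.trans (≡.cong (fromℤ (legendre -1ℤ) ^_) (half a)) (^≡^′ _ a)))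
          (power-value (a ℕ.* 2) (≡.cong₂ ℕ._*_ (half a) (half a))))
        (∏-D i (a ℕ.* 2)))
      (denominator-value s (λ k → + (i ℕ.+ j ℕ.+ 2 ℕ.* k) ℤ.- 1ℤ) (half a) (even-exponent a))
      (∏-FE-inverseʳ s a)
      where
      j s : ℕ
      j = i ℕ.+ a ℕ.* 2
      s = i ℕ.* 2 ℕ.+ a ℕ.* 2 ℕ.+ 1

  -- The recursion for B and the systems of the two characters

  b-recursion : ∀ ψ i d → b ψ i (i ℕ.+ suc d) ≃
    mono (T (i ℕ.+ suc d)) 0 (i ℕ.+ suc d) 0 * (gap i (suc d) - 1#) ⁻¹
    * sum {suc d} (λ t → m ψ (i ℕ.+ toℕ t) (i ℕ.+ suc d) * b ψ i (i ℕ.+ toℕ t))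
  b-recursion ψ i d = ≃.trans
    (≃.reflexive (b-upper ψ (ℕ.m<m+n i (s≤s z≤n))))
    (≃.*-cong
      -- `PX-1≉0` gives nonvanishing for the monomial form of the denominator, so the congruence
      -- starts from that form and is then reversed.
      (≃.*-cong (power-mono (T j) j) (≃.sym (⁻¹-cong (PX-1≉0 (i ℕ.* suc d ℕ.+ T (suc d)) d) (≃.sym gap-value))))
      (≃.reflexive (≡.cong (λ n → sum {n} (λ t → m ψ (i ℕ.+ toℕ t) j * b ψ i (i ℕ.+ toℕ t))) length)))
    where
    j : ℕ
    j = i ℕ.+ suc d

    length : suc (j ℕ.∸ 1) ℕ.∸ i ≡ suc d
    length rewrite ℕ.+-suc i d = ≡.trans (≡.cong (ℕ._∸ i) (≡.sym (ℕ.+-suc i d))) (ℕ.m+n∸m≡n i (suc d))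

    gap-exponent : ∀ d → d ℕ.* (i ℕ.+ d ℕ.+ i ℕ.+ 1) ℕ./ 2 ≡ i ℕ.* d ℕ.+ T d
    gap-exponent d = ≡.trans (≡.cong (ℕ._/ 2) (≡.trans (expand i d)
        (≡.trans (≡.cong (i ℕ.* d ℕ.* 2 ℕ.+_) (T-double d)) (≡.sym (ℕ.*-distribʳ-+ 2 (i ℕ.* d) (T d))))))
      (half (i ℕ.* d ℕ.+ T d))
      where
      expand : ∀ i d → d ℕ.* (i ℕ.+ d ℕ.+ i ℕ.+ 1) ≡ i ℕ.* d ℕ.* 2 ℕ.+ d ℕ.* (d ℕ.+ 1)
      expand = solve-∀

    gap-formula : ℕ → RatFun
    gap-formula d = p^[ + (d ℕ.* (j ℕ.+ i ℕ.+ 1) ℕ./ 2) ⊕ ℤ.- + d s] - 1#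

    gap-value : gap-formula (j ℕ.∸ i) ≃ gap i (suc d) - 1#
    gap-value = ≃.trans (≃.reflexive (≡.cong gap-formula (ℕ.m+n∸m≡n i (suc d))))
      (minus-cong (≃.trans (power-mono (suc d ℕ.* (j ℕ.+ i ℕ.+ 1) ℕ./ 2) (suc d)) (mono-cong 0 (suc d) 0 (gap-exponent (suc d)))) ≃.refl)

  system₀ : System
  system₀ = record
    { m          = m χ₀
    ; b          = b χ₀
    ; mE         = m₀
    ; mO         = m₁
    ; cE         = c₀
    ; cO         = c₁
    ; m-lower    = λ j<i → ≃.reflexive (m-lower _ χ₀ j<i)
    ; m-even     = m₀-entry
    ; m-odd      = m₁-entry
    ; mE-0       = V.m₀-diagonal
    ; cE-0       = V.c₀-diagonal
    ; eigen-even = V.eigen₀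
    ; eigen-odd  = V.eigen₁
    ; b-lower    = λ j<i → ≃.reflexive (b-lower χ₀ j<i)
    ; b-diagonal = λ i → ≃.reflexive (b-diagonal χ₀ i)
    ; b-upper    = b-recursion χ₀
    }

  -- M vanishes on the odd superdiagonals. With zero entries there for C as well, the odd equations
  -- read 0 = 0 and the products of two odd steps drop out of the even ones.
  systemᵨ : System
  systemᵨ = record
    { m          = m χₚ
    ; b          = b χₚ
    ; mE         = mᵨ
    ; mO         = λ _ _ → 0#
    ; cE         = cᵨ
    ; cO         = λ _ _ → 0#
    ; m-lower    = λ j<i → ≃.reflexive (m-lower _ χₚ j<i)
    ; m-even     = mᵨ-entry
    ; m-odd      = mᵨ-odd-entry
    ; mE-0       = V.mᵨ-diagonal
    ; cE-0       = V.cᵨ-diagonal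
    ; eigen-even = λ i n → ≃.trans (conv-cong n λ a b _ → odd-terms i a b) (V.eigenᵨ i n)
    ; eigen-odd  = λ i n → ≃.trans (conv-cong n λ a b _ → ≃.trans (≃.+-cong (≃.zeroʳ _) (≃.zeroˡ _)) (≃.+-identityˡ _))
                             (≃.trans (conv-0 n) (≃.sym (≃.zeroʳ _)))
    ; b-lower    = λ j<i → ≃.reflexive (b-lower χₚ j<i)
    ; b-diagonal = λ i → ≃.reflexive (b-diagonal χₚ i)
    ; b-upper    = b-recursion χₚ
    }
    where
    odd-terms : ∀ i a b → mᵨ i a * cᵨ (i ℕ.+ a ℕ.* 2) b + shift (λ a b → 0# * 0#) a b ≃
                mᵨ i a * cᵨ (i ℕ.+ a ℕ.* 2) b
    odd-terms i zero    b = ≃.+-identityʳ _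
    odd-terms i (suc a) b = ≃.trans (≃.+-congˡ (≃.zeroˡ 0#)) (≃.+-identityʳ _)

  system : Character → System
  system χ₀ = system₀
  system χₚ = systemᵨ

  c : Character → ℕ → ℕ → RatFun
  c ψ = System.c (system ψ)

  -- Links the congruence of i and j in the theorem to the parity of j - i, by which the closed
  -- formula is organised.
  shifted-parity : ∀ i a → i ℕ.% 2 ≢ (i ℕ.+ suc (a ℕ.* 2)) ℕ.% 2
  shifted-parity i a e = flip i (≡.trans e (≡.trans (≡.cong (ℕ._% 2) (ℕ.+-suc i (a ℕ.* 2)))
    (ℕ.[m+kn]%n≡m%n (suc i) a 2)))
    where
    flip : ∀ i → i ℕ.% 2 ≢ suc i ℕ.% 2
    flip zero          ()
    flip (suc zero)    ()
    flip (suc (suc i)) = flip i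

  c-even-entry : ∀ {ψ} {formula : ℕ → ℕ → ℕ → RatFun} →
    (∀ i a → formula i (i ℕ.+ a ℕ.* 2) (a ℕ.* 2) ≃ System.cE (system ψ) i a) →
    ∀ i j → i ℕ.≤ j → i ℕ.% 2 ≡ j ℕ.% 2 → c ψ i j ≃ formula i j (j ℕ.∸ i)
  c-even-entry {ψ} {formula} value i j i≤j i≡j with ℕ.m≤n⇒∃[o]m+o≡n i≤j
  ... | d , ≡.refl with parity d
  ...   | odd a  = contradiction i≡j (shifted-parity i a)
  ...   | even a = ≃.trans (System.c-even (system ψ) i a) (≃.trans (≃.sym (value i a))
    (≃.reflexive (≡.cong (formula i (i ℕ.+ a ℕ.* 2)) (≡.sym (ℕ.m+n∸m≡n i (a ℕ.* 2))))))

  c-odd-entry : ∀ i j → i ℕ.≤ j → i ℕ.% 2 ≢ j ℕ.% 2 → c χ₀ i j ≃ c₁-formula i j (j ℕ.∸ i)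
  c-odd-entry i j i≤j i≢j with ℕ.m≤n⇒∃[o]m+o≡n i≤j
  ... | d , ≡.refl with parity d
  ...   | even a = contradiction (≡.sym (ℕ.[m+kn]%n≡m%n i a 2)) i≢j
  ...   | odd a  = ≃.trans (System.c-odd system₀ i a) (≃.trans (≃.sym (c₁-value i a))
    (≃.reflexive (≡.cong (c₁-formula i (i ℕ.+ suc (a ℕ.* 2))) (≡.sym (ℕ.m+n∸m≡n i (suc (a ℕ.* 2)))))))

  closed-form : Character → ∀ n → Matrix (suc n)
  closed-form ψ n = System.matrix (system ψ) (c ψ) (suc n)

  inverse : ∀ ψ n → closed-form ψ n IsInverseOf B ψ n
  -- Only for a concrete character does the matrix stored in `system ψ` reduce to `b ψ`, hence the
  -- split into two clauses of the same form.
  inverse χ₀ n = (λ i j → ≃⇒≈ (System.inverseʳ system₀ (suc n) i j)) ,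
                 (λ i j → ≃⇒≈ (System.inverseˡ system₀ (suc n) i j))
  inverse χₚ n = (λ i j → ≃⇒≈ (System.inverseʳ systemᵨ (suc n) i j)) ,
                 (λ i j → ≃⇒≈ (System.inverseˡ systemᵨ (suc n) i j))

  inverse-entry : ∀ ψ n C → C IsInverseOf B ψ n → ∀ x y → C x y ≃ c ψ (toℕ x) (toℕ y)
  inverse-entry ψ n C (_ , CB≈I) = TriangularMatrices.inverse-unique ratFunRing
    {B = B ψ n} {closed-form ψ n} {C}
    (λ i j → ≈⇒≃ (CB≈I i j)) (λ i j → ≈⇒≃ (proj₁ (inverse ψ n) i j))

proposition2p6 : (p : ℕ) → Prime p → ¬ (2 ∣ p) → (n : ℕ) →
  let open AtPrime p in
  (∀ ψ → ∃ λ C → C IsInverseOf B ψ n)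
  ×
  (∀ C → C IsInverseOf B χ₀ n →
    ∀ (x y : Fin (suc n)) → toℕ x ℕ.≤ toℕ y →
    let i = toℕ x
        j = toℕ y
        d = j ℕ.∸ i
    in
    (i ℕ.% 2 ≡ j ℕ.% 2 →
      C x y ≈
        (p^[ + (d ℕ.* (d ℕ.+ 2) ℕ./ 4) ⊕ ℤ.- + d s]
          * (1# - p^[ + i ⊕ -1ℤ s])
          * ∏[ suc i ⋯ j ] (λ k → p^ k - 1#))
        / ((1# - p^[ + j ⊕ -1ℤ s])
          * ∏[ 1 ⋯ d ℕ./ 2 ] (λ k →
              (1# - p^[ + (i ℕ.+ j ℕ.+ 2 ℕ.* k) ℤ.- 1ℤ ⊕ ℤ.- + 2 s])
              * (p^ (2 ℕ.* k) - 1#))))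
    ×
    (i ℕ.% 2 ≢ j ℕ.% 2 →
      C x y ≈
        (p^[ + ((d ℕ.* d ℕ.∸ 1) ℕ./ 4) ⊕ ℤ.- + d s]
          * ∏[ suc i ⋯ j ] (λ k → p^ k - 1#))
        / ((1# - p^[ + j ⊕ -1ℤ s])
          * ∏[ 1 ⋯ (d ℕ.∸ 1) ℕ./ 2 ] (λ k →
              (1# - p^[ + (i ℕ.+ j ℕ.+ 2 ℕ.* k) ⊕ ℤ.- + 2 s])
              * (p^ (2 ℕ.* k) - 1#)))))
  ×
  (∀ C → C IsInverseOf B χₚ n →
    ∀ (x y : Fin (suc n)) → toℕ x ℕ.≤ toℕ y →
    let i = toℕ x
        j = toℕ y
        d = j ℕ.∸ i
    in
    i ℕ.% 2 ≡ j ℕ.% 2 →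
      C x y ≈
        (fromℤ (legendre -1ℤ) ^ (d ℕ./ 2)
          * p^[ + (d ℕ./ 2 ℕ.* (d ℕ./ 2)) ⊕ ℤ.- + d s]
          * ∏[ suc i ⋯ j ] (λ k → p^ k - 1#))
        / ∏[ 1 ⋯ d ℕ./ 2 ] (λ k →
            (1# - p^[ + (i ℕ.+ j ℕ.+ 2 ℕ.* k) ℤ.- 1ℤ ⊕ ℤ.- + 2 s])
            * (p^ (2 ℕ.* k) - 1#)))
proposition2p6 p p-prime _ n =
  (λ ψ → closed-form ψ n , inverse ψ n) ,
  (λ C isInverse x y x≤y →
    let entry = inverse-entry χ₀ n C isInverse x y in
    (λ x≡y → ≃⇒≈ (≃.trans entry (c-even-entry {χ₀} {c₀-formula} c₀-value (toℕ x) (toℕ y) x≤y x≡y))) ,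
    (λ x≢y → ≃⇒≈ (≃.trans entry (c-odd-entry (toℕ x) (toℕ y) x≤y x≢y)))) ,
  (λ C isInverse x y x≤y x≡y → ≃⇒≈ (≃.trans (inverse-entry χₚ n C isInverse x y)
    (c-even-entry {χₚ} {cᵨ-formula} cᵨ-value (toℕ x) (toℕ y) x≤y x≡y)))
  where open Evaluation p (ℕ.nonTrivial⇒n>1 p {{prime⇒nonTrivial p-prime}})
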